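{- There is an absolute constant $C>0$ such that for every $n\ge 3$, every base graph $G$ on $n$ vertices and every number of arrivals $T\ge 1$, there is an online algorithm $\mathcal{A}$ (which knows $G$ in advance) for online graph balancing with $T$ i.i.d. uniform arrivals from $E(G)$ satisfying $\mathcal{A}(G,T)\le C\log\log n\cdot \mathrm{OPT}(G,T)$. That is, there is an $O(\log\log n)$-competitive online algorithm for every base graph $G$ and every number of arrivals.
   Context: Online graph balancing with i.i.d. arrivals: a base graph $G=(V,E)$ with $|V|=n$ and $E\neq\emptyset$ is known in advance. At each time step $t=1,\dots,T$ an edge $e_t$ is drawn independently and uniformly at random from $E$ (with replacement), and upon its arrival the algorithm must irrevocably orient $e_t$ towards one of its endpoints, using only $G$ and $e_1,\dots,e_t$ (and previous decisions). The load of a vertex is the number of arrived edges oriented into it; the goal is to minimize the maximum load. Let $G'$ be the sampled multigraph formed by $e_1,\dots,e_T$, and $M^*(G')$ the minimum over all orientations of the edges of $G'$ of the maximum load (the offline optimum). Define $\mathrm{OPT}(G,T)=\mathbb{E}[M^*(G')]$ and, for an online algorithm $\mathcal{A}$, $\mathcal{A}(G,T)=\mathbb{E}[\text{maximum load produced by }\mathcal{A}]$. An algorithm is $\alpha$-competitive if $\mathcal{A}(G,T)\le \alpha\,\mathrm{OPT}(G,T)$. -}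

module Defs where

open import Data.Nat using (ℕ; zero; suc; _+_; _*_; _^_; _⊔_; _⊓_; NonZero)
open import Data.Nat.Properties using (m^n≢0)
open import Data.Nat.Logarithm using (⌈log₂_⌉)
open import Data.Bool using (Bool; true; false; if_then_else_)
open import Data.Fin using (Fin; _<_; _≟_)
open import Data.Product using (_×_; _,_; proj₁; proj₂)
open import Data.List using (List; []; _∷_; _++_; [_]; length; lookup; allFin; map; foldr; concatMap)
open import Data.Nat.ListAction using (sum)
open import Data.List.Relation.Unary.All using (All)
open import Data.List.Relation.Unary.Unique.Propositional using (Unique)
open import Data.Vec using (Vec; toList)
import Data.Vec as V
open import Data.Integer using (+_)
open import Data.Rational using (ℚ; _/_)
open import Relation.Nullary using (does)

-- A finite simple graph on vertex set Fin n with a nonempty edge set.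
-- Each undirected edge {u,v} is stored exactly once as the pair (u , v) with u < v.
record Graph (n : ℕ) : Set where
  field
    edges    : List (Fin n × Fin n)
    ordered  : All (λ e → proj₁ e < proj₂ e) edges
    distinct : Unique edges
    {{nonempty}} : NonZero (length edges)

open Graph public

#E : ∀ {n} → Graph n → ℕ
#E G = length (edges G)

Edge : ∀ {n} → Graph n → Set
Edge G = Fin (#E G)

endpoints : ∀ {n} (G : Graph n) → Edge G → Fin n × Fin n
endpoints G i = lookup (edges G) i

head : ∀ {n} (G : Graph n) → Bool → Edge G → Fin n
head G b i = if b then proj₁ (endpoints G i) else proj₂ (endpoints G i)

load : ∀ {n} → List (Fin n) → Fin n → ℕ
load hs v = length (Data.List.filter (λ w → w ≟ v) hs)

maxLoad : ∀ {n} → List (Fin n) → ℕ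
maxLoad {n} hs = foldr (λ v acc → load hs v ⊔ acc) 0 (allFin n)

allVecs : ∀ {A : Set} → List A → (T : ℕ) → List (Vec A T)
allVecs xs zero = V.[] ∷ []
allVecs xs (suc T) = concatMap (λ x → map (x V.∷_) (allVecs xs T)) xs

bools : List Bool
bools = true ∷ false ∷ []

-- A deterministic online algorithm for base graph G: given the sequence of
-- previously arrived edges (in arrival order) and the newly arrived edge,
-- it returns the orientation of the new edge.
OnlineAlg : ∀ {n} → Graph n → Set
OnlineAlg G = List (Edge G) → Edge G → Bool

run : ∀ {n} (G : Graph n) → OnlineAlg G → List (Edge G) → List (Edge G) → List (Fin n)
run G A past [] = []
run G A past (e ∷ es) = head G (A past e) e ∷ run G A (past ++ [ e ]) es

-- M*(G') : offline optimum of the sampled multigraph given by the arrival sequence.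
-- Minimum over all orientations; T is a valid initial value since every max load ≤ T.
offlineOpt : ∀ {n} (G : Graph n) {T : ℕ} → Vec (Edge G) T → ℕ
offlineOpt G {T} es =
  foldr (λ o acc → maxLoad (toList (V.zipWith (head G) o es)) ⊓ acc) T (allVecs bools T)

expect : ∀ {n} (G : Graph n) (T : ℕ) → (Vec (Edge G) T → ℕ) → ℚ
expect G T f = _/_ (+ sum (map f (allVecs (allFin (#E G)) T))) (#E G ^ T) {{m^n≢0 (#E G) T}}

OPT : ∀ {n} (G : Graph n) (T : ℕ) → ℚ
OPT G T = expect G T (offlineOpt G)

ALG : ∀ {n} (G : Graph n) (T : ℕ) → OnlineAlg G → ℚ
ALG G T A = expect G T (λ es → maxLoad (run G A [] (toList es)))

-- integer version of log log n (⌈log₂ ⌈log₂ n⌉⌉), within constant factors of ln ln n for n ≥ 3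
loglog : ℕ → ℕ
loglog n = ⌈log₂ ⌈log₂ n ⌉ ⌉

{-# OPTIONS --safe #-}

-- Let m be the number of edges and let K be the rounded-up optimum, so that a random sequence has
-- offline optimum at most 4K with probability 3/4.
--
-- Decomposition.  The density of G is at most Km/T, so peeling off vertices of small degree orients G
-- with in-degrees at most d 0 = 2Km/T.  Suppose a set S of tails sends more than d′ edges to each head
-- of a set B.  If B were much larger than S, then some heads of B would by chance receive 10K arrivals,
-- which S could not absorb; hence |B| ≤ Q|S| with Q = (64X)^(10K) and d′ ≈ 2Km/(TX).  Peeling off tails
-- again, the edges split into a part with out-degrees at most Qd and a part with in-degrees at most d′.
-- Repeating this with X j = 2^(2^j-1) gives loglog n + 2 scales, whose in-degrees d j decrease doubly
-- exponentially.
--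
-- Algorithm.  An edge of scale j tries its head in layer j, its tail in layer j+1, its head again in
-- layer j+2, and so on; every vertex accepts O(K) edges per layer.  If the last layer rejects an edge,
-- the algorithm forgets its state and starts afresh; as this happens with probability at most 1/2, the
-- expected number of restarts is at most 1.
--
-- Rejection.  A vertex that is full in layer i is either full of edges of scale i, which is doubly
-- exponentially unlikely, or full of edges whose other endpoint was full in layer i-1.  In the second
-- case the density bound 4K of the sampled graph gives, for a set of a such vertices, at least 8a
-- distinct vertices full in layer i-1, and 4a of them are of the same kind.  Iterating, a rejection
-- produces a tree with 4^D leaves of the first kind, and a union bound over these trees, with the
-- probability of each one estimated by an exponential change of measure, shows that they are rare.

module Submission where

import Algebra.Properties.CommutativeSemigroup as CommutativeSemigroupProperties
open import Defs
open import Data.Bool using (Bool; true; false; not; T; if_then_else_; _∧_)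
open import Data.Bool.Properties using (T?; ∧-identityʳ; ∧-zeroʳ)
open import Data.Fin using (Fin)
import Data.Fin as F
import Data.Fin.Properties as FP
import Data.Integer as ℤ
import Data.Integer.Properties as ℤP
open import Data.List using (List; []; _∷_; _++_; [_]; length; lookup; allFin; map; foldr; concatMap; filter; take)
open import Data.List.Properties using (length-tabulate; length-map; length-++; length-take)
open import Data.List.Membership.Propositional using (_∈_; _∉_)
import Data.List.Membership.DecPropositional as DecMembership
open import Data.List.Membership.Propositional.Properties using (∈-allFin; ∈-map⁺; ∈-map⁻; ∈-filter⁺; ∈-filter⁻; ∈-++⁺ˡ; ∈-++⁺ʳ; ∈-++⁻; ∈-concatMap⁺; ∈-concatMap⁻; ∈-lookup)
open import Data.List.Relation.Unary.All using (All; []; _∷_)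
import Data.List.Relation.Unary.All as All
import Data.List.Relation.Unary.All.Properties as AllP
open import Data.List.Relation.Unary.Any using (here; there)
import Data.List.Relation.Unary.Any as Any
open import Data.List.Relation.Unary.AllPairs using ([]; _∷_)
open import Data.List.Relation.Unary.Unique.Propositional using (Unique)
import Data.List.Relation.Unary.Unique.Propositional.Properties as UniqueP
open import Data.List.Relation.Binary.Sublist.Propositional using (_⊆_; []; _∷_; _∷ʳ_; ⊆-trans)
import Data.List.Relation.Binary.Sublist.Propositional as Sublist
import Data.List.Relation.Binary.Sublist.Propositional.Properties as SublistP
open import Data.Nat
open import Data.Nat.DivMod using (m/n*n≤m; m≡m%n+[m/n]*n; m%n<n; m<n⇒m/n≡0)
open import Data.Nat.ListAction using (sum)
open import Data.Nat.Logarithm using (⌈log₂_⌉; ⌈log₂⌉-mono-≤; ⌈log₂⌈n/2⌉⌉≡⌈log₂n⌉∸1)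
open import Data.Nat.Properties
open import Data.Nat.Tactic.RingSolver using (solve-∀)
open import Data.Product using (Σ; ∃-syntax; _×_; _,_; proj₁; proj₂)
open import Data.Product.Properties using (≡-dec)
open import Data.Rational using (ℚ) renaming (_*_ to _*ℚ_)
import Data.Rational as ℚ
import Data.Rational.Properties as ℚP
open import Data.Rational.Unnormalised using (mkℚᵘ; *≤*)
import Data.Rational.Unnormalised.Properties as ℚᵘP
open import Data.Sum using (_⊎_; inj₁; inj₂)
open import Data.Unit using (tt)
open import Data.Vec using (Vec; toList)
import Data.Vec as V
open import Function using (_∘_; id)
open import Relation.Binary.PropositionalEquality using (_≡_; _≢_; refl; sym; trans; cong; cong₂; subst; subst₂)
open import Relation.Nullary using (Dec; yes; no; ¬_; does; contradiction)
open import Relation.Nullary.Decidable using (_×-dec_; ¬?)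
open ≤-Reasoning

-- Sums over lists and over arrival sequences

-- The scales are calibrated for one competition. A tree edge in layer `i` may be any edge of
-- smaller scale, and its choice costs a factor `P i = 2 ^ (75 * K * 2 ^ i)`; a leaf in layer `j`
-- earns only about `2 ^ (L * 2 ^ j)`. Each step down halves the exponent that a leaf earns, so the
-- number of vertices must more than double per step. Branching by 4 does this, and `L = 302 * K`
-- balances the account. For the same reason it is affordable to square `X` (up to a factor 2) from
-- one scale to the next, and then about loglog n scales suffice for `X` to exceed the number of
-- edges. An edge changes sides in every layer so that the vertex it is pushed to and the full
-- vertex it comes from are its two ends; only then does the density of the sampled graph force
-- branching. As either end may thus be the target, every scale needs an out-degree bound as well,
-- even one that is weaker by the large factor `Q`. Probabilities are cleared of denominators
-- throughout: an event is counted among the `#E G ^ t` equally likely sequences.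

module +-CS = CommutativeSemigroupProperties +-commutativeSemigroup
module *-CS = CommutativeSemigroupProperties *-commutativeSemigroup

∑ : {A : Set} → List A → (A → ℕ) → ℕ
∑ []       f = 0
∑ (x ∷ xs) f = f x + ∑ xs f

χ : {P : Set} → Dec P → ℕ
χ (yes _) = 1
χ (no _)  = 0

χ-yes : {P : Set} (p? : Dec P) → P → χ p? ≡ 1
χ-yes (yes _) _ = refl
χ-yes (no ¬p) p = contradiction p ¬p

1≤χ : {P : Set} (p? : Dec P) → P → 1 ≤ χ p?
1≤χ p? p = ≤-reflexive (sym (χ-yes p? p))

χ-no : {P : Set} (p? : Dec P) → ¬ P → χ p? ≡ 0
χ-no (yes p) ¬p = contradiction p ¬p
χ-no (no _)  _  = refl

χ≤1 : {P : Set} (p? : Dec P) → χ p? ≤ 1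
χ≤1 (yes _) = ≤-refl
χ≤1 (no _)  = z≤n

χ≤ : {P : Set} (p? : Dec P) {x : ℕ} → (P → 1 ≤ x) → χ p? ≤ x
χ≤ (yes p) f = f p
χ≤ (no _)  _ = z≤n

χ-mono : {P Q : Set} (p? : Dec P) (q? : Dec Q) → (P → Q) → χ p? ≤ χ q?
χ-mono (no _)  _  _ = z≤n
χ-mono (yes p) q? f = 1≤χ q? (f p)

χ-cong : {P Q : Set} (p? : Dec P) (q? : Dec Q) → (P → Q) → (Q → P) → χ p? ≡ χ q?
χ-cong p? q? f g = ≤-antisym (χ-mono p? q? f) (χ-mono q? p? g)

χ-× : {P Q : Set} (p? : Dec P) (q? : Dec Q) → χ (p? ×-dec q?) ≡ χ p? * χ q?
χ-× (yes _) (yes _) = refl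
χ-× (yes _) (no _)  = refl
χ-× (no _)  _       = refl

module _ {A : Set} where

  ∑-cong∈ : (xs : List A) {f g : A → ℕ} → (∀ x → x ∈ xs → f x ≡ g x) → ∑ xs f ≡ ∑ xs g
  ∑-cong∈ []       h = refl
  ∑-cong∈ (x ∷ xs) h = cong₂ _+_ (h x (here refl)) (∑-cong∈ xs (λ y y∈ → h y (there y∈)))

  ∑-cong : (xs : List A) {f g : A → ℕ} → (∀ x → f x ≡ g x) → ∑ xs f ≡ ∑ xs g
  ∑-cong xs h = ∑-cong∈ xs (λ x _ → h x)

  ∑-mono∈ : (xs : List A) {f g : A → ℕ} → (∀ x → x ∈ xs → f x ≤ g x) → ∑ xs f ≤ ∑ xs g
  ∑-mono∈ []       h = z≤n
  ∑-mono∈ (x ∷ xs) h = +-mono-≤ (h x (here refl)) (∑-mono∈ xs (λ y y∈ → h y (there y∈)))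

  ∑-mono : (xs : List A) {f g : A → ℕ} → (∀ x → f x ≤ g x) → ∑ xs f ≤ ∑ xs g
  ∑-mono xs h = ∑-mono∈ xs (λ x _ → h x)

  ∑-const : (xs : List A) (c : ℕ) → ∑ xs (λ _ → c) ≡ length xs * c
  ∑-const []       c = refl
  ∑-const (x ∷ xs) c = cong (c +_) (∑-const xs c)

  ∑-zero : (xs : List A) → ∑ xs (λ _ → 0) ≡ 0
  ∑-zero xs = trans (∑-const xs 0) (*-zeroʳ (length xs))

  ∑-+ : (xs : List A) (f g : A → ℕ) → ∑ xs (λ x → f x + g x) ≡ ∑ xs f + ∑ xs g
  ∑-+ []       f g = refl
  ∑-+ (x ∷ xs) f g = trans (cong (f x + g x +_) (∑-+ xs f g)) (lemma (f x) (g x) (∑ xs f) (∑ xs g))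
    where
    lemma : ∀ a b c d → a + b + (c + d) ≡ a + c + (b + d)
    lemma = solve-∀

  ∑-*ˡ : (xs : List A) (c : ℕ) (f : A → ℕ) → ∑ xs (λ x → c * f x) ≡ c * ∑ xs f
  ∑-*ˡ []       c f = sym (*-zeroʳ c)
  ∑-*ˡ (x ∷ xs) c f = trans (cong (c * f x +_) (∑-*ˡ xs c f)) (sym (*-distribˡ-+ c (f x) (∑ xs f)))

  ∑-*ʳ : (xs : List A) (c : ℕ) (f : A → ℕ) → ∑ xs (λ x → f x * c) ≡ ∑ xs f * c
  ∑-*ʳ xs c f = trans (∑-cong xs (λ x → *-comm (f x) c)) (trans (∑-*ˡ xs c f) (*-comm c _))

  ∑-++ : (xs ys : List A) (f : A → ℕ) → ∑ (xs ++ ys) f ≡ ∑ xs f + ∑ ys f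
  ∑-++ []       ys f = refl
  ∑-++ (x ∷ xs) ys f = trans (cong (f x +_) (∑-++ xs ys f)) (sym (+-assoc (f x) _ _))

  ∈⇒≤∑ : {xs : List A} (f : A → ℕ) {x : A} → x ∈ xs → f x ≤ ∑ xs f
  ∈⇒≤∑ f (here refl) = m≤m+n _ _
  ∈⇒≤∑ f (there x∈)  = ≤-trans (∈⇒≤∑ f x∈) (m≤n+m _ _)

  sum-map : (f : A → ℕ) (xs : List A) → sum (map f xs) ≡ ∑ xs f
  sum-map f []       = refl
  sum-map f (x ∷ xs) = cong (f x +_) (sum-map f xs)

  averaging : (xs : List A) (f g : A → ℕ) → xs ≢ [] → ∑ xs f ≤ ∑ xs g → ∃[ x ] (x ∈ xs × f x ≤ g x)
  averaging []       f g ne _ = contradiction refl ne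
  averaging (x ∷ xs) f g _  h with f x ≤? g x
  ... | yes le = x , here refl , le
  averaging (x ∷ [])     f g _ h | no ≰ =
    contradiction (+-cancelʳ-≤ 0 _ _ h) ≰
  averaging (x ∷ y ∷ xs) f g _ h | no ≰ with averaging (y ∷ xs) f g (λ ()) (+-cancelˡ-≤ (f x) _ _ (≤-trans h (+-monoˡ-≤ _ (<⇒≤ (≰⇒> ≰)))))
  ... | z , z∈ , le = z , there z∈ , le

  length-filter : {P : A → Set} (P? : ∀ x → Dec (P x)) (xs : List A) → length (filter P? xs) ≡ ∑ xs (λ x → χ (P? x))
  length-filter P? [] = refl
  length-filter P? (x ∷ xs) with P? x
  ... | yes p = cong suc (length-filter P? xs)
  ... | no ¬p = length-filter P? xs

  ∑-filter : {P : A → Set} (P? : ∀ x → Dec (P x)) (xs : List A) (f : A → ℕ) → ∑ (filter P? xs) f ≡ ∑ xs (λ x → χ (P? x) * f x)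
  ∑-filter P? [] f = refl
  ∑-filter P? (x ∷ xs) f with P? x
  ... | yes p = cong₂ _+_ (sym (+-identityʳ (f x))) (∑-filter P? xs f)
  ... | no ¬p = ∑-filter P? xs f

module _ {A B : Set} where

  ∑-swap : (xs : List A) (ys : List B) (f : A → B → ℕ) → ∑ xs (λ x → ∑ ys (f x)) ≡ ∑ ys (λ y → ∑ xs (λ x → f x y))
  ∑-swap []       ys f = sym (∑-zero ys)
  ∑-swap (x ∷ xs) ys f = trans (cong (∑ ys (f x) +_) (∑-swap xs ys f)) (sym (∑-+ ys (f x) _))

  ∑-map : (g : A → B) (xs : List A) (f : B → ℕ) → ∑ (map g xs) f ≡ ∑ xs (f ∘ g)
  ∑-map g []       f = refl
  ∑-map g (x ∷ xs) f = cong (f (g x) +_) (∑-map g xs f)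

  ∑-concatMap : (g : A → List B) (xs : List A) (f : B → ℕ) → ∑ (concatMap g xs) f ≡ ∑ xs (λ x → ∑ (g x) f)
  ∑-concatMap g []       f = refl
  ∑-concatMap g (x ∷ xs) f = trans (∑-++ (g x) (concatMap g xs) f) (cong (∑ (g x) f +_) (∑-concatMap g xs f))

length≡∑ : {A : Set} (xs : List A) → length xs ≡ ∑ xs (λ _ → 1)
length≡∑ xs = sym (trans (∑-const xs 1) (*-identityʳ (length xs)))

length-allFin : ∀ n → length (allFin n) ≡ n
length-allFin n = length-tabulate id

module _ {A : Set} (_≟ᴬ_ : (x y : A) → Dec (x ≡ y)) where

  ∑-δ-∉ : (xs : List A) (a : A) (f : A → ℕ) → a ∉ xs → ∑ xs (λ x → χ (a ≟ᴬ x) * f x) ≡ 0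
  ∑-δ-∉ xs a f a∉ = trans (∑-cong∈ xs (λ x x∈ → cong (_* f x) (χ-no (a ≟ᴬ x) (λ { refl → a∉ x∈ })))) (∑-zero xs)

  ∑-δ : {xs : List A} → Unique xs → {a : A} (f : A → ℕ) → a ∈ xs → ∑ xs (λ x → χ (a ≟ᴬ x) * f x) ≡ f a
  ∑-δ {x ∷ xs} (x∉ ∷ u) {a} f (here refl) = begin-equality
    χ (a ≟ᴬ a) * f a + ∑ xs _ ≡⟨ cong₂ _+_ (cong (_* f a) (χ-yes (a ≟ᴬ a) refl)) (∑-δ-∉ xs a f (λ a∈ → All.lookup x∉ a∈ refl)) ⟩
    f a + 0 + 0 ≡⟨ trans (+-identityʳ _) (+-identityʳ _) ⟩
    f a ∎
  ∑-δ {x ∷ xs} (x∉ ∷ u) {a} f (there a∈) =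
    trans (cong (_+ ∑ xs (λ z → χ (a ≟ᴬ z) * f z)) (cong (_* f x) (χ-no (a ≟ᴬ x) (λ { refl → All.lookup x∉ a∈ refl })))) (∑-δ u f a∈)

∑-δ-allFin : ∀ {n} (v : Fin n) (f : Fin n → ℕ) → ∑ (allFin n) (λ w → χ (v FP.≟ w) * f w) ≡ f v
∑-δ-allFin {n} v f = ∑-δ FP._≟_ (UniqueP.allFin⁺ n) f (∈-allFin v)

∑-allVecs : {A : Set} (xs : List A) (t : ℕ) (f : Vec A (suc t) → ℕ) →
  ∑ (allVecs xs (suc t)) f ≡ ∑ xs (λ x → ∑ (allVecs xs t) (λ s → f (x V.∷ s)))
∑-allVecs xs t f = trans (∑-concatMap (λ x → map (x V.∷_) (allVecs xs t)) xs f)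
  (∑-cong xs (λ x → ∑-map (x V.∷_) (allVecs xs t) f))

length-allVecs : {A : Set} (xs : List A) (t : ℕ) → length (allVecs xs t) ≡ length xs ^ t
length-allVecs xs zero    = refl
length-allVecs xs (suc t) = begin-equality
  length (allVecs xs (suc t)) ≡⟨ length≡∑ (allVecs xs (suc t)) ⟩
  ∑ (allVecs xs (suc t)) (λ _ → 1) ≡⟨ ∑-allVecs xs t (λ _ → 1) ⟩
  ∑ xs (λ _ → ∑ (allVecs xs t) (λ _ → 1)) ≡⟨ ∑-const xs _ ⟩
  length xs * ∑ (allVecs xs t) (λ _ → 1) ≡⟨ cong (length xs *_) (trans (sym (length≡∑ (allVecs xs t))) (length-allVecs xs t)) ⟩
  length xs * length xs ^ t ∎

∈-allVecs : {A : Set} {xs : List A} → (∀ x → x ∈ xs) → ∀ {t} (s : Vec A t) → s ∈ allVecs xs t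
∈-allVecs all V.[]      = here refl
∈-allVecs all (x V.∷ s) = ∈-concatMap⁺ _ (Any.map (λ { refl → ∈-map⁺ (x V.∷_) (∈-allVecs all s) }) (all x))

∏ : {A : Set} → List A → (A → ℕ) → ℕ
∏ []       f = 1
∏ (x ∷ xs) f = f x * ∏ xs f

-- Independence of the arrivals. It evaluates the exponential moments in the union bound over
-- witness trees.
∑-∏ : {A : Set} (xs : List A) (t : ℕ) (y : A → ℕ) → ∑ (allVecs xs t) (λ s → ∏ (toList s) y) ≡ ∑ xs y ^ t
∑-∏ xs zero    y = refl
∑-∏ xs (suc t) y = begin-equality
  ∑ (allVecs xs (suc t)) (λ s → ∏ (toList s) y) ≡⟨ ∑-allVecs xs t _ ⟩
  ∑ xs (λ x → ∑ (allVecs xs t) (λ s → y x * ∏ (toList s) y)) ≡⟨ ∑-cong xs (λ x → ∑-*ˡ (allVecs xs t) (y x) _) ⟩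
  ∑ xs (λ x → y x * ∑ (allVecs xs t) (λ s → ∏ (toList s) y)) ≡⟨ ∑-*ʳ xs _ y ⟩
  ∑ xs y * ∑ (allVecs xs t) (λ s → ∏ (toList s) y) ≡⟨ cong (∑ xs y *_) (∑-∏ xs t y) ⟩
  ∑ xs y * ∑ xs y ^ t ∎

∏-++ : {A : Set} (xs ys : List A) (y : A → ℕ) → ∏ (xs ++ ys) y ≡ ∏ xs y * ∏ ys y
∏-++ []       ys y = sym (*-identityˡ _)
∏-++ (x ∷ xs) ys y = trans (cong (y x *_) (∏-++ xs ys y)) (sym (*-assoc (y x) _ _))

^-distribʳ-* : ∀ o m n → (m * n) ^ o ≡ m ^ o * n ^ o
^-distribʳ-* zero    m n = refl
^-distribʳ-* (suc o) m n = trans (cong (m * n *_) (^-distribʳ-* o m n)) (*-CS.interchange m n (m ^ o) (n ^ o))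

n<2^n : ∀ n → n < 2 ^ n
n<2^n zero    = s≤s z≤n
n<2^n (suc n) = +-mono-≤ (m^n>0 2 n) (≤-trans (n<2^n n) (≤-reflexive (sym (+-identityʳ _))))

-- The offline optimum and the density of the sampled graph

module _ {n : ℕ} where

  open DecMembership (FP._≟_ {n}) using (_∈?_) public

  count∈≤length : (Z : List (Fin n)) → ∑ (allFin n) (λ v → χ (v ∈? Z)) ≤ length Z
  count∈≤length Z = begin
    ∑ (allFin n) (λ v → χ (v ∈? Z)) ≤⟨ ∑-mono (allFin n) pointwise ⟩
    ∑ (allFin n) (λ v → ∑ Z (λ z → χ (z FP.≟ v))) ≡⟨ ∑-swap (allFin n) Z _ ⟩
    ∑ Z (λ z → ∑ (allFin n) (λ v → χ (z FP.≟ v))) ≡⟨ ∑-cong Z (λ z → trans (∑-cong (allFin n) (λ v → sym (*-identityʳ _))) (∑-δ-allFin z (λ _ → 1))) ⟩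
    ∑ Z (λ _ → 1) ≡⟨ length≡∑ Z ⟨
    length Z ∎
    where
    pointwise : ∀ v → χ (v ∈? Z) ≤ ∑ Z (λ z → χ (z FP.≟ v))
    pointwise v with v ∈? Z
    ... | no _  = z≤n
    ... | yes p = ≤-trans (1≤χ (v FP.≟ v) refl) (∈⇒≤∑ (λ z → χ (z FP.≟ v)) p)

  load≡∑ : (hs : List (Fin n)) (v : Fin n) → load hs v ≡ ∑ hs (λ w → χ (w FP.≟ v))
  load≡∑ hs v = length-filter (λ w → w FP.≟ v) hs

  private
    maxOver : List (Fin n) → List (Fin n) → ℕ
    maxOver hs vs = foldr (λ v acc → load hs v ⊔ acc) 0 vs

    load≤maxOver : ∀ hs {vs v} → v ∈ vs → load hs v ≤ maxOver hs vs
    load≤maxOver hs {v ∷ vs} (here refl) = m≤m⊔n (load hs v) (maxOver hs vs)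
    load≤maxOver hs {w ∷ vs} (there v∈)  = ≤-trans (load≤maxOver hs v∈) (m≤n⊔m (load hs w) (maxOver hs vs))

    maxOver≤ : ∀ hs vs {M} → (∀ v → load hs v ≤ M) → maxOver hs vs ≤ M
    maxOver≤ hs []       h = z≤n
    maxOver≤ hs (v ∷ vs) h = ⊔-lub (h v) (maxOver≤ hs vs h)

  load≤maxLoad : ∀ hs v → load hs v ≤ maxLoad hs
  load≤maxLoad hs v = load≤maxOver hs (∈-allFin v)

  maxLoad≤ : ∀ hs {M} → (∀ v → load hs v ≤ M) → maxLoad hs ≤ M
  maxLoad≤ hs h = maxOver≤ hs (allFin n) h

  load≤length : (hs : List (Fin n)) (v : Fin n) → load hs v ≤ length hs
  load≤length hs v = begin
    load hs v ≡⟨ load≡∑ hs v ⟩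
    ∑ hs (λ w → χ (w FP.≟ v)) ≤⟨ ∑-mono hs (λ w → χ≤1 (w FP.≟ v)) ⟩
    ∑ hs (λ _ → 1) ≡⟨ length≡∑ hs ⟨
    length hs ∎

card : ∀ {n} → (Fin n → Bool) → ℕ
card {n} S = ∑ (allFin n) (λ v → χ (T? (S v)))

∈-bools : ∀ b → b ∈ bools
∈-bools true  = here refl
∈-bools false = there (here refl)

module _ {n : ℕ} (G : Graph n) where

  private
    vs : List (Fin n)
    vs = allFin n

  oriented : ∀ {t} → Vec Bool t → Vec (Edge G) t → List (Bool × Edge G)
  oriented o es = toList (V.zip o es)

  headLoad : List (Bool × Edge G) → Fin n → ℕ
  headLoad ps v = ∑ ps (λ p → χ (head G (proj₁ p) (proj₂ p) FP.≟ v))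

  -- The witnessed form of an offline optimum of at most `M`; `offlineOpt-balanced` and
  -- `offlineOpt-least` translate between the two.
  Balanced : ∀ {t} → Vec (Edge G) t → ℕ → Set
  Balanced {t} es M = Σ (Vec Bool t) (λ o → ∀ v → headLoad (oriented o es) v ≤ M)

  zipWith-oriented : ∀ {t} (o : Vec Bool t) (es : Vec (Edge G) t) (f : Fin n → ℕ) →
    ∑ (toList (V.zipWith (head G) o es)) f ≡ ∑ (oriented o es) (λ p → f (head G (proj₁ p) (proj₂ p)))
  zipWith-oriented V.[]      V.[]       f = refl
  zipWith-oriented (b V.∷ o) (e V.∷ es) f = cong (f (head G b e) +_) (zipWith-oriented o es f)

  ∑-oriented : ∀ {t} (o : Vec Bool t) (es : Vec (Edge G) t) (f : Edge G → ℕ) →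
    ∑ (toList es) f ≡ ∑ (oriented o es) (f ∘ proj₂)
  ∑-oriented V.[]      V.[]       f = refl
  ∑-oriented (b V.∷ o) (e V.∷ es) f = cong (f e +_) (∑-oriented o es f)

  heads : ∀ {t} → Vec Bool t → Vec (Edge G) t → List (Fin n)
  heads o es = toList (V.zipWith (head G) o es)

  load-zipWith : ∀ {t} (o : Vec Bool t) (es : Vec (Edge G) t) (v : Fin n) →
    load (heads o es) v ≡ headLoad (oriented o es) v
  load-zipWith o es v = trans (load≡∑ (heads o es) v) (zipWith-oriented o es _)

  private
    minOver : ∀ {t} → Vec (Edge G) t → List (Vec Bool t) → ℕ
    minOver {t} es = foldr (λ o acc → maxLoad (heads o es) ⊓ acc) t

    minOver≤ : ∀ {t} (es : Vec (Edge G) t) {os o} → o ∈ os → minOver es os ≤ maxLoad (heads o es)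
    minOver≤ es {o ∷ os}  (here refl) = m⊓n≤m (maxLoad (heads o es)) (minOver es os)
    minOver≤ es {o′ ∷ os} (there o∈)  = ≤-trans (m⊓n≤n (maxLoad (heads o′ es)) (minOver es os)) (minOver≤ es o∈)

    headLoad≤length : ∀ {t} (o : Vec Bool t) (es : Vec (Edge G) t) v → headLoad (oriented o es) v ≤ t
    headLoad≤length V.[]      V.[]       v = z≤n
    headLoad≤length (b V.∷ o) (e V.∷ es) v = +-mono-≤ (χ≤1 (head G b e FP.≟ v)) (headLoad≤length o es v)

    minOver-balanced : ∀ {t} (es : Vec (Edge G) t) os → Balanced es (minOver es os)
    -- The start value `t` of the minimum is also realised by an orientation, because no load of `t`
    -- arrivals exceeds `t`.
    minOver-balanced {t} es []       = V.replicate t true , headLoad≤length (V.replicate t true) es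
    minOver-balanced     es (o ∷ os) with ⊓-sel (maxLoad (heads o es)) (minOver es os)
    ... | inj₁ eq = subst (Balanced es) (sym eq) (o , λ v → subst (_≤ maxLoad (heads o es)) (load-zipWith o es v) (load≤maxLoad (heads o es) v))
    ... | inj₂ eq = subst (Balanced es) (sym eq) (minOver-balanced es os)

  offlineOpt-balanced : ∀ {t} (es : Vec (Edge G) t) → Balanced es (offlineOpt G es)
  offlineOpt-balanced {t} es = minOver-balanced es (allVecs bools t)

  offlineOpt-least : ∀ {t} (es : Vec (Edge G) t) {M} → Balanced es M → offlineOpt G es ≤ M
  offlineOpt-least es (o , h) = ≤-trans (minOver≤ es (∈-allVecs ∈-bools o))
    (maxLoad≤ (heads o es) (λ v → ≤-trans (≤-reflexive (load-zipWith o es v)) (h v)))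

  offlineOpt≥1 : ∀ {t} (es : Vec (Edge G) (suc t)) → 1 ≤ offlineOpt G es
  offlineOpt≥1 (e V.∷ es) with offlineOpt-balanced (e V.∷ es)
  ... | b V.∷ o , h = begin
    1 ≡⟨ χ-yes (head G b e FP.≟ head G b e) refl ⟨
    χ (head G b e FP.≟ head G b e) ≤⟨ m≤m+n _ _ ⟩
    headLoad (oriented (b V.∷ o) (e V.∷ es)) (head G b e) ≤⟨ h (head G b e) ⟩
    offlineOpt G (e V.∷ es) ∎

  ∑-headLoad : (ps : List (Bool × Edge G)) (f : Fin n → ℕ) →
    ∑ ps (λ p → f (head G (proj₁ p) (proj₂ p))) ≡ ∑ vs (λ v → headLoad ps v * f v)
  ∑-headLoad ps f = begin-equality
    ∑ ps (λ p → f (hd p)) ≡⟨ ∑-cong ps (λ p → ∑-δ-allFin (hd p) f) ⟨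
    ∑ ps (λ p → ∑ vs (λ v → χ (hd p FP.≟ v) * f v)) ≡⟨ ∑-swap ps vs _ ⟩
    ∑ vs (λ v → ∑ ps (λ p → χ (hd p FP.≟ v) * f v)) ≡⟨ ∑-cong vs (λ v → ∑-*ʳ ps (f v) _) ⟩
    ∑ vs (λ v → headLoad ps v * f v) ∎
    where
    hd : Bool × Edge G → Fin n
    hd p = head G (proj₁ p) (proj₂ p)

  ∑-headLoad≤ : ∀ {t} {es : Vec (Edge G) t} {M} (bal : Balanced es M) (f : Fin n → ℕ) →
    ∑ (oriented (proj₁ bal) es) (λ p → f (head G (proj₁ p) (proj₂ p))) ≤ M * ∑ vs f
  ∑-headLoad≤ {es = es} {M} (o , h) f = begin
    ∑ (oriented o es) (λ p → f (head G (proj₁ p) (proj₂ p))) ≡⟨ ∑-headLoad (oriented o es) f ⟩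
    ∑ vs (λ v → headLoad (oriented o es) v * f v) ≤⟨ ∑-mono vs (λ v → *-monoˡ-≤ (f v) (h v)) ⟩
    ∑ vs (λ v → M * f v) ≡⟨ ∑-*ˡ vs M f ⟩
    M * ∑ vs f ∎

  inside? : {P : Fin n → Set} → (∀ v → Dec (P v)) → (e : Edge G) → Dec (P (head G true e) × P (head G false e))
  inside? P? e = P? (head G true e) ×-dec P? (head G false e)

  -- Whichever end an edge inside `P` is oriented to, that end lies in `P`; so these edges are
  -- charged to the loads of the vertices of `P`.
  density : ∀ {t} (es : Vec (Edge G) t) {M} → Balanced es M → {P : Fin n → Set} (P? : ∀ v → Dec (P v)) →
    ∑ (toList es) (λ e → χ (inside? P? e)) ≤ M * ∑ vs (λ v → χ (P? v))
  density es {M} bal@(o , h) P? = begin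
    ∑ (toList es) (λ e → χ (inside? P? e)) ≡⟨ ∑-oriented o es _ ⟩
    ∑ (oriented o es) (λ p → χ (inside? P? (proj₂ p))) ≤⟨ ∑-mono (oriented o es) (λ { (b , e) → χ-mono (inside? P? e) (P? (head G b e)) (either b e) }) ⟩
    ∑ (oriented o es) (λ p → χ (P? (head G (proj₁ p) (proj₂ p)))) ≤⟨ ∑-headLoad≤ {es = es} bal (λ v → χ (P? v)) ⟩
    M * ∑ vs (λ v → χ (P? v)) ∎
    where
    either : ∀ b e → _ → _
    either true  e (p , _) = p
    either false e (_ , q) = q

  module _ (hd : Edge G → Bool) where

    hv tv : Edge G → Fin n
    hv e = head G (hd e) e
    tv e = head G (not (hd e)) e

    head≡hv⊎tv : ∀ b e → head G b e ≡ hv e ⊎ head G b e ≡ tv e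
    head≡hv⊎tv b e with hd e
    head≡hv⊎tv true  e | true  = inj₁ refl
    head≡hv⊎tv true  e | false = inj₂ refl
    head≡hv⊎tv false e | true  = inj₂ refl
    head≡hv⊎tv false e | false = inj₁ refl

    into? : (R : Edge G → Bool) (S : Fin n → Bool) (b : Fin n) (e : Edge G) → Dec (hv e ≡ b × T (R e) × T (S (tv e)))
    into? R S b e = (hv e FP.≟ b) ×-dec (T? (R e) ×-dec T? (S (tv e)))

    -- A balanced orientation turns at most `M` of the edges counted at `b` towards `b`. The others
    -- are turned towards their tails, which lie in `S` and together carry load at most
    -- `M * card S`.
    excess≤ : ∀ {t} (es : Vec (Edge G) t) {M} → Balanced es M → (R : Edge G → Bool) (S : Fin n → Bool) →
      ∑ vs (λ b → ∑ (toList es) (λ e → χ (into? R S b e)) ∸ M) ≤ M * card S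
    excess≤ es {M} bal@(o , h) R S = begin
      ∑ vs (λ b → ∑ (toList es) (λ e → χ (into? R S b e)) ∸ M)
        ≤⟨ ∑-mono vs perVertex ⟩
      ∑ vs (λ b → ∑ ps (λ p → χ (hv (proj₂ p) FP.≟ b) * χ (T? (S (w p)))))
        ≡⟨ ∑-swap vs ps _ ⟩
      ∑ ps (λ p → ∑ vs (λ b → χ (hv (proj₂ p) FP.≟ b) * χ (T? (S (w p)))))
        ≡⟨ ∑-cong ps (λ p → ∑-δ-allFin (hv (proj₂ p)) _) ⟩
      ∑ ps (λ p → χ (T? (S (w p))))
        ≤⟨ ∑-headLoad≤ {es = es} bal (λ v → χ (T? (S v))) ⟩
      M * card S ∎
      where
      ps : List (Bool × Edge G)
      ps = oriented o es
      w : Bool × Edge G → Fin n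
      w p = head G (proj₁ p) (proj₂ p)
      pointwise : ∀ b p → χ (into? R S b (proj₂ p)) ≤ χ (w p FP.≟ b) + χ (hv (proj₂ p) FP.≟ b) * χ (T? (S (w p)))
      pointwise b (c , e) with into? R S b e
      ... | no _ = z≤n
      ... | yes (hv≡b , _ , s) with head≡hv⊎tv c e
      ... | inj₁ eq = ≤-trans (1≤χ (head G c e FP.≟ b) (trans eq hv≡b)) (m≤m+n _ _)
      ... | inj₂ eq = ≤-trans (≤-reflexive (sym (cong₂ _*_ (χ-yes (hv e FP.≟ b) hv≡b) (χ-yes (T? (S (head G c e))) (subst (T ∘ S) (sym eq) s))))) (m≤n+m _ (χ (head G c e FP.≟ b)))
      perVertex : ∀ b → ∑ (toList es) (λ e → χ (into? R S b e)) ∸ M ≤ ∑ ps (λ p → χ (hv (proj₂ p) FP.≟ b) * χ (T? (S (w p))))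
      perVertex b = m≤n+o⇒m∸n≤o (∑ (toList es) (λ e → χ (into? R S b e))) M (begin
        ∑ (toList es) (λ e → χ (into? R S b e)) ≡⟨ ∑-oriented o es _ ⟩
        ∑ ps (λ p → χ (into? R S b (proj₂ p))) ≤⟨ ∑-mono ps (pointwise b) ⟩
        ∑ ps (λ p → χ (w p FP.≟ b) + χ (hv (proj₂ p) FP.≟ b) * χ (T? (S (w p)))) ≡⟨ ∑-+ ps _ _ ⟩
        headLoad ps b + ∑ ps (λ p → χ (hv (proj₂ p) FP.≟ b) * χ (T? (S (w p)))) ≤⟨ +-monoˡ-≤ _ (h b) ⟩
        M + ∑ ps (λ p → χ (hv (proj₂ p) FP.≟ b) * χ (T? (S (w p)))) ∎)

-- Planting arrivals at random positions

-- The sets of `l` positions among `t`, as characteristic vectors; their number is the binomial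
-- coefficient `C(t,l)`.
masks : (t l : ℕ) → List (Vec Bool t)
masks zero    zero    = V.[] ∷ []
masks zero    (suc l) = []
masks (suc t) zero    = map (false V.∷_) (masks t zero)
masks (suc t) (suc l) = map (true V.∷_) (masks t l) ++ map (false V.∷_) (masks t (suc l))

∑-masks : ∀ t l (f : Vec Bool (suc t) → ℕ) →
  ∑ (masks (suc t) (suc l)) f ≡ ∑ (masks t l) (λ o → f (true V.∷ o)) + ∑ (masks t (suc l)) (λ o → f (false V.∷ o))
∑-masks t l f = trans (∑-++ (map (true V.∷_) (masks t l)) _ f)
  (cong₂ _+_ (∑-map (true V.∷_) (masks t l) f) (∑-map (false V.∷_) (masks t (suc l)) f))

length-masks-zero : ∀ t → length (masks t zero) ≡ 1
length-masks-zero zero    = refl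
length-masks-zero (suc t) = trans (length-map (false V.∷_) (masks t zero)) (length-masks-zero t)

length-masks-suc : ∀ t l → length (masks (suc t) (suc l)) ≡ length (masks t l) + length (masks t (suc l))
length-masks-suc t l = trans (length-++ (map (true V.∷_) (masks t l)))
  (cong₂ _+_ (length-map (true V.∷_) (masks t l)) (length-map (false V.∷_) (masks t (suc l))))

masks-absorption : ∀ t l → suc l * length (masks (suc t) (suc l)) ≡ suc t * length (masks t l)
masks-absorption zero zero = refl
masks-absorption zero (suc l) = *-zeroʳ l
masks-absorption (suc t) zero = begin-equality
  1 * length (masks (suc (suc t)) 1) ≡⟨ cong (1 *_) (length-masks-suc (suc t) 0) ⟩
  1 * (length (masks (suc t) 0) + length (masks (suc t) 1)) ≡⟨ cong₂ (λ a b → 1 * (a + b)) (length-masks-zero (suc t)) one ⟩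
  1 * (1 + suc t) ≡⟨ trans (*-identityˡ _) (sym (*-identityʳ _)) ⟩
  suc (suc t) * 1 ≡⟨ cong (suc (suc t) *_) (length-masks-zero (suc t)) ⟨
  suc (suc t) * length (masks (suc t) 0) ∎
  where
  one : length (masks (suc t) 1) ≡ suc t
  one = trans (sym (*-identityˡ _)) (trans (masks-absorption t zero) (trans (cong (suc t *_) (length-masks-zero t)) (*-identityʳ _)))
masks-absorption (suc t) (suc l) = +-cancelʳ-≡ (suc t * A) _ _ (begin-equality
  suc (suc l) * length (masks (suc (suc t)) (suc (suc l))) + suc t * A ≡⟨ cong (λ z → suc (suc l) * z + suc t * A) (length-masks-suc (suc t) (suc l)) ⟩
  suc (suc l) * (B + C) + suc t * A ≡⟨ e1 l t A B C ⟩
  suc (suc l) * C + (suc (suc l) * B + suc t * A) ≡⟨ cong₂ _+_ (masks-absorption t (suc l)) refl ⟩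
  suc t * D + (suc (suc l) * B + suc t * A) ≡⟨ e2 l t A B D ⟩
  suc (suc l) * B + suc t * (A + D) ≡⟨ cong (λ z → suc (suc l) * B + suc t * z) (length-masks-suc t l) ⟨
  suc (suc l) * B + suc t * B ≡⟨ e3 l t B ⟩
  suc (suc t) * B + suc l * B ≡⟨ cong (suc (suc t) * B +_) (masks-absorption t l) ⟩
  suc (suc t) * B + suc t * A ∎)
  where
  A B C D : ℕ
  A = length (masks t l)
  B = length (masks (suc t) (suc l))
  C = length (masks (suc t) (suc (suc l)))
  D = length (masks t (suc l))
  e1 : ∀ l t a b c → suc (suc l) * (b + c) + suc t * a ≡ suc (suc l) * c + (suc (suc l) * b + suc t * a)
  e1 = solve-∀
  e2 : ∀ l t a b d → suc t * d + (suc (suc l) * b + suc t * a) ≡ suc (suc l) * b + suc t * (a + d)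
  e2 = solve-∀
  e3 : ∀ l t b → suc (suc l) * b + suc t * b ≡ suc (suc t) * b + suc l * b
  e3 = solve-∀

-- The bound `C(t,l) ≥ (t/l)^l`, by induction through the absorption identity; the inductive step
-- needs `(t+1)/(l+1) ≤ t/l`, which holds for `l ≤ t`.
length-masks≥ : ∀ t l → l ≤ t → t ^ l ≤ l ^ l * length (masks t l)
length-masks≥ t zero _ = ≤-reflexive (sym (trans (*-identityˡ _) (length-masks-zero t)))
length-masks≥ (suc t) (suc l) (s≤s l≤t) = begin
  suc t * suc t ^ l ≤⟨ *-monoʳ-≤ (suc t) (step l l≤t) ⟩
  suc t * (suc l ^ l * length (masks t l)) ≡⟨ *-CS.x∙yz≈y∙xz (suc t) (suc l ^ l) _ ⟩
  suc l ^ l * (suc t * length (masks t l)) ≡⟨ cong (suc l ^ l *_) (masks-absorption t l) ⟨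
  suc l ^ l * (suc l * length (masks (suc t) (suc l))) ≡⟨ *-CS.x∙yz≈yx∙z (suc l ^ l) (suc l) _ ⟩
  suc l * suc l ^ l * length (masks (suc t) (suc l)) ∎
  where
  ratio : ∀ l → l ≤ t → suc t * l ≤ suc l * t
  ratio l l≤t = ≤-trans (+-monoˡ-≤ (t * l) l≤t) (≤-reflexive (cong (λ z → t + z) (*-comm t l)))
  step : ∀ l → l ≤ t → suc t ^ l ≤ suc l ^ l * length (masks t l)
  step zero    _   = ≤-reflexive (sym (trans (*-identityˡ _) (length-masks-zero t)))
  step l@(suc _) l≤t = *-cancelˡ-≤ (l ^ l) {{m^n≢0 l l}} (begin
    l ^ l * suc t ^ l ≡⟨ trans (*-comm (l ^ l) _) (sym (^-distribʳ-* l (suc t) l)) ⟩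
    (suc t * l) ^ l ≤⟨ ^-monoˡ-≤ l (ratio l l≤t) ⟩
    (suc l * t) ^ l ≡⟨ ^-distribʳ-* l (suc l) t ⟩
    suc l ^ l * t ^ l ≤⟨ *-monoʳ-≤ (suc l ^ l) (length-masks≥ t l l≤t) ⟩
    suc l ^ l * (l ^ l * length (masks t l)) ≡⟨ *-CS.x∙yz≈y∙xz (suc l ^ l) (l ^ l) _ ⟩
    l ^ l * (suc l ^ l * length (masks t l)) ∎)

module _ {A : Set} where

  rest : ∀ {t} → Vec Bool t → Vec A t → List A
  rest V.[]          V.[]      = []
  rest (true  V.∷ o) (x V.∷ s) = rest o s
  rest (false V.∷ o) (x V.∷ s) = x ∷ rest o s

  module _ {U : A → Set} (U? : ∀ x → Dec (U x)) where

    hits : List A → ℕ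
    hits s = ∑ s (λ x → χ (U? x))

    -- Indicator that all masked positions are hits. The product form lets it be summed one position
    -- at a time.
    planted : ∀ {t} → Vec Bool t → Vec A t → ℕ
    planted V.[]          V.[]      = 1
    planted (true  V.∷ o) (x V.∷ s) = χ (U? x) * planted o s
    planted (false V.∷ o) (x V.∷ s) = planted o s

    hits-rest≤ : ∀ {t} (o : Vec Bool t) s → hits (rest o s) ≤ hits (toList s)
    hits-rest≤ V.[]          V.[]      = z≤n
    hits-rest≤ (true  V.∷ o) (x V.∷ s) = ≤-trans (hits-rest≤ o s) (m≤n+m _ _)
    hits-rest≤ (false V.∷ o) (x V.∷ s) = +-monoʳ-≤ (χ (U? x)) (hits-rest≤ o s)

    -- The masks that count are sets of positions of hits, and there are `2 ^ hits` such sets of any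
    -- size.
    ∑-planted≤ : ∀ {t} l (s : Vec A t) → ∑ (masks t l) (λ o → planted o s) ≤ 2 ^ hits (toList s)
    ∑-planted≤ zero    V.[]      = ≤-refl
    ∑-planted≤ (suc l) V.[]      = z≤n
    ∑-planted≤ {suc t} zero (x V.∷ s) = begin
      ∑ (map (false V.∷_) (masks t zero)) (λ o → planted o (x V.∷ s)) ≡⟨ ∑-map (false V.∷_) (masks t zero) _ ⟩
      ∑ (masks t zero) (λ o → planted o s) ≤⟨ ∑-planted≤ zero s ⟩
      2 ^ hits (toList s) ≤⟨ ^-monoʳ-≤ 2 (m≤n+m (hits (toList s)) (χ (U? x))) ⟩
      2 ^ (χ (U? x) + hits (toList s)) ∎
    ∑-planted≤ {suc t} (suc l) (x V.∷ s) = begin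
      ∑ (masks (suc t) (suc l)) (λ o → planted o (x V.∷ s)) ≡⟨ ∑-masks t l _ ⟩
      ∑ (masks t l) (λ o → χ (U? x) * planted o s) + ∑ (masks t (suc l)) (λ o → planted o s)
        ≡⟨ cong (_+ ∑ (masks t (suc l)) (λ o → planted o s)) (∑-*ˡ (masks t l) (χ (U? x)) _) ⟩
      χ (U? x) * ∑ (masks t l) (λ o → planted o s) + ∑ (masks t (suc l)) (λ o → planted o s)
        ≤⟨ +-mono-≤ (*-monoʳ-≤ (χ (U? x)) (∑-planted≤ l s)) (∑-planted≤ (suc l) s) ⟩
      χ (U? x) * 2 ^ hits (toList s) + 2 ^ hits (toList s) ≤⟨ double (U? x) ⟩
      2 ^ (χ (U? x) + hits (toList s)) ∎
      where
      double : {P : Set} (p? : Dec P) → χ p? * 2 ^ hits (toList s) + 2 ^ hits (toList s) ≤ 2 ^ (χ p? + hits (toList s))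
      double (yes _) = ≤-reflexive (trans (cong (_+ 2 ^ hits (toList s)) (*-identityˡ _)) (cong (2 ^ hits (toList s) +_) (sym (+-identityʳ _))))
      double (no _)  = ≤-refl

    hits≡ : ∀ {t} l {o : Vec Bool t} s → o ∈ masks t l → 1 ≤ planted o s → hits (toList s) ≡ l + hits (rest o s)
    hits≡ {zero} zero V.[] (here refl) _ = refl
    hits≡ {suc t} zero (x V.∷ s) o∈ p with ∈-map⁻ (false V.∷_) o∈
    ... | o , o∈′ , refl = cong (χ (U? x) +_) (hits≡ zero s o∈′ p)
    hits≡ {suc t} (suc l) (x V.∷ s) o∈ p with ∈-++⁻ (map (true V.∷_) (masks t l)) o∈
    ... | inj₂ o∈′ with ∈-map⁻ (false V.∷_) o∈′
    ...   | o , o∈″ , refl = trans (cong (χ (U? x) +_) (hits≡ (suc l) s o∈″ p)) (+-CS.x∙yz≈y∙xz (χ (U? x)) (suc l) _)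
    hits≡ {suc t} (suc l) (x V.∷ s) o∈ p | inj₁ o∈′ with ∈-map⁻ (true V.∷_) o∈′
    ...   | o , o∈″ , refl with U? x
    ...     | yes _ = cong suc (hits≡ l s o∈″ (≤-trans p (≤-reflexive (*-identityˡ _))))
    ...     | no _  = contradiction p (λ ())

    -- At each masked position a hit has probability hits xs / |xs|, and rest does not look there.
    ∑-planted : (xs : List A) {t : ℕ} (l : ℕ) {o : Vec Bool t} → o ∈ masks t l → (g : List A → ℕ) →
      length xs ^ l * ∑ (allVecs xs t) (λ s → planted o s * g (rest o s)) ≡
      hits xs ^ l * ∑ (allVecs xs t) (λ s → g (rest o s))
    ∑-planted xs {zero} zero (here refl) g = cong (λ z → 1 * (z + 0)) (*-identityˡ (g []))
    ∑-planted xs {suc t} zero o∈ g with ∈-map⁻ (false V.∷_) o∈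
    ... | o , o∈′ , refl = cong (1 *_) (begin-equality
      ∑ (allVecs xs (suc t)) (λ s → planted (false V.∷ o) s * g (rest (false V.∷ o) s)) ≡⟨ ∑-allVecs xs t _ ⟩
      ∑ xs (λ x → ∑ (allVecs xs t) (λ s → planted o s * g (x ∷ rest o s))) ≡⟨ ∑-cong xs (λ x → *-cancelˡ-≡ _ _ 1 (∑-planted xs zero o∈′ (λ r → g (x ∷ r)))) ⟩
      ∑ xs (λ x → ∑ (allVecs xs t) (λ s → g (x ∷ rest o s))) ≡⟨ ∑-allVecs xs t _ ⟨
      ∑ (allVecs xs (suc t)) (λ s → g (rest (false V.∷ o) s)) ∎)
    ∑-planted xs {suc t} (suc l) o∈ g with ∈-++⁻ (map (true V.∷_) (masks t l)) o∈
    ... | inj₂ o∈′ with ∈-map⁻ (false V.∷_) o∈′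
    ...   | o , o∈″ , refl = begin-equality
      length xs ^ suc l * ∑ (allVecs xs (suc t)) (λ s → planted (false V.∷ o) s * g (rest (false V.∷ o) s))
        ≡⟨ cong (length xs ^ suc l *_) (∑-allVecs xs t _) ⟩
      length xs ^ suc l * ∑ xs (λ x → ∑ (allVecs xs t) (λ s → planted o s * g (x ∷ rest o s)))
        ≡⟨ ∑-*ˡ xs (length xs ^ suc l) _ ⟨
      ∑ xs (λ x → length xs ^ suc l * ∑ (allVecs xs t) (λ s → planted o s * g (x ∷ rest o s)))
        ≡⟨ ∑-cong xs (λ x → ∑-planted xs (suc l) o∈″ (λ r → g (x ∷ r))) ⟩
      ∑ xs (λ x → hits xs ^ suc l * ∑ (allVecs xs t) (λ s → g (x ∷ rest o s)))
        ≡⟨ ∑-*ˡ xs (hits xs ^ suc l) _ ⟩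
      hits xs ^ suc l * ∑ xs (λ x → ∑ (allVecs xs t) (λ s → g (x ∷ rest o s)))
        ≡⟨ cong (hits xs ^ suc l *_) (∑-allVecs xs t _) ⟨
      hits xs ^ suc l * ∑ (allVecs xs (suc t)) (λ s → g (rest (false V.∷ o) s)) ∎
    ∑-planted xs {suc t} (suc l) o∈ g | inj₁ o∈′ with ∈-map⁻ (true V.∷_) o∈′
    ...   | o , o∈″ , refl = begin-equality
      length xs ^ suc l * ∑ (allVecs xs (suc t)) (λ s → planted (true V.∷ o) s * g (rest (true V.∷ o) s))
        ≡⟨ cong (length xs ^ suc l *_) (∑-allVecs xs t _) ⟩
      length xs ^ suc l * ∑ xs (λ x → ∑ (allVecs xs t) (λ s → χ (U? x) * planted o s * g (rest o s)))
        ≡⟨ cong (length xs ^ suc l *_) (∑-cong xs (λ x → trans (∑-cong (allVecs xs t) (λ s → *-assoc (χ (U? x)) _ _)) (∑-*ˡ (allVecs xs t) (χ (U? x)) _))) ⟩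
      length xs ^ suc l * ∑ xs (λ x → χ (U? x) * W)
        ≡⟨ cong (length xs ^ suc l *_) (∑-*ʳ xs W _) ⟩
      length xs ^ suc l * (hits xs * W)
        ≡⟨ *-CS.interchange (length xs) (length xs ^ l) (hits xs) W ⟩
      length xs * hits xs * (length xs ^ l * W)
        ≡⟨ cong (length xs * hits xs *_) (∑-planted xs l o∈″ g) ⟩
      length xs * hits xs * (hits xs ^ l * W′)
        ≡⟨ e2 (length xs) (hits xs) (hits xs ^ l) W′ ⟩
      hits xs ^ suc l * (length xs * W′)
        ≡⟨ cong (hits xs ^ suc l *_) (∑-const xs W′) ⟨
      hits xs ^ suc l * ∑ xs (λ x → W′)
        ≡⟨ cong (hits xs ^ suc l *_) (∑-allVecs xs t _) ⟨
      hits xs ^ suc l * ∑ (allVecs xs (suc t)) (λ s → g (rest (true V.∷ o) s)) ∎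
      where
      W W′ : ℕ
      W  = ∑ (allVecs xs t) (λ s → planted o s * g (rest o s))
      W′ = ∑ (allVecs xs t) (λ s → g (rest o s))
      e2 : ∀ m d dl w → m * d * (dl * w) ≡ d * dl * (m * w)
      e2 = solve-∀

    ∑-hits : (xs : List A) (t : ℕ) → length xs * ∑ (allVecs xs t) (λ s → hits (toList s)) ≡ t * hits xs * length xs ^ t
    ∑-hits xs zero    = *-zeroʳ (length xs)
    ∑-hits xs (suc t) = begin-equality
      length xs * ∑ (allVecs xs (suc t)) (λ s → hits (toList s))
        ≡⟨ cong (length xs *_) (∑-allVecs xs t _) ⟩
      length xs * ∑ xs (λ x → ∑ (allVecs xs t) (λ s → χ (U? x) + hits (toList s)))
        ≡⟨ cong (length xs *_) (∑-cong xs (λ x → trans (∑-+ (allVecs xs t) _ _) (cong (_+ H) (trans (∑-const (allVecs xs t) _) (cong (_* χ (U? x)) (length-allVecs xs t)))))) ⟩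
      length xs * ∑ xs (λ x → length xs ^ t * χ (U? x) + H)
        ≡⟨ cong (length xs *_) (trans (∑-+ xs _ _) (cong₂ _+_ (∑-*ˡ xs (length xs ^ t) _) (∑-const xs H))) ⟩
      length xs * (length xs ^ t * hits xs + length xs * H)
        ≡⟨ cong (λ z → length xs * (length xs ^ t * hits xs + z)) (∑-hits xs t) ⟩
      length xs * (length xs ^ t * hits xs + t * hits xs * length xs ^ t)
        ≡⟨ e (length xs) (length xs ^ t) (hits xs) t ⟩
      suc t * hits xs * length xs ^ suc t ∎
      where
      H : ℕ
      H = ∑ (allVecs xs t) (λ s → hits (toList s))
      e : ∀ m mt d t → m * (mt * d + t * d * mt) ≡ suc t * d * (m * mt)
      e = solve-∀

markov : {A : Set} (xs : List A) (f : A → ℕ) (K c N : ℕ) → 1 ≤ K → ∑ xs f ≤ K * N →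
  c * ∑ xs (λ x → χ (¬? (f x ≤? c * K))) ≤ N
markov xs f K c N K≥1 h = *-cancelˡ-≤ K {{>-nonZero K≥1}} (begin
  K * (c * ∑ xs (λ x → χ (¬? (f x ≤? c * K)))) ≡⟨ trans (sym (*-assoc K c _)) (cong (_* ∑ xs (λ x → χ (¬? (f x ≤? c * K)))) (*-comm K c)) ⟩
  c * K * ∑ xs (λ x → χ (¬? (f x ≤? c * K))) ≡⟨ ∑-*ˡ xs (c * K) _ ⟨
  ∑ xs (λ x → c * K * χ (¬? (f x ≤? c * K))) ≤⟨ ∑-mono xs pointwise ⟩
  ∑ xs f ≤⟨ h ⟩
  K * N ∎)
  where
  pointwise : ∀ x → c * K * χ (¬? (f x ≤? c * K)) ≤ f x
  pointwise x with f x ≤? c * K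
  ... | yes _ = ≤-trans (≤-reflexive (*-zeroʳ (c * K))) z≤n
  ... | no ≰  = ≤-trans (≤-reflexive (*-identityʳ (c * K))) (<⇒≤ (≰⇒> ≰))

-- Few heads receive many edges from few tails

restᵛ : {A : Set} {t : ℕ} (o : Vec Bool t) (s : Vec A t) → Vec A (length (rest o s))
restᵛ o s = V.fromList (rest o s)

module _ {n : ℕ} (G : Graph n) (hd : Edge G → Bool) where

  tv≢hv : ∀ e → tv G hd e ≢ hv G hd e
  tv≢hv e eq with hd e | FP.<⇒≢ (All.lookup (ordered G) (∈-lookup {xs = edges G} e))
  ... | true  | ne = ne (sym eq)
  ... | false | ne = ne eq

  -- Extra load after `p` edges have been turned towards their common head `b` and `q` edges towards
  -- their tails: a vertex other than `b` can gain at most `q`, even if all the tails coincide.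
  share : Fin n → ℕ → ℕ → Fin n → ℕ
  share b p q v = χ (b FP.≟ v) * p + χ (¬? (b FP.≟ v)) * q

  share≤ : ∀ b p v → share b p p v ≤ p
  share≤ b p v with b FP.≟ v
  ... | yes _ = ≤-reflexive (trans (+-identityʳ _) (*-identityˡ p))
  ... | no _  = ≤-reflexive (*-identityˡ p)

  share-toHead : ∀ {b w} p q v → w ≡ b → χ (w FP.≟ v) + share b p q v ≤ share b (suc p) q v
  share-toHead {b} p q v refl with b FP.≟ v
  ... | yes _ = ≤-refl
  ... | no _  = ≤-refl

  share-toTail : ∀ {b w} p q v → w ≢ b → χ (w FP.≟ v) + share b p q v ≤ share b p (suc q) v
  share-toTail {b} {w} p q v w≢b with b FP.≟ v
  ... | yes refl = ≤-reflexive (cong (_+ (1 * p + 0)) (χ-no (w FP.≟ v) w≢b))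
  ... | no _     = +-monoˡ-≤ (1 * q) (χ≤1 (w FP.≟ v))

  module _ {U : Edge G → Set} (U? : ∀ e → Dec (U e)) (b : Fin n) (U⇒hv≡b : ∀ e → U e → hv G hd e ≡ b) where

    -- Planting is cheap for the optimum: if half of the planted edges go to `b` and half to their
    -- tails, each load grows by only half their number, while `b` sees all of them as hits.
    insert : ∀ {t} l p q → p + q ≡ l → {o : Vec Bool t} (s : Vec (Edge G) t) → o ∈ masks t l → 1 ≤ planted U? o s →
      (o₁ : Vec Bool (length (rest o s))) →
      Σ (Vec Bool t) (λ o′ → ∀ v → headLoad G (oriented G o′ s) v ≤ headLoad G (oriented G o₁ (restᵛ o s)) v + share b p q v)
    insert {zero} zero p q eq V.[] (here refl) pl V.[] = V.[] , λ v → z≤n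
    insert {suc t} zero p q eq (e V.∷ s) o∈ pl o₁ with ∈-map⁻ (false V.∷_) o∈
    insert {suc t} zero p q eq (e V.∷ s) o∈ pl (c V.∷ o₁) | o , o∈′ , refl with insert zero p q eq s o∈′ pl o₁
    ... | o′ , h = c V.∷ o′ , λ v → ≤-trans (+-monoʳ-≤ (χ (head G c e FP.≟ v)) (h v)) (≤-reflexive (sym (+-assoc (χ (head G c e FP.≟ v)) _ _)))
    insert {suc t} (suc l) p q eq (e V.∷ s) o∈ pl o₁ with ∈-++⁻ (map (true V.∷_) (masks t l)) o∈
    insert {suc t} (suc l) p q eq (e V.∷ s) o∈ pl o₁ | inj₂ o∈′ with ∈-map⁻ (false V.∷_) o∈′
    insert {suc t} (suc l) p q eq (e V.∷ s) o∈ pl (c V.∷ o₁) | inj₂ o∈′ | o , o∈″ , refl with insert (suc l) p q eq s o∈″ pl o₁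
    ... | o′ , h = c V.∷ o′ , λ v → ≤-trans (+-monoʳ-≤ (χ (head G c e FP.≟ v)) (h v)) (≤-reflexive (sym (+-assoc (χ (head G c e FP.≟ v)) _ _)))
    insert {suc t} (suc l) p q eq (e V.∷ s) o∈ pl o₁ | inj₁ o∈′ with ∈-map⁻ (true V.∷_) o∈′
    insert {suc t} (suc l) p q eq (e V.∷ s) o∈ pl o₁ | inj₁ o∈′ | o , o∈″ , refl with U? e
    insert {suc t} (suc l) p q eq (e V.∷ s) o∈ pl o₁ | inj₁ o∈′ | o , o∈″ , refl | no _ = contradiction pl (λ ())
    insert {suc t} (suc l) (suc p) q eq (e V.∷ s) o∈ pl o₁ | inj₁ o∈′ | o , o∈″ , refl | yes u
      with insert l p q (suc-injective eq) s o∈″ (≤-trans pl (≤-reflexive (*-identityˡ _))) o₁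
    ... | o′ , h = hd e V.∷ o′ , λ v → ≤-trans (+-monoʳ-≤ (χ (hv G hd e FP.≟ v)) (h v))
      (≤-trans (≤-reflexive (+-CS.x∙yz≈y∙xz (χ (hv G hd e FP.≟ v)) (headLoad G (oriented G o₁ (restᵛ o s)) v) (share b p q v)))
               (+-monoʳ-≤ (headLoad G (oriented G o₁ (restᵛ o s)) v) (share-toHead p q v (U⇒hv≡b e u))))
    insert {suc t} (suc l) zero (suc q) eq (e V.∷ s) o∈ pl o₁ | inj₁ o∈′ | o , o∈″ , refl | yes u
      with insert l zero q (suc-injective eq) s o∈″ (≤-trans pl (≤-reflexive (*-identityˡ _))) o₁
    ... | o′ , h = not (hd e) V.∷ o′ , λ v → ≤-trans (+-monoʳ-≤ (χ (tv G hd e FP.≟ v)) (h v))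
      (≤-trans (≤-reflexive (+-CS.x∙yz≈y∙xz (χ (tv G hd e FP.≟ v)) (headLoad G (oriented G o₁ (restᵛ o s)) v) (share b 0 q v)))
               (+-monoʳ-≤ (headLoad G (oriented G o₁ (restᵛ o s)) v)
                 (share-toTail 0 q v (λ tv≡b → tv≢hv e (trans tv≡b (sym (U⇒hv≡b e u)))))))

  restrict : ∀ {t} (o : Vec Bool t) (s : Vec (Edge G) t) (o₁ : Vec Bool t) →
    Σ (Vec Bool (length (rest o s))) (λ o′ → ∀ v → headLoad G (oriented G o′ (restᵛ o s)) v ≤ headLoad G (oriented G o₁ s) v)
  restrict V.[] V.[] V.[] = V.[] , λ v → z≤n
  restrict (true  V.∷ o) (e V.∷ s) (c V.∷ o₁) with restrict o s o₁
  ... | o′ , h = o′ , λ v → ≤-trans (h v) (m≤n+m _ _)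
  restrict (false V.∷ o) (e V.∷ s) (c V.∷ o₁) with restrict o s o₁
  ... | o′ , h = c V.∷ o′ , λ v → +-monoʳ-≤ (χ (head G c e FP.≟ v)) (h v)

  offlineOpt-rest≤ : ∀ {t} (o : Vec Bool t) (s : Vec (Edge G) t) → offlineOpt G (restᵛ o s) ≤ offlineOpt G s
  offlineOpt-rest≤ o s with offlineOpt-balanced G s
  ... | o₁ , h with restrict o s o₁
  ... | o′ , h′ = offlineOpt-least G (restᵛ o s) (o′ , λ v → ≤-trans (h′ v) (h v))

allEdges : ∀ {n} (G : Graph n) → List (Edge G)
allEdges G = allFin (#E G)

sequences : ∀ {n} (G : Graph n) (t : ℕ) → List (Vec (Edge G) t)
sequences G t = allVecs (allEdges G) t

length-sequences : ∀ {n} (G : Graph n) t → length (sequences G t) ≡ #E G ^ t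
length-sequences G t = trans (length-allVecs (allEdges G) t) (cong (_^ t) (length-allFin (#E G)))

module _ {n : ℕ} (G : Graph n) (hd : Edge G → Bool) (t K : ℕ) (K≥1 : 1 ≤ K)
  (opt≤K : ∑ (sequences G t) (offlineOpt G) ≤ K * #E G ^ t) where

  private
    m : ℕ
    m = #E G
    xs : List (Edge G)
    xs = allEdges G
    vs : List (Fin n)
    vs = allFin n
    seqs : List (Vec (Edge G) t)
    seqs = sequences G t
    l : ℕ
    -- Written as a sum because `insert` turns one half towards the head and the other half towards
    -- the tails.
    l = 5 * K + 5 * K
    l≡ : l ≡ 10 * K
    l≡ = sym (*-distribʳ-+ K 5 5)

  module _ {U : Edge G → Set} (U? : ∀ e → Dec (U e)) (b : Fin n) (U⇒hv≡b : ∀ e → U e → hv G hd e ≡ b)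
    (rate : t * hits U? xs ≤ 2 * K * m) where

    private
      H : Vec (Edge G) t → ℕ
      H s = hits U? (toList s)

      good? : (r : List (Edge G)) → Dec (offlineOpt G (V.fromList r) ≤ 4 * K × hits U? r ≤ 8 * K)
      good? r = (offlineOpt G (V.fromList r) ≤? 4 * K) ×-dec (hits U? r ≤? 8 * K)

      good₀? : (s : Vec (Edge G) t) → Dec (offlineOpt G s ≤ 4 * K × H s ≤ 8 * K)
      good₀? s = (offlineOpt G s ≤? 4 * K) ×-dec (H s ≤? 8 * K)

      good : List (Edge G) → ℕ
      good r = χ (good? r)

      good₀ : Vec (Edge G) t → ℕ
      good₀ s = χ (good₀? s)

      mean : ∑ seqs H ≤ K * (2 * m ^ t)
      mean = *-cancelˡ-≤ m {{nonempty G}} (begin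
        m * ∑ seqs H ≡⟨ cong (_* ∑ seqs H) (length-allFin m) ⟨
        length xs * ∑ seqs H ≡⟨ ∑-hits U? xs t ⟩
        t * hits U? xs * length xs ^ t ≡⟨ cong (λ z → t * hits U? xs * z ^ t) (length-allFin m) ⟩
        t * hits U? xs * m ^ t ≤⟨ *-monoˡ-≤ (m ^ t) rate ⟩
        2 * K * m * m ^ t ≡⟨ e K m (m ^ t) ⟩
        m * (K * (2 * m ^ t)) ∎)
        where
        e : ∀ K m x → 2 * K * m * x ≡ m * (K * (2 * x))
        e = solve-∀

      -- Markov twice: the optimum has mean at most `K` and exceeds `4 * K` with probability at most
      -- 1/4; the hits have mean at most `2 * K` and exceed `8 * K` with probability at most 1/4.
      many-good : m ^ t ≤ 2 * ∑ seqs good₀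
      many-good = *-cancelˡ-≤ 2 (+-cancelʳ-≤ (2 * m ^ t) _ _ (begin
        2 * m ^ t + 2 * m ^ t ≡⟨ e₁ (m ^ t) ⟩
        4 * m ^ t ≤⟨ *-monoʳ-≤ 4 total ⟩
        4 * (Σg + (bad₁ + bad₂)) ≡⟨ e₂ Σg bad₁ bad₂ ⟩
        2 * (2 * Σg) + (4 * bad₁ + 4 * bad₂) ≤⟨ +-monoʳ-≤ (2 * (2 * Σg)) (+-mono-≤ (markov seqs (offlineOpt G) K 4 (m ^ t) K≥1 opt≤K) bad₂≤) ⟩
        2 * (2 * Σg) + (m ^ t + m ^ t) ≡⟨ cong (λ z → 2 * (2 * Σg) + (m ^ t + z)) (+-identityʳ (m ^ t)) ⟨
        2 * (2 * Σg) + 2 * m ^ t ∎))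
        where
        Σg bad₁ bad₂ : ℕ
        Σg   = ∑ seqs good₀
        bad₁ = ∑ seqs (λ s → χ (¬? (offlineOpt G s ≤? 4 * K)))
        bad₂ = ∑ seqs (λ s → χ (¬? (H s ≤? 8 * K)))
        e₁ : ∀ x → 2 * x + 2 * x ≡ 4 * x
        e₁ = solve-∀
        e₂ : ∀ a b c → 4 * (a + (b + c)) ≡ 2 * (2 * a) + (4 * b + 4 * c)
        e₂ = solve-∀
        bad₂≤ : 4 * bad₂ ≤ m ^ t
        bad₂≤ = *-cancelˡ-≤ 2 (≤-trans (≤-reflexive (sym (*-assoc 2 4 bad₂))) (markov seqs H K 8 (2 * m ^ t) K≥1 mean))
        cover : {P Q : Set} (p? : Dec P) (q? : Dec Q) → 1 ≤ χ (p? ×-dec q?) + (χ (¬? p?) + χ (¬? q?))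
        cover (yes _) (yes _) = ≤-refl
        cover (yes _) (no _)  = ≤-refl
        cover (no _)  _       = s≤s z≤n
        total : m ^ t ≤ Σg + (bad₁ + bad₂)
        total = begin
          m ^ t ≡⟨ length-sequences G t ⟨
          length seqs ≡⟨ length≡∑ seqs ⟩
          ∑ seqs (λ _ → 1) ≤⟨ ∑-mono seqs (λ s → cover (offlineOpt G s ≤? 4 * K) (H s ≤? 8 * K)) ⟩
          ∑ seqs (λ s → good₀ s + (χ (¬? (offlineOpt G s ≤? 4 * K)) + χ (¬? (H s ≤? 8 * K))))
                              ≡⟨ trans (∑-+ seqs good₀ _) (cong (Σg +_) (∑-+ seqs _ _)) ⟩
          Σg + (bad₁ + bad₂) ∎

      good₀≤good : ∀ (o : Vec Bool t) s → good₀ s ≤ good (rest o s)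
      good₀≤good o s = χ-mono (good₀? s) (good? (rest o s))
        (λ { (a , c) → ≤-trans (offlineOpt-rest≤ G hd o s) a , ≤-trans (hits-rest≤ U? o s) c })

      -- Deleting arrivals keeps a sequence good, so the unmasked part is good at least as often as
      -- the whole sequence. It is independent of the masked positions, which are all hits with
      -- probability `(hits/m)^l`.
      perMask : ∀ o → o ∈ masks t l → hits U? xs ^ l * ∑ seqs good₀ ≤ m ^ l * ∑ seqs (λ s → planted U? o s * good (rest o s))
      perMask o o∈ = begin
        hits U? xs ^ l * ∑ seqs good₀ ≤⟨ *-monoʳ-≤ (hits U? xs ^ l) (∑-mono seqs (good₀≤good o)) ⟩
        hits U? xs ^ l * ∑ seqs (λ s → good (rest o s)) ≡⟨ ∑-planted U? xs l o∈ good ⟨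
        length xs ^ l * Z ≡⟨ cong (λ z → z ^ l * Z) (length-allFin m) ⟩
        m ^ l * Z ∎
        where
        Z : ℕ
        Z = ∑ seqs (λ s → planted U? o s * good (rest o s))

      -- With `10 * K` planted hits the optimum is at most `4 * K + 5 * K`, so the hits exceed it;
      -- and they number at most `10 * K + 8 * K`.
      excess≥ : ∀ {o} s → o ∈ masks t l → 1 ≤ planted U? o s → offlineOpt G (restᵛ o s) ≤ 4 * K → hits U? (rest o s) ≤ 8 * K →
        1 ≤ H s ∸ offlineOpt G s × H s ≤ 18 * K
      excess≥ {o} s o∈ pl a c = m<n⇒0<n∸m (begin-strict
          offlineOpt G s ≤⟨ offlineOpt-least G s (proj₁ ins , bal) ⟩
          9 * K <⟨ m<n+m (9 * K) K≥1 ⟩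
          K + 9 * K ≡⟨ l≡ ⟨
          l ≤⟨ m≤m+n l _ ⟩
          l + hits U? (rest o s) ≡⟨ hits≡ U? l s o∈ pl ⟨
          H s ∎)
        , (begin
          H s ≡⟨ hits≡ U? l s o∈ pl ⟩
          l + hits U? (rest o s) ≤⟨ +-mono-≤ (≤-reflexive l≡) c ⟩
          10 * K + 8 * K ≡⟨ *-distribʳ-+ K 10 8 ⟨
          18 * K ∎)
        where
        bal₁ : Balanced G (restᵛ o s) (4 * K)
        bal₁ with offlineOpt-balanced G (restᵛ o s)
        ... | o₁ , h = o₁ , λ v → ≤-trans (h v) a
        ins : _
        ins = insert G hd U? b U⇒hv≡b l (5 * K) (5 * K) refl s o∈ pl (proj₁ bal₁)
        bal : ∀ v → headLoad G (oriented G (proj₁ ins) s) v ≤ 9 * K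
        bal v = begin
          headLoad G (oriented G (proj₁ ins) s) v ≤⟨ proj₂ ins v ⟩
          headLoad G (oriented G (proj₁ bal₁) (restᵛ o s)) v + share G hd b (5 * K) (5 * K) v
                                                    ≤⟨ +-mono-≤ (proj₂ bal₁ v) (share≤ G hd b (5 * K) v) ⟩
          4 * K + 5 * K ≡⟨ *-distribʳ-+ K 4 5 ⟨
          9 * K ∎

      -- Limits the overcounting: a sequence obtained by planting has positive excess and at most
      -- `18 * K` hits, hence arises from at most `2 ^ (18 * K)` masks.
      perSequence : ∀ s → ∑ (masks t l) (λ o → planted U? o s * good (rest o s)) ≤ 2 ^ (18 * K) * (H s ∸ offlineOpt G s)
      perSequence s with (1 ≤? H s ∸ offlineOpt G s) ×-dec (H s ≤? 18 * K)
      ... | yes (a , c) = begin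
        ∑ (masks t l) (λ o → planted U? o s * good (rest o s))
          ≤⟨ ∑-mono (masks t l) (λ o → ≤-trans (*-monoʳ-≤ (planted U? o s) (χ≤1 (good? (rest o s)))) (≤-reflexive (*-identityʳ _))) ⟩
        ∑ (masks t l) (λ o → planted U? o s) ≤⟨ ∑-planted≤ U? l s ⟩
        2 ^ H s ≤⟨ ^-monoʳ-≤ 2 c ⟩
        2 ^ (18 * K) ≤⟨ m≤m*n (2 ^ (18 * K)) (H s ∸ offlineOpt G s) {{>-nonZero a}} ⟩
        2 ^ (18 * K) * (H s ∸ offlineOpt G s) ∎
      ... | no ¬ok = ≤-trans (≤-reflexive (trans (∑-cong∈ (masks t l) vanish) (∑-zero (masks t l)))) z≤n
        where
        vanish : ∀ o → o ∈ masks t l → planted U? o s * good (rest o s) ≡ 0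
        vanish o o∈ with 1 ≤? planted U? o s
        ... | no ≰  = cong (_* good (rest o s)) (n≤0⇒n≡0 (s≤s⁻¹ (≰⇒> ≰)))
        ... | yes p = trans (cong (planted U? o s *_) (χ-no (good? (rest o s)) (λ { (a , c) → ¬ok (excess≥ s o∈ p a c) }))) (*-zeroʳ (planted U? o s))

    -- Double counting of pairs of a mask and a sequence. As an expectation: with `D` edges in `U`,
    -- the truncated difference of hits and optimum has mean at least
    -- `C(t,l) (D/m)^l / (2 * 2^(18K))`.
    excess-lower : length (masks t l) * hits U? xs ^ l * m ^ t ≤ 2 * (m ^ l * (2 ^ (18 * K) * ∑ seqs (λ s → H s ∸ offlineOpt G s)))
    excess-lower = begin
      length (masks t l) * D ^ l * m ^ t ≤⟨ *-monoʳ-≤ (length (masks t l) * D ^ l) many-good ⟩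
      length (masks t l) * D ^ l * (2 * ∑ seqs good₀) ≡⟨ e (length (masks t l)) (D ^ l) (∑ seqs good₀) ⟩
      2 * (length (masks t l) * (D ^ l * ∑ seqs good₀)) ≡⟨ cong (2 *_) (∑-const (masks t l) _) ⟨
      2 * ∑ (masks t l) (λ o → D ^ l * ∑ seqs good₀) ≤⟨ *-monoʳ-≤ 2 (∑-mono∈ (masks t l) perMask) ⟩
      2 * ∑ (masks t l) (λ o → m ^ l * ∑ seqs (λ s → planted U? o s * good (rest o s)))
                                                                ≡⟨ cong (2 *_) (trans (∑-*ˡ (masks t l) (m ^ l) _) (cong (m ^ l *_) (∑-swap (masks t l) seqs _))) ⟩
      2 * (m ^ l * ∑ seqs (λ s → ∑ (masks t l) (λ o → planted U? o s * good (rest o s))))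
                                                                ≤⟨ *-monoʳ-≤ 2 (*-monoʳ-≤ (m ^ l) (∑-mono seqs perSequence)) ⟩
      2 * (m ^ l * ∑ seqs (λ s → 2 ^ (18 * K) * (H s ∸ offlineOpt G s)))
                                                                ≡⟨ cong (λ z → 2 * (m ^ l * z)) (∑-*ˡ seqs (2 ^ (18 * K)) _) ⟩
      2 * (m ^ l * (2 ^ (18 * K) * ∑ seqs (λ s → H s ∸ offlineOpt G s))) ∎
      where
      D : ℕ
      D = hits U? xs
      e : ∀ a b c → a * b * (2 * c) ≡ 2 * (a * (b * c))
      e = solve-∀

  bigHead? : (R : Edge G → Bool) (S : Fin n → Bool) (d′ : ℕ) (b : Fin n) → Dec (d′ ≤ ∑ xs (λ e → χ (into? G hd R S b e)))
  bigHead? R S d′ b = d′ ≤? ∑ xs (λ e → χ (into? G hd R S b e))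

  -- Each big head has mean excess bounded below by `excess-lower`, whereas by `excess≤` the mean
  -- excess of all heads together is at most `K * card S`. Inserting `C(t,l) ≥ (t/l)^l` and
  -- `d′ ≥ 2Km/(tX)` leaves at most `(40X)^l * card S` big heads. The hypothesis `10 * K ≤ t` makes
  -- room for the planted positions.
  few-bigHeads : (R : Edge G → Bool) (S : Fin n → Bool) (d d′ X : ℕ) →
    (∀ b → ∑ xs (λ e → χ ((hv G hd e FP.≟ b) ×-dec T? (R e))) ≤ d) →
    t * d ≤ 2 * K * m → 2 * K * m ≤ t * X * d′ → 10 * K ≤ t →
    ∑ vs (λ b → χ (bigHead? R S d′ b)) ≤ (64 * X) ^ (10 * K) * card S
  few-bigHeads R S d d′ X indeg rate rate′ t≥ = subst (λ z → B ≤ (64 * X) ^ z * card S) l≡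
    (*-cancelʳ-≤ B _ ((K * m) ^ l) {{m^n≢0 (K * m) l {{m*n≢0 K m {{>-nonZero K≥1}} {{nonempty G}}}}}} (begin
      B * (K * m) ^ l ≤⟨ *-monoʳ-≤ B (^-monoˡ-≤ l (≤-trans (m≤n*m (K * m) 2) (≤-trans (≤-reflexive (sym (*-assoc 2 K m))) rate′))) ⟩
      B * (t * X * d′) ^ l ≡⟨ cong (B *_) (trans (^-distribʳ-* l (t * X) d′) (cong (_* d′ ^ l) (^-distribʳ-* l t X))) ⟩
      B * (t ^ l * X ^ l * d′ ^ l) ≤⟨ *-monoʳ-≤ B (*-monoˡ-≤ (d′ ^ l) (*-monoˡ-≤ (X ^ l) (length-masks≥ t l (≤-trans (≤-reflexive l≡) t≥)))) ⟩
      B * (l ^ l * length (masks t l) * X ^ l * d′ ^ l) ≡⟨ e₁ B (l ^ l) (length (masks t l)) (X ^ l) (d′ ^ l) ⟩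
      l ^ l * X ^ l * (B * (length (masks t l) * d′ ^ l)) ≤⟨ *-monoʳ-≤ (l ^ l * X ^ l) cancelled ⟩
      l ^ l * X ^ l * (2 * (m ^ l * (2 ^ (18 * K) * (K * card S)))) ≡⟨ e₂ (l ^ l) (X ^ l) (m ^ l) (2 ^ (18 * K)) K (card S) ⟩
      l ^ l * m ^ l * X ^ l * (2 * K * 2 ^ (18 * K)) * card S ≤⟨ *-monoˡ-≤ (card S) (*-mono-≤ (*-monoˡ-≤ (X ^ l) (*-monoˡ-≤ (m ^ l) (≤-reflexive (cong (_^ l) l≡)))) small) ⟩
      (10 * K) ^ l * m ^ l * X ^ l * 4 ^ l * card S ≡⟨ cong (_* card S) powers ⟩
      -- The constant 40 is raised to 64 so that `64 * X` is a power of two whenever `X` is one.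
      (10 * K * m * X * 4) ^ l * card S ≤⟨ *-monoˡ-≤ (card S) (^-monoˡ-≤ l (≤-trans (≤-reflexive (e₃ K m X)) (*-monoˡ-≤ (K * m) (*-monoˡ-≤ X (m≤m+n 40 24))))) ⟩
      (64 * X * (K * m)) ^ l * card S ≡⟨ cong (_* card S) (^-distribʳ-* l (64 * X) (K * m)) ⟩
      (64 * X) ^ l * (K * m) ^ l * card S ≡⟨ *-CS.xy∙z≈xz∙y ((64 * X) ^ l) ((K * m) ^ l) (card S) ⟩
      (64 * X) ^ l * card S * (K * m) ^ l ∎))
    where
    B : ℕ
    B = ∑ vs (λ b → χ (bigHead? R S d′ b))
    D : Fin n → ℕ
    D b = hits (into? G hd R S b) xs
    excess : Fin n → ℕ
    excess b = ∑ seqs (λ s → hits (into? G hd R S b) (toList s) ∸ offlineOpt G s)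
    e₁ : ∀ B a c x y → B * (a * c * x * y) ≡ a * x * (B * (c * y))
    e₁ = solve-∀
    e₂ : ∀ a x c y K s → a * x * (2 * (c * (y * (K * s)))) ≡ a * c * x * (2 * K * y) * s
    e₂ = solve-∀
    e₃ : ∀ K m X → 10 * K * m * X * 4 ≡ 40 * X * (K * m)
    e₃ = solve-∀
    powers : (10 * K) ^ l * m ^ l * X ^ l * 4 ^ l ≡ (10 * K * m * X * 4) ^ l
    powers = sym (trans (^-distribʳ-* l (10 * K * m * X) 4) (cong (_* 4 ^ l) (trans (^-distribʳ-* l (10 * K * m) X) (cong (_* X ^ l) (^-distribʳ-* l (10 * K) m)))))
    small : 2 * K * 2 ^ (18 * K) ≤ 4 ^ l
    small = begin
      2 * K * 2 ^ (18 * K) ≤⟨ *-monoˡ-≤ (2 ^ (18 * K)) (<⇒≤ (n<2^n (2 * K))) ⟩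
      2 ^ (2 * K) * 2 ^ (18 * K) ≡⟨ ^-distribˡ-+-* 2 (2 * K) (18 * K) ⟨
      2 ^ (2 * K + 18 * K) ≡⟨ cong (2 ^_) (trans (e₅ K) (cong (2 *_) (sym l≡))) ⟩
      2 ^ (2 * l) ≡⟨ ^-*-assoc 2 2 l ⟨
      4 ^ l ∎
      where
      e₅ : ∀ K → 2 * K + 18 * K ≡ 2 * (10 * K)
      e₅ = solve-∀
    D≤d : ∀ b → D b ≤ d
    D≤d b = ≤-trans (∑-mono xs (λ e → χ-mono (into? G hd R S b e) ((hv G hd e FP.≟ b) ×-dec T? (R e)) (λ { (p , r , _) → p , r }))) (indeg b)
    perHead : ∀ b → χ (bigHead? R S d′ b) * (length (masks t l) * d′ ^ l * m ^ t) ≤ 2 * (m ^ l * (2 ^ (18 * K) * excess b))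
    perHead b with bigHead? R S d′ b
    ... | no _   = z≤n
    ... | yes le = begin
      1 * (length (masks t l) * d′ ^ l * m ^ t) ≡⟨ *-identityˡ _ ⟩
      length (masks t l) * d′ ^ l * m ^ t ≤⟨ *-monoˡ-≤ (m ^ t) (*-monoʳ-≤ (length (masks t l)) (^-monoˡ-≤ l le)) ⟩
      length (masks t l) * D b ^ l * m ^ t ≤⟨ excess-lower (into? G hd R S b) b (λ _ → proj₁) (≤-trans (*-monoʳ-≤ t (D≤d b)) rate) ⟩
      2 * (m ^ l * (2 ^ (18 * K) * excess b)) ∎
    totalExcess : ∑ vs excess ≤ K * m ^ t * card S
    totalExcess = begin
      ∑ vs excess ≡⟨ ∑-swap vs seqs _ ⟩
      ∑ seqs (λ s → ∑ vs (λ b → hits (into? G hd R S b) (toList s) ∸ offlineOpt G s))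
                                             ≤⟨ ∑-mono seqs (λ s → excess≤ G hd s (offlineOpt-balanced G s) R S) ⟩
      ∑ seqs (λ s → offlineOpt G s * card S) ≡⟨ ∑-*ʳ seqs (card S) _ ⟩
      ∑ seqs (offlineOpt G) * card S ≤⟨ *-monoˡ-≤ (card S) opt≤K ⟩
      K * m ^ t * card S ∎
    cancelled : B * (length (masks t l) * d′ ^ l) ≤ 2 * (m ^ l * (2 ^ (18 * K) * (K * card S)))
    cancelled = *-cancelʳ-≤ _ _ (m ^ t) {{m^n≢0 m t {{nonempty G}}}} (begin
      B * (length (masks t l) * d′ ^ l) * m ^ t ≡⟨ *-assoc B _ _ ⟩
      B * (length (masks t l) * d′ ^ l * m ^ t) ≡⟨ ∑-*ʳ vs _ _ ⟨
      ∑ vs (λ b → χ (bigHead? R S d′ b) * (length (masks t l) * d′ ^ l * m ^ t)) ≤⟨ ∑-mono vs perHead ⟩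
      ∑ vs (λ b → 2 * (m ^ l * (2 ^ (18 * K) * excess b)))
        ≡⟨ trans (∑-*ˡ vs 2 _) (cong (2 *_) (trans (∑-*ˡ vs (m ^ l) _) (cong (m ^ l *_) (∑-*ˡ vs (2 ^ (18 * K)) excess)))) ⟩
      2 * (m ^ l * (2 ^ (18 * K) * ∑ vs excess)) ≤⟨ *-monoʳ-≤ 2 (*-monoʳ-≤ (m ^ l) (*-monoʳ-≤ (2 ^ (18 * K)) totalExcess)) ⟩
      2 * (m ^ l * (2 ^ (18 * K) * (K * m ^ t * card S))) ≡⟨ e₆ (m ^ l) (2 ^ (18 * K)) K (m ^ t) (card S) ⟩
      2 * (m ^ l * (2 ^ (18 * K) * (K * card S))) * m ^ t ∎)
      where
      e₆ : ∀ a b K x s → 2 * (a * (b * (K * x * s))) ≡ 2 * (a * (b * (K * s))) * x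
      e₆ = solve-∀

-- Orientation and scales

fromDoes : {P : Set} (p? : Dec P) → T (does p?) → P
fromDoes (yes p) _ = p

toDoes : {P : Set} (p? : Dec P) → P → T (does p?)
toDoes (yes _) _ = tt
toDoes (no ¬p) p = contradiction p ¬p

T-∧-not : ∀ x {y} → T (x ∧ not y) → T x × ¬ T y
T-∧-not true {false} _ = tt , λ ()

module _ {n : ℕ} where

  -- The vertices still present at the moment when `a` is peeled off, `a` included.
  above : (Fin n → ℕ) → Fin n → Fin n → Bool
  above rank a v = rank a ≤ᵇ rank v

  above⁺ : ∀ rank {a v} → rank a ≤ rank v → T (above rank a v)
  above⁺ rank le = ≤⇒≤ᵇ le

  ∃-below-average : (S : Fin n → Bool) (g : Fin n → ℕ) (c : ℕ) → 1 ≤ card S →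
    ∑ (allFin n) (λ a → χ (T? (S a)) * g a) ≤ c * card S → ∃[ a ] (T (S a) × g a ≤ c)
  ∃-below-average S g c ne h with averaging A g (λ _ → c) A≢[] (begin
      ∑ A g ≡⟨ ∑-filter (T? ∘ S) (allFin n) g ⟩
      ∑ (allFin n) (λ a → χ (T? (S a)) * g a) ≤⟨ h ⟩
      c * card S ≡⟨ *-comm c (card S) ⟩
      card S * c ≡⟨ cong (_* c) (length-filter (T? ∘ S) (allFin n)) ⟨
      length A * c ≡⟨ ∑-const A c ⟨
      ∑ A (λ _ → c) ∎)
    where
    A : List (Fin n)
    A = filter (T? ∘ S) (allFin n)
    A≢[] : A ≢ []
    A≢[] eq = contradiction (≤-trans ne (≤-reflexive (trans (sym (length-filter (T? ∘ S) (allFin n))) (cong length eq)))) (λ ())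
  ... | a , a∈ , le = a , proj₂ (∈-filter⁻ (T? ∘ S) {xs = allFin n} a∈) , le

  module _ (f : Fin n → (Fin n → Bool) → ℕ) (f-cong : ∀ a {S S′} → (∀ v → S v ≡ S′ v) → f a S ≡ f a S′)
    (c : ℕ) (choose : ∀ S → 1 ≤ card S → ∃[ a ] (T (S a) × f a S ≤ c)) where

    private
      ≤ᵇ-suc : ∀ x y → (suc x ≤ᵇ suc y) ≡ (x ≤ᵇ y)
      ≤ᵇ-suc zero    y = refl
      ≤ᵇ-suc (suc x) y = refl

      peelFrom : ∀ N S → card S ≤ N → Σ (Fin n → ℕ) (λ rank → ∀ a → T (S a) → f a (λ v → S v ∧ above rank a v) ≤ c)
      peelFrom N S le with 1 ≤? card S
      ... | no empty = (λ _ → 0) , λ a s → contradiction (≤-trans (1≤χ (T? (S a)) s) (∈⇒≤∑ (λ v → χ (T? (S v))) (∈-allFin a))) empty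
      peelFrom zero    S le | yes ne = contradiction (≤-trans ne le) (λ ())
      peelFrom (suc N) S le | yes ne with choose S ne
      ... | a₀ , s₀ , f≤c with peelFrom N (λ v → S v ∧ not (does (v FP.≟ a₀))) (s≤s⁻¹ (≤-trans smaller le))
        where
        smaller : card (λ v → S v ∧ not (does (v FP.≟ a₀))) < card S
        smaller = begin
          suc (card (λ v → S v ∧ not (does (v FP.≟ a₀)))) ≡⟨ cong (_+ card (λ v → S v ∧ not (does (v FP.≟ a₀)))) (∑-δ-allFin a₀ (λ _ → 1)) ⟨
          ∑ (allFin n) (λ v → χ (a₀ FP.≟ v) * 1) + card (λ v → S v ∧ not (does (v FP.≟ a₀))) ≡⟨ ∑-+ (allFin n) _ _ ⟨
          ∑ (allFin n) (λ v → χ (a₀ FP.≟ v) * 1 + χ (T? (S v ∧ not (does (v FP.≟ a₀))))) ≤⟨ ∑-mono (allFin n) split ⟩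
          card S ∎
          where
          split : ∀ v → χ (a₀ FP.≟ v) * 1 + χ (T? (S v ∧ not (does (v FP.≟ a₀)))) ≤ χ (T? (S v))
          split v with v FP.≟ a₀
          ... | yes refl rewrite ∧-zeroʳ (S v) = ≤-trans (≤-reflexive (+-identityʳ _)) (≤-trans (≤-reflexive (*-identityʳ _)) (≤-trans (χ≤1 (a₀ FP.≟ a₀)) (1≤χ (T? (S v)) s₀)))
          ... | no v≢a₀ rewrite ∧-identityʳ (S v) = ≤-reflexive (cong (λ z → z * 1 + χ (T? (S v))) (χ-no (a₀ FP.≟ v) (λ eq → v≢a₀ (sym eq))))
      ... | rank′ , h = rank , bound
        where
        rank : Fin n → ℕ
        rank v = if does (v FP.≟ a₀) then 0 else suc (rank′ v)
        same : ∀ a → a ≢ a₀ → ∀ v → (S v ∧ above rank a v) ≡ ((S v ∧ not (does (v FP.≟ a₀))) ∧ above rank′ a v)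
        same a a≢ v with a FP.≟ a₀
        ... | yes eq = contradiction eq a≢
        ... | no _ with v FP.≟ a₀
        ...   | yes refl = trans (∧-zeroʳ (S v)) (sym (cong (_∧ above rank′ a v) (∧-zeroʳ (S v))))
        ...   | no _     = cong₂ _∧_ (sym (∧-identityʳ (S v))) (≤ᵇ-suc (rank′ a) (rank′ v))
        first : ∀ v → (S v ∧ above rank a₀ v) ≡ S v
        first v with a₀ FP.≟ a₀
        ... | yes _ = ∧-identityʳ (S v)
        ... | no ne = contradiction refl ne
        bound : ∀ a → T (S a) → f a (λ v → S v ∧ above rank a v) ≤ c
        bound a s = byCases (a FP.≟ a₀)
          where
          kept : ∀ {x y} → T x → a ≢ a₀ → y ≡ does (a FP.≟ a₀) → T (x ∧ not y)
          kept {true} _ a≢ refl with a FP.≟ a₀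
          ... | yes eq = contradiction eq a≢
          ... | no _   = tt
          byCases : Dec (a ≡ a₀) → f a (λ v → S v ∧ above rank a v) ≤ c
          byCases (yes refl) = ≤-trans (≤-reflexive (f-cong a first)) f≤c
          byCases (no a≢)    = ≤-trans (≤-reflexive (f-cong a (same a a≢))) (h a (kept s a≢ refl))

    -- A degeneracy order: `choose` is applied again and again to the set of remaining vertices, and
    -- the rank is the time of removal. Sets are Boolean functions, so `f-cong` stands in for
    -- extensionality when the remaining set is identified with `above rank a`.
    peel : Σ (Fin n → ℕ) (λ rank → ∀ a → f a (above rank a) ≤ c)
    peel with peelFrom n (λ _ → true) (≤-reflexive (trans (sym (length≡∑ (allFin n))) (length-allFin n)))
    ... | rank , h = rank , λ a → h a tt

argmin : {A : Set} (r : A → ℕ) (x : A) (xs : List A) → ∃[ y ] (y ∈ (x ∷ xs) × All (λ z → r y ≤ r z) (x ∷ xs))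
argmin r x [] = x , here refl , ≤-refl ∷ []
argmin r x (z ∷ zs) with argmin r z zs
... | y , y∈ , least with r x ≤? r y
...   | yes le = x , here refl , ≤-refl ∷ All.map (≤-trans le) least
...   | no ≰   = y , there y∈ , <⇒≤ (≰⇒> ≰) ∷ least

module _ {n : ℕ} (G : Graph n) (t K : ℕ) (opt≤K : ∑ (sequences G t) (offlineOpt G) ≤ K * #E G ^ t) where

  private
    m : ℕ
    m = #E G
    xs : List (Edge G)
    xs = allEdges G
    vs : List (Fin n)
    vs = allFin n

  -- Each edge arrives `t/m` times on average, so averaging `density` over all sequences yields a
  -- density bound for the base graph itself.
  density-mean : {P : Fin n → Set} (P? : ∀ v → Dec (P v)) → t * ∑ xs (λ e → χ (inside? G P? e)) ≤ K * m * ∑ (allFin n) (λ v → χ (P? v))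
  density-mean P? = *-cancelʳ-≤ _ _ (m ^ t) {{m^n≢0 m t {{nonempty G}}}} (begin
    t * ∑ xs (λ e → χ (inside? G P? e)) * m ^ t ≡⟨ cong (λ z → t * ∑ xs (λ e → χ (inside? G P? e)) * z ^ t) (length-allFin m) ⟨
    t * ∑ xs (λ e → χ (inside? G P? e)) * length xs ^ t ≡⟨ ∑-hits (inside? G P?) xs t ⟨
    length xs * Z ≡⟨ cong (_* Z) (length-allFin m) ⟩
    m * Z ≤⟨ *-monoʳ-≤ m (∑-mono (sequences G t) (λ s → density G s (offlineOpt-balanced G s) P?)) ⟩
    m * ∑ (sequences G t) (λ s → offlineOpt G s * C) ≡⟨ cong (m *_) (∑-*ʳ (sequences G t) C (offlineOpt G)) ⟩
    m * (∑ (sequences G t) (offlineOpt G) * C) ≤⟨ *-monoʳ-≤ m (*-monoˡ-≤ C opt≤K) ⟩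
    m * (K * m ^ t * C) ≡⟨ e m K (m ^ t) C ⟩
    K * m * C * m ^ t ∎)
    where
    Z C : ℕ
    Z = ∑ (sequences G t) (λ s → hits (inside? G P?) (toList s))
    C = ∑ (allFin n) (λ v → χ (P? v))
    e : ∀ m K x C → m * (K * x * C) ≡ K * m * C * x
    e = solve-∀

  private
    in²? : (S : Fin n → Bool) (e : Edge G) → Dec (T (S (head G true e)) × T (S (head G false e)))
    in²? S e = inside? G (T? ∘ S) e

    degreeIn : Fin n → (Fin n → Bool) → ℕ
    degreeIn a S = ∑ xs (λ e → χ (in²? S e) * (χ (head G true e FP.≟ a) + χ (head G false e FP.≟ a)))

    degreeIn-cong : ∀ a {S S′} → (∀ v → S v ≡ S′ v) → degreeIn a S ≡ degreeIn a S′
    degreeIn-cong a {S} {S′} eq = ∑-cong xs (λ e → cong (_* (χ (head G true e FP.≟ a) + χ (head G false e FP.≟ a)))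
      (χ-cong (in²? S e) (in²? S′ e) (λ { (p , q) → subst T (eq _) p , subst T (eq _) q }) (λ { (p , q) → subst T (sym (eq _)) p , subst T (sym (eq _)) q })))

    ∑-degreeIn : ∀ S → ∑ vs (λ a → degreeIn a S) ≡ 2 * ∑ xs (λ e → χ (in²? S e))
    ∑-degreeIn S = begin-equality
      ∑ vs (λ a → degreeIn a S) ≡⟨ ∑-swap vs xs _ ⟩
      ∑ xs (λ e → ∑ vs (λ a → χ (in²? S e) * (χ (head G true e FP.≟ a) + χ (head G false e FP.≟ a))))
        ≡⟨ ∑-cong xs (λ e → trans (∑-*ˡ vs (χ (in²? S e)) _) (trans (cong (χ (in²? S e) *_) (trans (∑-+ vs _ _) (cong₂ _+_ (one (head G true e)) (one (head G false e))))) (*-comm (χ (in²? S e)) 2))) ⟩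
      ∑ xs (λ e → 2 * χ (in²? S e)) ≡⟨ ∑-*ˡ xs 2 _ ⟩
      2 * ∑ xs (λ e → χ (in²? S e)) ∎
      where
      one : ∀ w → ∑ vs (λ a → χ (w FP.≟ a)) ≡ 1
      one w = trans (∑-cong vs (λ a → sym (*-identityʳ _))) (∑-δ-allFin w (λ _ → 1))

  private
    -- The degrees inside `S` sum to twice the number of edges inside `S`, so their average is at
    -- most `2Km/t`, which is less than `d + 1`.
    low-degree-vertex : (d : ℕ) → 2 * K * m < t * suc d → ∀ S → 1 ≤ card S → ∃[ a ] (T (S a) × degreeIn a S ≤ d)
    low-degree-vertex d 2Km< S ne = proj₁ low , proj₁ (proj₂ low) , s≤s⁻¹ (*-cancelˡ-< t _ _ (≤-<-trans (proj₂ (proj₂ low)) 2Km<))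
      where
      e₁ : ∀ t z → t * (2 * z) ≡ 2 * (t * z)
      e₁ = solve-∀
      e₂ : ∀ K m c → 2 * (K * m * c) ≡ 2 * K * m * c
      e₂ = solve-∀
      total : ∑ vs (λ a → χ (T? (S a)) * (t * degreeIn a S)) ≤ 2 * K * m * card S
      total = begin
        ∑ vs (λ a → χ (T? (S a)) * (t * degreeIn a S)) ≤⟨ ∑-mono vs (λ a → ≤-trans (*-monoˡ-≤ (t * degreeIn a S) (χ≤1 (T? (S a)))) (≤-reflexive (*-identityˡ _))) ⟩
        ∑ vs (λ a → t * degreeIn a S) ≡⟨ trans (∑-*ˡ vs t _) (cong (t *_) (∑-degreeIn S)) ⟩
        t * (2 * ∑ xs (λ e → χ (in²? S e))) ≡⟨ e₁ t (∑ xs (λ e → χ (in²? S e))) ⟩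
        2 * (t * ∑ xs (λ e → χ (in²? S e))) ≤⟨ *-monoʳ-≤ 2 (density-mean (T? ∘ S)) ⟩
        2 * (K * m * card S) ≡⟨ e₂ K m (card S) ⟩
        2 * K * m * card S ∎
      low : ∃[ a ] (T (S a) × t * degreeIn a S ≤ 2 * K * m)
      low = ∃-below-average S (λ a → t * degreeIn a S) (2 * K * m) ne total

    -- The head is the end that is peeled off first. Hence every edge into `b` lies inside the set
    -- from which `b` was removed, where `b` has degree at most `d`.
    orientByRank : (d : ℕ) (rank : Fin n → ℕ) → (∀ a → degreeIn a (above rank a) ≤ d) →
      Σ (Edge G → Bool) (λ hd → ∀ b → ∑ xs (λ e → χ (hv G hd e FP.≟ b)) ≤ d)
    orientByRank d rank h = hd , λ b → ≤-trans (∑-mono xs (pointwise b)) (h b)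
      where
      hd : Edge G → Bool
      hd e = rank (head G true e) ≤ᵇ rank (head G false e)
      headFirst : ∀ e → rank (hv G hd e) ≤ rank (head G true e) × rank (hv G hd e) ≤ rank (head G false e)
      headFirst e = byHead (hd e) refl
        where
        byHead : ∀ c → c ≡ (rank (head G true e) ≤ᵇ rank (head G false e)) →
          rank (head G c e) ≤ rank (head G true e) × rank (head G c e) ≤ rank (head G false e)
        byHead true  eq = ≤-refl , ≤ᵇ⇒≤ _ _ (subst T eq tt)
        byHead false eq = ≰⇒≥ (λ le → subst T (sym eq) (≤⇒≤ᵇ le)) , ≤-refl
      end : ∀ b c e → head G c e ≡ b → 1 ≤ χ (head G true e FP.≟ b) + χ (head G false e FP.≟ b)
      end b true  e eq = ≤-trans (1≤χ (head G true e FP.≟ b) eq) (m≤m+n _ _)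
      end b false e eq = ≤-trans (1≤χ (head G false e FP.≟ b) eq) (m≤n+m _ _)
      pointwise : ∀ b e → χ (hv G hd e FP.≟ b) ≤ χ (inside? G (T? ∘ above rank b) e) * (χ (head G true e FP.≟ b) + χ (head G false e FP.≟ b))
      pointwise b e = χ≤ (hv G hd e FP.≟ b) (λ { refl →
        *-mono-≤ (1≤χ (inside? G (T? ∘ above rank b) e) (above⁺ rank (proj₁ (headFirst e)) , above⁺ rank (proj₂ (headFirst e)))) (end b (hd e) e refl) })

  low-indegree-orientation : (d : ℕ) → 2 * K * m < t * suc d →
    Σ (Edge G → Bool) (λ hd → ∀ b → ∑ xs (λ e → χ (hv G hd e FP.≟ b)) ≤ d)
  low-indegree-orientation d 2Km< = orientByRank d (proj₁ peeled) (proj₂ peeled)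
    where
    peeled : Σ (Fin n → ℕ) (λ rank → ∀ a → degreeIn a (above rank a) ≤ d)
    peeled = peel degreeIn degreeIn-cong d (low-degree-vertex d 2Km<)

  module _ (K≥1 : 1 ≤ K) (10K≤t : 10 * K ≤ t) (hd : Edge G → Bool) where

    private
      hv′ tv′ : Edge G → Fin n
      hv′ = hv G hd
      tv′ = tv G hd

    out? : (R good : Edge G → Bool) (a : Fin n) (e : Edge G) → Dec (tv G hd e ≡ a × T (R e) × T (good e))
    out? R good a e = (tv′ e FP.≟ a) ×-dec (T? (R e) ×-dec T? (good e))

    in? : (R : Edge G → Bool) (b : Fin n) (e : Edge G) → Dec (hv G hd e ≡ b × T (R e))
    in? R b e = (hv′ e FP.≟ b) ×-dec T? (R e)

    scaled? : (w : Edge G → Fin n) (R : Edge G → Bool) (scale : Edge G → ℕ) (i : ℕ) (v : Fin n) (e : Edge G) → Dec (w e ≡ v × T (R e) × scale e ≡ i)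
    scaled? w R scale i v e = (w e FP.≟ v) ×-dec (T? (R e) ×-dec (scale e ≟ i))

    module _ (R : Edge G → Bool) (d d′ X : ℕ) where

      private
        big? : (S : Fin n → Bool) (b : Fin n) → Dec (suc d′ ≤ ∑ xs (λ e → χ (into? G hd R S b e)))
        big? S b = bigHead? G hd t K K≥1 opt≤K R S (suc d′) b

        f : Fin n → (Fin n → Bool) → ℕ
        f a S = ∑ xs (λ e → χ ((tv′ e FP.≟ a) ×-dec (T? (R e))) * χ (big? S (hv′ e)))

        into-cong : ∀ {S S′} → (∀ v → S v ≡ S′ v) → ∀ b → ∑ xs (λ e → χ (into? G hd R S b e)) ≡ ∑ xs (λ e → χ (into? G hd R S′ b e))
        into-cong {S} {S′} eq b = ∑-cong xs (λ e → χ-cong (into? G hd R S b e) (into? G hd R S′ b e)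
          (λ { (p , q , r) → p , q , subst T (eq _) r }) (λ { (p , q , r) → p , q , subst T (sym (eq _)) r }))
        f-cong : ∀ a {S S′} → (∀ v → S v ≡ S′ v) → f a S ≡ f a S′
        f-cong a {S} {S′} eq = ∑-cong xs (λ e → cong (χ ((tv′ e FP.≟ a) ×-dec (T? (R e))) *_)
          (χ-cong (big? S (hv′ e)) (big? S′ (hv′ e)) (subst (suc d′ ≤_) (into-cong eq (hv′ e))) (subst (suc d′ ≤_) (sym (into-cong eq (hv′ e))))))

        -- The edges from `S` to big heads are recounted at the heads: `few-bigHeads` bounds the
        -- number of these heads and `d` the edges at each of them.
        total : (∀ b → ∑ xs (λ e → χ (in? R b e)) ≤ d) → t * d ≤ 2 * K * m → 2 * K * m ≤ t * X * suc d′ →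
          ∀ S → ∑ vs (λ a → χ (T? (S a)) * f a S) ≤ (64 * X) ^ (10 * K) * d * card S
        total indeg rate rate′ S = begin
          ∑ vs (λ a → χ (T? (S a)) * f a S)
            ≡⟨ ∑-cong vs (λ a → sym (∑-*ˡ xs (χ (T? (S a))) _)) ⟩
          ∑ vs (λ a → ∑ xs (λ e → χ (T? (S a)) * (χ ((tv′ e FP.≟ a) ×-dec (T? (R e))) * χ (big? S (hv′ e)))))
            ≡⟨ ∑-swap vs xs _ ⟩
          ∑ xs (λ e → ∑ vs (λ a → χ (T? (S a)) * (χ ((tv′ e FP.≟ a) ×-dec (T? (R e))) * χ (big? S (hv′ e)))))
            ≡⟨ ∑-cong xs (λ e → trans (∑-cong vs (rearrange e)) (∑-δ-allFin (tv′ e) _)) ⟩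
          ∑ xs (λ e → χ (T? (S (tv′ e))) * χ (T? (R e)) * χ (big? S (hv′ e)))
            ≡⟨ ∑-cong xs (λ e → trans (sym (∑-δ-allFin (hv′ e) (λ b → χ (T? (S (tv′ e))) * χ (T? (R e)) * χ (big? S b)))) (∑-cong vs (rearrange′ e))) ⟩
          ∑ xs (λ e → ∑ vs (λ b → χ (big? S b) * χ (into? G hd R S b e)))
            ≡⟨ ∑-swap xs vs _ ⟩
          ∑ vs (λ b → ∑ xs (λ e → χ (big? S b) * χ (into? G hd R S b e)))
            ≡⟨ ∑-cong vs (λ b → ∑-*ˡ xs (χ (big? S b)) _) ⟩
          ∑ vs (λ b → χ (big? S b) * ∑ xs (λ e → χ (into? G hd R S b e)))
            ≤⟨ ∑-mono vs (λ b → *-monoʳ-≤ (χ (big? S b)) (≤-trans (∑-mono xs (λ e → χ-mono (into? G hd R S b e) (in? R b e) (λ { (p , r , _) → p , r }))) (indeg b))) ⟩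
          ∑ vs (λ b → χ (big? S b) * d)
            ≡⟨ ∑-*ʳ vs d _ ⟩
          ∑ vs (λ b → χ (big? S b)) * d
            ≤⟨ *-monoˡ-≤ d (few-bigHeads G hd t K K≥1 opt≤K R S d (suc d′) X indeg rate rate′ 10K≤t) ⟩
          (64 * X) ^ (10 * K) * card S * d
            ≡⟨ *-CS.xy∙z≈xz∙y ((64 * X) ^ (10 * K)) (card S) d ⟩
          (64 * X) ^ (10 * K) * d * card S ∎
          where
          e₂ : ∀ s a r g → s * (a * r * g) ≡ a * (s * r * g)
          e₂ = solve-∀
          e₃ : ∀ a s r g → a * (s * r * g) ≡ g * (a * (r * s))
          e₃ = solve-∀
          rearrange : ∀ e a → χ (T? (S a)) * (χ ((tv′ e FP.≟ a) ×-dec (T? (R e))) * χ (big? S (hv′ e))) ≡ χ (tv′ e FP.≟ a) * (χ (T? (S a)) * χ (T? (R e)) * χ (big? S (hv′ e)))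
          rearrange e a = trans (cong (λ z → χ (T? (S a)) * (z * χ (big? S (hv′ e)))) (χ-× (tv′ e FP.≟ a) (T? (R e)))) (e₂ (χ (T? (S a))) (χ (tv′ e FP.≟ a)) (χ (T? (R e))) _)
          rearrange′ : ∀ e b → χ (hv′ e FP.≟ b) * (χ (T? (S (tv′ e))) * χ (T? (R e)) * χ (big? S b)) ≡ χ (big? S b) * χ (into? G hd R S b e)
          rearrange′ e b = trans (e₃ (χ (hv′ e FP.≟ b)) (χ (T? (S (tv′ e)))) (χ (T? (R e))) (χ (big? S b)))
            (cong (χ (big? S b) *_) (sym (trans (χ-× (hv′ e FP.≟ b) (T? (R e) ×-dec T? (S (tv′ e)))) (cong (χ (hv′ e FP.≟ b) *_) (χ-× (T? (R e)) (T? (S (tv′ e))))))))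

        splitByRank : (rank : Fin n → ℕ) → (∀ a → f a (above rank a) ≤ (64 * X) ^ (10 * K) * d) →
          Σ (Edge G → Bool) (λ good →
            (∀ a → ∑ xs (λ e → χ (out? R good a e)) ≤ (64 * X) ^ (10 * K) * d) ×
            (∀ b → ∑ xs (λ e → χ ((hv′ e FP.≟ b) ×-dec T? (R e ∧ not (good e)))) ≤ d′))
        splitByRank rank h = good , out , inBad
          where
          good : Edge G → Bool
          good e = does (big? (above rank (tv′ e)) (hv′ e))
          out : ∀ a → ∑ xs (λ e → χ (out? R good a e)) ≤ (64 * X) ^ (10 * K) * d
          out a = ≤-trans (∑-mono xs pointwise) (h a)
            where
            pointwise : ∀ e → χ (out? R good a e) ≤ χ ((tv′ e FP.≟ a) ×-dec (T? (R e))) * χ (big? (above rank a) (hv′ e))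
            pointwise e = χ≤ (out? R good a e) (λ { (refl , r , g) → *-mono-≤
              (1≤χ ((tv′ e FP.≟ tv′ e) ×-dec (T? (R e))) (refl , r))
              (1≤χ (big? (above rank a) (hv′ e)) (fromDoes (big? (above rank a) (hv′ e)) g)) })
          inBad : ∀ b → ∑ xs (λ e → χ ((hv′ e FP.≟ b) ×-dec T? (R e ∧ not (good e)))) ≤ d′
          inBad b = bound (filter bad? xs) refl
            where
            bad? : ∀ e → Dec (hv′ e ≡ b × T (R e ∧ not (good e)))
            bad? e = (hv′ e FP.≟ b) ×-dec T? (R e ∧ not (good e))
            notBig : ∀ e → T (R e ∧ not (good e)) → ∑ xs (λ z → χ (into? G hd R (above rank (tv′ e)) (hv′ e) z)) ≤ d′
            notBig e bad = s≤s⁻¹ (≰⇒> (λ big → proj₂ (T-∧-not (R e) bad) (toDoes (big? (above rank (tv′ e)) (hv′ e)) big)))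
            bound : ∀ bs → filter bad? xs ≡ bs → ∑ xs (λ e → χ (bad? e)) ≤ d′
            bound [] eq = ≤-trans (≤-reflexive (trans (sym (length-filter bad? xs)) (cong length eq))) z≤n
            -- Take a bad edge into `b` whose tail is peeled off first. At that moment the tails of
            -- all bad edges into `b` are still present, yet `b` is not big; so these edges number
            -- at most `d′`.
            bound (e₀ ∷ es) eq with argmin (rank ∘ tv′) e₀ es
            ... | e , e∈ , least with ∈-filter⁻ bad? {xs = xs} (subst (e ∈_) (sym eq) e∈)
            ... | _ , refl , bad = ≤-trans (∑-mono∈ xs pointwise) (notBig e bad)
              where
              pointwise : ∀ z → z ∈ xs → χ (bad? z) ≤ χ (into? G hd R (above rank (tv′ e)) (hv′ e) z)
              pointwise z z∈ = χ-mono (bad? z) (into? G hd R (above rank (tv′ e)) (hv′ e) z)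
                (λ { (p , q) → p , proj₁ (T-∧-not (R z) q) , above⁺ rank (All.lookup least (subst (z ∈_) eq (∈-filter⁺ bad? z∈ (p , q)))) })

      -- An edge is good if its head still received more than d′ edges when its tail was peeled off.
      split-scale : (∀ b → ∑ xs (λ e → χ (in? R b e)) ≤ d) → t * d ≤ 2 * K * m → 2 * K * m ≤ t * X * suc d′ →
        Σ (Edge G → Bool) (λ good →
          (∀ a → ∑ xs (λ e → χ (out? R good a e)) ≤ (64 * X) ^ (10 * K) * d) ×
          (∀ b → ∑ xs (λ e → χ ((hv′ e FP.≟ b) ×-dec T? (R e ∧ not (good e)))) ≤ d′))
      split-scale indeg rate rate′ = splitByRank (proj₁ peeled) (proj₂ peeled)
        where
        peeled : Σ (Fin n → ℕ) (λ rank → ∀ a → f a (above rank a) ≤ (64 * X) ^ (10 * K) * d)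
        peeled = peel f f-cong ((64 * X) ^ (10 * K) * d) (λ S ne → ∃-below-average S (λ a → f a S) _ ne (total indeg rate rate′ S))

    module _ (k : ℕ) (d X : ℕ → ℕ) (rate : ∀ j → t * d j ≤ 2 * K * m) (rate′ : ∀ j → 2 * K * m ≤ t * X j * suc (d j)) (d-end : d (suc k) ≡ 0) where

      -- The out-degree bound of scale `i` involves `X (suc i)` because its edges are those whose
      -- heads still exceeded the next in-degree bound `d (suc i)` when the tail was peeled off.
      record Scaling (j : ℕ) (R : Edge G → Bool) : Set where
        field
          scale  : Edge G → ℕ
          lower  : ∀ e → T (R e) → j ≤ scale e
          upper  : ∀ e → T (R e) → scale e ≤ k
          inDeg  : ∀ i → j ≤ i → ∀ b → ∑ xs (λ e → χ (scaled? hv′ R scale i b e)) ≤ d i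
          outDeg : ∀ i → j ≤ i → ∀ a → ∑ xs (λ e → χ (scaled? tv′ R scale i a e)) ≤ (64 * X (suc i)) ^ (10 * K) * d i

      private
        emptyScaling : ∀ j (R : Edge G → Bool) → (∀ e → ¬ T (R e)) → Scaling j R
        emptyScaling j R R-empty = record
          { scale  = λ _ → j
          ; lower  = λ e r → contradiction r (R-empty e)
          ; upper  = λ e r → contradiction r (R-empty e)
          ; inDeg  = λ i _ b → ≤-trans (∑-mono xs (λ e → χ≤0 (scaled? hv′ R (λ _ → j) i b e) (λ { (_ , r , _) → R-empty e r }))) (≤-trans (≤-reflexive (∑-zero xs)) z≤n)
          ; outDeg = λ i _ a → ≤-trans (∑-mono xs (λ e → χ≤0 (scaled? tv′ R (λ _ → j) i a e) (λ { (_ , r , _) → R-empty e r }))) (≤-trans (≤-reflexive (∑-zero xs)) z≤n)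
          }
          where
          χ≤0 : {P : Set} (p? : Dec P) → ¬ P → χ p? ≤ 0
          χ≤0 p? ¬p = ≤-reflexive (χ-no p? ¬p)

        addScale : ∀ j → j ≤ k → (R good : Edge G → Bool) →
          (∀ b → ∑ xs (λ e → χ (in? R b e)) ≤ d j) →
          (∀ a → ∑ xs (λ e → χ (out? R good a e)) ≤ (64 * X (suc j)) ^ (10 * K) * d j) →
          Scaling (suc j) (λ e → R e ∧ not (good e)) → Scaling j R
        addScale j j≤k R good indeg out rest = record { scale = sc ; lower = lo ; upper = up ; inDeg = inn ; outDeg = outt }
          where
          module S = Scaling rest
          R′ : Edge G → Bool
          R′ e = R e ∧ not (good e)
          sc : Edge G → ℕ
          sc e = if good e then j else S.scale e
          lo : ∀ e → T (R e) → j ≤ sc e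
          lo e r with R e | good e | S.lower e
          ... | true | true  | _ = ≤-refl
          ... | true | false | h = ≤-trans (n≤1+n j) (h tt)
          up : ∀ e → T (R e) → sc e ≤ k
          up e r with R e | good e | S.upper e
          ... | true | true  | _ = j≤k
          ... | true | false | h = h tt
          isGood : ∀ e → T (R e) → sc e ≡ j → T (good e)
          isGood e r eq with R e | good e | S.lower e
          ... | true | true  | _ = tt
          ... | true | false | h = contradiction (≤-trans (h tt) (≤-reflexive eq)) 1+n≰n
          isBad : ∀ e i → j < i → T (R e) → sc e ≡ i → T (R e ∧ not (good e)) × S.scale e ≡ i
          isBad e i lt r eq with R e | good e
          ... | true | true  = contradiction (≤-trans lt (≤-reflexive (sym eq))) 1+n≰n
          ... | true | false = tt , eq
          inn : ∀ i → j ≤ i → ∀ b → ∑ xs (λ e → χ (scaled? hv′ R sc i b e)) ≤ d i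
          inn i j≤i b with m≤n⇒m<n∨m≡n j≤i
          ... | inj₂ refl = ≤-trans (∑-mono xs (λ e → χ-mono (scaled? hv′ R sc i b e) (in? R b e) (λ { (p , r , _) → p , r }))) (indeg b)
          ... | inj₁ j<i  = ≤-trans (∑-mono xs (λ e → χ-mono (scaled? hv′ R sc i b e) (scaled? hv′ R′ S.scale i b e) (λ { (p , r , q) → p , isBad e i j<i r q }))) (S.inDeg i j<i b)
          outt : ∀ i → j ≤ i → ∀ a → ∑ xs (λ e → χ (scaled? tv′ R sc i a e)) ≤ (64 * X (suc i)) ^ (10 * K) * d i
          outt i j≤i a with m≤n⇒m<n∨m≡n j≤i
          ... | inj₂ refl = ≤-trans (∑-mono xs (λ e → χ-mono (scaled? tv′ R sc i a e) (out? R good a e) (λ { (p , r , q) → p , r , isGood e r q }))) (out a)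
          ... | inj₁ j<i  = ≤-trans (∑-mono xs (λ e → χ-mono (scaled? tv′ R sc i a e) (scaled? tv′ R′ S.scale i a e) (λ { (p , r , q) → p , isBad e i j<i r q }))) (S.outDeg i j<i a)

      scaleFrom : ∀ fuel j → j + fuel ≡ suc k → (R : Edge G → Bool) →
        (∀ b → ∑ xs (λ e → χ (in? R b e)) ≤ d j) → Scaling j R
      -- Here `j` is `suc k`, and `d (suc k) ≡ 0` leaves no edge without a scale.
      scaleFrom zero j j≡ R indeg = emptyScaling j R R-empty
        where
        d≡0 : d j ≡ 0
        d≡0 = trans (cong d (trans (sym (+-identityʳ j)) j≡)) d-end
        R-empty : ∀ e → ¬ T (R e)
        R-empty e r = contradiction (≤-trans (≤-trans (1≤χ (in? R (hv′ e) e) (refl , r))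
          (∈⇒≤∑ (λ z → χ (in? R (hv′ e) z)) (∈-allFin e))) (≤-trans (indeg (hv′ e)) (≤-reflexive d≡0))) (λ ())
      scaleFrom (suc fuel) j j≡ R indeg =
        addScale j (s≤s⁻¹ (≤-trans (m≤m+n (suc j) fuel) (≤-reflexive j≡′))) R (proj₁ splitting) indeg (proj₁ (proj₂ splitting))
          (scaleFrom fuel (suc j) j≡′ (λ e → R e ∧ not (proj₁ splitting e)) (proj₂ (proj₂ splitting)))
        where
        j≡′ : suc j + fuel ≡ suc k
        j≡′ = trans (sym (+-suc j fuel)) j≡
        splitting : _
        splitting = split-scale R (d j) (d (suc j)) (X (suc j)) indeg (rate j) (rate′ (suc j))

      scaling : (∀ b → ∑ xs (λ e → χ (hv′ e FP.≟ b)) ≤ d 0) → Scaling 0 (λ _ → true)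
      scaling indeg = scaleFrom (suc k) 0 refl (λ _ → true) (λ b → ≤-trans (∑-mono xs (λ e → χ-mono (in? (λ _ → true) b e) (hv′ e FP.≟ b) proj₁)) (indeg b))

-- The layered algorithm

module Layered {n : ℕ} (G : Graph n) (hd : Edge G → Bool) (sc : Edge G → ℕ) (k L : ℕ) (sc≤k : ∀ e → sc e ≤ k) where

  private
    m : ℕ
    m = #E G
    seqs : ∀ t → List (Vec (Edge G) t)
    seqs t = sequences G t
    xs : List (Edge G)
    xs = allEdges G

  Log : Set
  Log = List (Edge G × ℕ)

  flip : ℕ → Bool → Bool
  flip zero    b = b
  flip (suc i) b = not (flip i b)

  -- Only the parity of `i - sc e` matters, and `i + sc e` has the same parity without truncated
  -- subtraction.
  side : Edge G → ℕ → Bool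
  side e i = flip (i + sc e) (hd e)

  target : Edge G → ℕ → Fin n
  target e i = head G (side e i) e

  side-scale : ∀ e → side e (sc e) ≡ hd e
  side-scale e = even (sc e) (hd e)
    where
    even : ∀ i b → flip (i + i) b ≡ b
    even zero    b = refl
    even (suc i) b rewrite +-suc i i = trans (not-not (flip (i + i) b)) (even i b)
      where
      not-not : ∀ b → not (not b) ≡ b
      not-not true  = refl
      not-not false = refl

  entry? : (i : ℕ) (v : Fin n) (p : Edge G × ℕ) → Dec (proj₂ p ≡ i × target (proj₁ p) i ≡ v)
  entry? i v p = (proj₂ p ≟ i) ×-dec (target (proj₁ p) i FP.≟ v)

  count : Log → ℕ → Fin n → ℕ
  count log i v = ∑ log (λ p → χ (entry? i v p))

  -- The capacity is twice `L` so that a full vertex holds either `L` entries of its layer's own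
  -- scale or `L` entries pushed up from lower layers.
  Full : Log → ℕ → Fin n → Set
  Full log i v = L + L ≤ count log i v

  -- A placement carries the evidence that the layers tried before were full. This stays true while
  -- the log grows, and `Valid.chain` preserves it for the layer immediately below, which is the
  -- link between levels of a witness tree.
  data Placement (log : Log) (e : Edge G) : Set where
    placed   : (i : ℕ) → sc e ≤ i → i ≤ k → count log i (target e i) < L + L →
               (∀ j → sc e ≤ j → j < i → Full log j (target e j)) → Placement log e
    overflow : Full log k (target e k) → Placement log e

  private
    search : ∀ log e fuel i → i + fuel ≡ k → sc e ≤ i → (∀ j → sc e ≤ j → j < i → Full log j (target e j)) → Placement log e
    search log e fuel i i≡ lo full with count log i (target e i) <? L + L
    ... | yes lt = placed i lo (≤-trans (m≤m+n i fuel) (≤-reflexive i≡)) lt full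
    search log e zero       i i≡ lo full | no ≮ = overflow (subst (λ z → Full log z (target e z)) (trans (sym (+-identityʳ i)) i≡) (≮⇒≥ ≮))
    search log e (suc fuel) i i≡ lo full | no ≮ = search log e fuel (suc i) (trans (sym (+-suc i fuel)) i≡) (≤-trans lo (n≤1+n i)) full′
      where
      full′ : ∀ j → sc e ≤ j → j < suc i → Full log j (target e j)
      full′ j lo′ j<1+i with m<1+n⇒m<n∨m≡n j<1+i
      ... | inj₁ j<i  = full j lo′ j<i
      ... | inj₂ refl = ≮⇒≥ ≮

  place : ∀ log e → Placement log e
  place log e = search log e (k ∸ sc e) (sc e) (m+[n∸m]≡n (sc≤k e)) ≤-refl (λ j lo j< → contradiction (≤-trans j< lo) 1+n≰n)

  orient : ∀ {log e} → Placement log e → Bool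
  orient {e = e} (placed i _ _ _ _) = side e i
  orient {e = e} (overflow _)       = hd e

  -- Forgets everything on overflow, including the edge that caused it.
  next : ∀ {log e} → Placement log e → Log
  next {log} {e} (placed i _ _ _ _) = (e , i) ∷ log
  next           (overflow _)       = []

  -- An `OnlineAlg` has no memory of its own, so it recomputes its state from the past arrivals at
  -- every step.
  replay : Log → List (Edge G) → Log
  replay log []       = log
  replay log (e ∷ es) = replay (next (place log e)) es

  algorithm : OnlineAlg G
  algorithm past e = orient (place (replay [] past) e)

  runFrom : Log → List (Edge G) → List (Fin n)
  runFrom log []       = []
  runFrom log (e ∷ es) = head G (orient (place log e)) e ∷ runFrom (next (place log e)) es

  replay-∷ʳ : ∀ log past e → replay log (past ++ [ e ]) ≡ next (place (replay log past) e)
  replay-∷ʳ log []         e = refl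
  replay-∷ʳ log (x ∷ past) e = replay-∷ʳ (next (place log x)) past e

  run≡runFrom : ∀ past es → run G algorithm past es ≡ runFrom (replay [] past) es
  run≡runFrom past []       = refl
  run≡runFrom past (e ∷ es) = cong (head G (algorithm past e) e ∷_)
    (trans (run≡runFrom (past ++ [ e ]) es) (cong (λ log → runFrom log es) (replay-∷ʳ [] past e)))

  mutual
    overflows : Log → List (Edge G) → ℕ
    overflows log []       = 0
    overflows log (e ∷ es) = overflowsP (place log e) es

    overflowsP : ∀ {log e} → Placement log e → List (Edge G) → ℕ
    overflowsP {log} {e} (placed i _ _ _ _) es = overflows ((e , i) ∷ log) es
    overflowsP           (overflow _)       es = suc (overflows [] es)

  mutual
    -- Indicator of at least one overflow. In contrast to `overflows` it stops at the first one, the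
    -- only one that needs a probability estimate.
    overflowing : Log → List (Edge G) → ℕ
    overflowing log []       = 0
    overflowing log (e ∷ es) = overflowingP (place log e) es

    overflowingP : ∀ {log e} → Placement log e → List (Edge G) → ℕ
    overflowingP {log} {e} (placed i _ _ _ _) es = overflowing ((e , i) ∷ log) es
    overflowingP           (overflow _)       es = 1

  record Valid (log : Log) : Set where
    field
      lower : ∀ {e i} → (e , i) ∈ log → sc e ≤ i
      upper : ∀ {e i} → (e , i) ∈ log → i ≤ k
      chain : ∀ {e i} → (e , suc i) ∈ log → sc e ≤ i → Full log i (target e i)
      cap   : ∀ i v → count log i v ≤ L + L

  open Valid

  valid-[] : Valid []
  valid-[] = record { lower = λ () ; upper = λ () ; chain = λ () ; cap = λ _ _ → z≤n }

  valid-∷ : ∀ {log} e i → Valid log → sc e ≤ i → i ≤ k → count log i (target e i) < L + L →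
    (∀ j → sc e ≤ j → j < i → Full log j (target e j)) → Valid ((e , i) ∷ log)
  valid-∷ {log} e i V lo hi lt full = record
    { lower = λ { (here refl) → lo ; (there p) → lower V p }
    ; upper = λ { (here refl) → hi ; (there p) → upper V p }
    ; chain = λ { {i = j} (here refl) le → ≤-trans (full j le ≤-refl) (m≤n+m _ _) ; (there p) le → ≤-trans (chain V p le) (m≤n+m _ _) }
    ; cap   = cap′
    }
    where
    cap′ : ∀ j v → χ (entry? j v (e , i)) + count log j v ≤ L + L
    cap′ j v with entry? j v (e , i)
    ... | yes (refl , refl) = lt
    ... | no _              = cap V j v

  totalCount : Log → Fin n → ℕ
  totalCount log v = ∑ log (λ p → χ (target (proj₁ p) (proj₂ p) FP.≟ v))

  capacity : ℕ
  capacity = suc k * (L + L)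

  totalCount≤ : ∀ {log} → Valid log → ∀ v → totalCount log v ≤ capacity
  totalCount≤ {log} V v = begin
    totalCount log v ≤⟨ ∑-mono∈ log pointwise ⟩
    ∑ log (λ p → ∑ (allFin (suc k)) (λ i → χ (entry? (F.toℕ i) v p))) ≡⟨ ∑-swap log (allFin (suc k)) _ ⟩
    ∑ (allFin (suc k)) (λ i → count log (F.toℕ i) v) ≤⟨ ∑-mono (allFin (suc k)) (λ i → cap V (F.toℕ i) v) ⟩
    ∑ (allFin (suc k)) (λ _ → L + L) ≡⟨ trans (∑-const (allFin (suc k)) (L + L)) (cong (_* (L + L)) (length-allFin (suc k))) ⟩
    capacity ∎
    where
    pointwise : ∀ p → p ∈ log → χ (target (proj₁ p) (proj₂ p) FP.≟ v) ≤ ∑ (allFin (suc k)) (λ i → χ (entry? (F.toℕ i) v p))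
    pointwise (e , i) p∈ = χ≤ (target e i FP.≟ v) (λ { refl → ≤-trans
      (1≤χ (entry? (F.toℕ j) (target e i) (e , i)) (sym toℕj , cong (target e) toℕj))
      (∈⇒≤∑ (λ z → χ (entry? (F.toℕ z) (target e i) (e , i))) (∈-allFin j)) })
      where
      j : Fin (suc k)
      j = F.fromℕ< (s≤s (upper V p∈))
      toℕj : F.toℕ j ≡ i
      toℕj = FP.toℕ-fromℕ< (s≤s (upper V p∈))

  -- Between two overflows a vertex gains at most `capacity`, and the overflowing edge may add one
  -- more.
  load-runFrom : ∀ {log} → Valid log → ∀ es v → ∑ (runFrom log es) (λ w → χ (w FP.≟ v)) + totalCount log v ≤ suc (overflows log es) * suc capacity
  load-runFrom V []       v = ≤-trans (totalCount≤ V v) (≤-trans (n≤1+n capacity) (≤-reflexive (sym (*-identityˡ _))))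
  load-runFrom {log} V (e ∷ es) v with place log e
  ... | placed i lo hi lt full = ≤-trans (≤-reflexive (swap (χ (target e i FP.≟ v)) (∑ (runFrom ((e , i) ∷ log) es) (λ w → χ (w FP.≟ v))) (totalCount log v)))
        (load-runFrom (valid-∷ e i V lo hi lt full) es v)
    where
    swap : ∀ a b c → a + b + c ≡ b + (a + c)
    swap = solve-∀
  ... | overflow _ = begin
    χ (hv G hd e FP.≟ v) + ∑ (runFrom [] es) (λ w → χ (w FP.≟ v)) + totalCount log v ≡⟨ swap (χ (hv G hd e FP.≟ v)) _ (totalCount log v) ⟩
    χ (hv G hd e FP.≟ v) + totalCount log v + (∑ (runFrom [] es) (λ w → χ (w FP.≟ v)) + 0)
      ≤⟨ +-mono-≤ (+-mono-≤ (χ≤1 (hv G hd e FP.≟ v)) (totalCount≤ V v)) (load-runFrom valid-[] es v) ⟩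
    suc capacity + suc (overflows [] es) * suc capacity ∎
    where
    swap : ∀ a b c → a + b + c ≡ a + c + (b + 0)
    swap = solve-∀

  maxLoad-run≤ : ∀ es → maxLoad (run G algorithm [] es) ≤ suc (overflows [] es) * suc capacity
  maxLoad-run≤ es = maxLoad≤ (run G algorithm [] es) (λ v → ≤-trans
    (≤-reflexive (trans (cong (λ hs → load hs v) (run≡runFrom [] es)) (trans (load≡∑ (runFrom [] es) v) (sym (+-identityʳ _)))))
    (load-runFrom valid-[] es v))

  overflowCount : Log → ℕ → ℕ
  overflowCount log t = ∑ (sequences G t) (λ s → overflowing log (toList s))

  private
    ∑-sequences : ∀ t (f : Vec (Edge G) (suc t) → ℕ) → ∑ (sequences G (suc t)) f ≡ ∑ (allEdges G) (λ e → ∑ (sequences G t) (λ s → f (e V.∷ s)))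
    ∑-sequences t f = ∑-allVecs (allEdges G) t f

    ∑-sequences-const : ∀ t c → ∑ (sequences G t) (λ _ → c) ≡ m ^ t * c
    ∑-sequences-const t c = trans (∑-const (sequences G t) c) (cong (_* c) (length-sequences G t))

  overflowCount-suc : ∀ log t → m * overflowCount log t ≤ overflowCount log (suc t)
  overflowCount-suc log zero = ≤-trans (≤-reflexive (*-zeroʳ m)) z≤n
  overflowCount-suc log (suc t) = begin
    m * overflowCount log (suc t)
      ≡⟨ cong (m *_) (∑-sequences t _) ⟩
    m * ∑ xs (λ e → ∑ (seqs t) (λ s → overflowingP (place log e) (toList s)))
      ≡⟨ ∑-*ˡ xs m _ ⟨
    ∑ xs (λ e → m * ∑ (seqs t) (λ s → overflowingP (place log e) (toList s)))
      ≤⟨ ∑-mono xs (λ e → perEdge e (place log e)) ⟩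
    ∑ xs (λ e → ∑ (seqs (suc t)) (λ s → overflowingP (place log e) (toList s)))
      ≡⟨ ∑-sequences (suc t) (λ s → overflowing log (toList s)) ⟨
    overflowCount log (suc (suc t)) ∎
    where
    perEdge : ∀ e (p : Placement log e) → m * ∑ (seqs t) (λ s → overflowingP p (toList s)) ≤ ∑ (seqs (suc t)) (λ s → overflowingP p (toList s))
    perEdge e (placed i _ _ _ _) = overflowCount-suc ((e , i) ∷ log) t
    perEdge e (overflow _) = ≤-reflexive (trans (cong (m *_) (∑-sequences-const t 1)) (trans (sym (*-assoc m (m ^ t) 1)) (sym (∑-sequences-const (suc t) 1))))

  -- An overflow persists when the sequence is prolonged, so its probability increases with the
  -- horizon. The estimate for the full horizon thus covers the shorter ones that remain after a
  -- restart.
  rarely-earlier : ∀ t r → 2 * overflowCount [] (r + t) ≤ m ^ (r + t) → 2 * overflowCount [] t ≤ m ^ t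
  rarely-earlier t zero    h = h
  rarely-earlier t (suc r) h = rarely-earlier t r (*-cancelˡ-≤ m {{nonempty G}} (begin
    m * (2 * overflowCount [] (r + t)) ≡⟨ *-CS.x∙yz≈y∙xz m 2 _ ⟩
    2 * (m * overflowCount [] (r + t)) ≤⟨ *-monoʳ-≤ 2 (overflowCount-suc [] (r + t)) ⟩
    2 * overflowCount [] (suc r + t) ≤⟨ h ⟩
    m * m ^ (r + t) ∎))

  -- After an overflow the remaining arrivals are fresh, so the expected number of overflows is a
  -- geometric series with ratio at most 1/2.
  ∑-overflows≤ : ∀ t → (∀ r → r ≤ t → 2 * overflowCount [] r ≤ m ^ r) → ∀ log →
    ∑ (seqs t) (λ s → overflows log (toList s)) ≤ 2 * overflowCount log t
  ∑-overflows≤ zero    h log = z≤n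
  ∑-overflows≤ (suc t) h log = begin
    ∑ (seqs (suc t)) (λ s → overflows log (toList s))
      ≡⟨ ∑-sequences t _ ⟩
    ∑ xs (λ e → ∑ (seqs t) (λ s → overflowsP (place log e) (toList s)))
      ≤⟨ ∑-mono xs (λ e → perEdge e (place log e)) ⟩
    ∑ xs (λ e → 2 * ∑ (seqs t) (λ s → overflowingP (place log e) (toList s)))
      ≡⟨ trans (∑-*ˡ xs 2 _) (cong (2 *_) (sym (∑-sequences t _))) ⟩
    2 * overflowCount log (suc t) ∎
    where
    h′ : ∀ r → r ≤ t → 2 * overflowCount [] r ≤ m ^ r
    h′ r r≤t = h r (≤-trans r≤t (n≤1+n t))
    perEdge : ∀ e (p : Placement log e) → ∑ (seqs t) (λ s → overflowsP p (toList s)) ≤ 2 * ∑ (seqs t) (λ s → overflowingP p (toList s))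
    perEdge e (placed i _ _ _ _) = ∑-overflows≤ t h′ ((e , i) ∷ log)
    perEdge e (overflow _) = begin
      ∑ (seqs t) (λ s → 1 + overflows [] (toList s)) ≡⟨ trans (∑-+ (seqs t) _ _) (cong (_+ ∑ (seqs t) (λ s → overflows [] (toList s))) (∑-sequences-const t 1)) ⟩
      m ^ t * 1 + ∑ (seqs t) (λ s → overflows [] (toList s)) ≤⟨ +-monoʳ-≤ (m ^ t * 1) (≤-trans (∑-overflows≤ t h′ []) (h′ t ≤-refl)) ⟩
      m ^ t * 1 + m ^ t ≡⟨ dbl (m ^ t) ⟩
      2 * (m ^ t * 1) ≡⟨ cong (2 *_) (∑-sequences-const t 1) ⟨
      2 * ∑ (seqs t) (λ _ → 1) ∎
      where
      dbl : ∀ x → x * 1 + x ≡ 2 * (x * 1)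
      dbl = solve-∀

  ∑-maxLoad≤ : ∀ t → 2 * overflowCount [] t ≤ m ^ t →
    ∑ (sequences G t) (λ s → maxLoad (run G algorithm [] (toList s))) ≤ 2 * m ^ t * suc capacity
  ∑-maxLoad≤ t h = begin
    ∑ (seqs t) (λ s → maxLoad (run G algorithm [] (toList s))) ≤⟨ ∑-mono (seqs t) (λ s → maxLoad-run≤ (toList s)) ⟩
    ∑ (seqs t) (λ s → suc (overflows [] (toList s)) * suc capacity) ≡⟨ ∑-*ʳ (seqs t) (suc capacity) _ ⟩
    ∑ (seqs t) (λ s → 1 + overflows [] (toList s)) * suc capacity ≤⟨ *-monoˡ-≤ (suc capacity) bound ⟩
    2 * m ^ t * suc capacity ∎
    where
    h′ : ∀ r → r ≤ t → 2 * overflowCount [] r ≤ m ^ r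
    h′ r r≤t = rarely-earlier r (t ∸ r) (subst (λ z → 2 * overflowCount [] z ≤ m ^ z) (sym (m∸n+n≡m r≤t)) h)
    bound : ∑ (seqs t) (λ s → 1 + overflows [] (toList s)) ≤ 2 * m ^ t
    bound = begin
      ∑ (seqs t) (λ s → 1 + overflows [] (toList s)) ≡⟨ trans (∑-+ (seqs t) _ _) (cong (_+ ∑ (seqs t) (λ s → overflows [] (toList s))) (∑-sequences-const t 1)) ⟩
      m ^ t * 1 + ∑ (seqs t) (λ s → overflows [] (toList s)) ≤⟨ +-monoʳ-≤ (m ^ t * 1) (≤-trans (∑-overflows≤ t h′ []) h) ⟩
      m ^ t * 1 + m ^ t ≡⟨ dbl (m ^ t) ⟩
      2 * m ^ t ∎
      where
      dbl : ∀ x → x * 1 + x ≡ 2 * x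
      dbl = solve-∀

  -- The state just before the first overflow. The split fields express that logged and remaining
  -- arrivals together are a rearrangement of the input, in the forms needed later: sums for
  -- densities and lengths, products for tilted weights.
  record Stuck (log : Log) (es : List (Edge G)) : Set where
    field
      final     : Log
      remaining : List (Edge G)
      valid     : Valid final
      vertex    : Fin n
      full      : Full final k vertex
      ∑-split   : ∀ f → ∑ log (f ∘ proj₁) + ∑ es f ≡ ∑ final (f ∘ proj₁) + ∑ remaining f
      ∏-split   : ∀ y → ∏ log (y ∘ proj₁) * ∏ es y ≡ ∏ final (y ∘ proj₁) * ∏ remaining y

  mutual
    stuck : ∀ {log} → Valid log → ∀ es → overflowing log es ≢ 0 → Stuck log es
    stuck V []       ne = contradiction refl ne
    stuck {log} V (e ∷ es) ne = stuckP V (place log e) es ne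

    stuckP : ∀ {log e} → Valid log → (p : Placement log e) → ∀ es → overflowingP p es ≢ 0 → Stuck log (e ∷ es)
    stuckP {log} {e} V (overflow f) es ne = record
      { final = log ; remaining = e ∷ es ; valid = V ; vertex = target e k ; full = f ; ∑-split = λ _ → refl ; ∏-split = λ _ → refl }
    stuckP {log} {e} V (placed i lo hi lt full) es ne = record
      { final = S.final ; remaining = S.remaining ; valid = S.valid ; vertex = S.vertex ; full = S.full
      ; ∑-split = λ f → trans (swap+ (∑ log (f ∘ proj₁)) (f e) (∑ es f)) (S.∑-split f)
      ; ∏-split = λ y → trans (*-CS.x∙yz≈yx∙z (∏ log (y ∘ proj₁)) (y e) (∏ es y)) (S.∏-split y) }
      where
      module S = Stuck (stuck (valid-∷ e i V lo hi lt full) es ne)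
      swap+ : ∀ a b c → a + (b + c) ≡ b + a + c
      swap+ = solve-∀

  overflowing≤1 : ∀ log es → overflowing log es ≤ 1
  overflowing≤1 log [] = z≤n
  overflowing≤1 log (e ∷ es) with place log e
  ... | placed i _ _ _ _ = overflowing≤1 ((e , i) ∷ log) es
  ... | overflow _       = ≤-refl

-- Witness trees

Unique-resp-⊆ : {A : Set} {ys xs : List A} → ys ⊆ xs → Unique xs → Unique ys
Unique-resp-⊆ []         []       = []
Unique-resp-⊆ (x ∷ʳ τ)   (_ ∷ u)  = Unique-resp-⊆ τ u
Unique-resp-⊆ (refl ∷ τ) (x∉ ∷ u) = SublistP.All-resp-⊆ τ x∉ ∷ Unique-resp-⊆ τ u

module _ {A : Set} where

  combos : ℕ → List A → List (List A)
  combos zero    xs       = [] ∷ []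
  combos (suc l) []       = []
  combos (suc l) (x ∷ xs) = map (x ∷_) (combos l xs) ++ combos (suc l) xs

  ∈-combos : ∀ {l ys xs} → ys ⊆ xs → length ys ≡ l → ys ∈ combos l xs
  ∈-combos {zero}  {[]}     _          refl = here refl
  ∈-combos {suc l} {y ∷ ys} (x ∷ʳ τ)   eq   = ∈-++⁺ʳ (map (x ∷_) (combos l _)) (∈-combos τ eq)
  ∈-combos {suc l} {y ∷ ys} (refl ∷ τ) eq   = ∈-++⁺ˡ (∈-map⁺ (y ∷_) (∈-combos τ (suc-injective eq)))

  length-∈-combos : ∀ l xs {ys} → ys ∈ combos l xs → length ys ≡ l
  length-∈-combos zero    xs       (here refl) = refl
  length-∈-combos (suc l) (x ∷ xs) y∈ with ∈-++⁻ (map (x ∷_) (combos l xs)) y∈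
  ... | inj₂ y∈′ = length-∈-combos (suc l) xs y∈′
  ... | inj₁ y∈′ with ∈-map⁻ (x ∷_) y∈′
  ...   | zs , z∈ , refl = cong suc (length-∈-combos l xs z∈)

  ⊆⇒∈ : {ys xs : List A} → ys ⊆ xs → ∀ {y} → y ∈ ys → y ∈ xs
  ⊆⇒∈ τ = Sublist.lookup τ

  filter-partition : {P : A → Set} (P? : ∀ x → Dec (P x)) (xs : List A) → length (filter P? xs) + length (filter (¬? ∘ P?) xs) ≡ length xs
  filter-partition P? [] = refl
  filter-partition P? (x ∷ xs) with P? x
  ... | yes _ = cong suc (filter-partition P? xs)
  ... | no _  = trans (+-suc _ _) (cong suc (filter-partition P? xs))

  majority : {P : A → Set} (P? : ∀ x → Dec (P x)) (xs : List A) (a : ℕ) → a + a ≤ length xs →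
    a ≤ length (filter P? xs) ⊎ a ≤ length (filter (¬? ∘ P?) xs)
  majority P? xs a le with a ≤? length (filter P? xs)
  ... | yes p = inj₁ p
  ... | no ≰  = inj₂ (+-cancelˡ-≤ a _ _ (≤-trans le (≤-trans (≤-reflexive (sym (filter-partition P? xs))) (+-monoˡ-≤ _ (<⇒≤ (≰⇒> ≰))))))

  module _ {B : Set} (_≟ᴮ_ : (x y : B) → Dec (x ≡ y)) (key : A → B) where

    nubBy : List A → List A
    nubBy []       = []
    nubBy (x ∷ xs) = x ∷ filter (λ y → ¬? (key x ≟ᴮ key y)) (nubBy xs)

    nubBy-⊆ : ∀ xs → nubBy xs ⊆ xs
    nubBy-⊆ []       = []
    nubBy-⊆ (x ∷ xs) = refl ∷ ⊆-trans (SublistP.filter-⊆ (λ y → ¬? (key x ≟ᴮ key y)) (nubBy xs)) (nubBy-⊆ xs)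

    nubBy-unique : ∀ xs → Unique (map key (nubBy xs))
    nubBy-unique []       = []
    nubBy-unique (x ∷ xs) =
      AllP.map⁺ (AllP.all-filter (λ y → ¬? (key x ≟ᴮ key y)) (nubBy xs))
      ∷ Unique-resp-⊆ (SublistP.map⁺ key (SublistP.filter-⊆ (λ y → ¬? (key x ≟ᴮ key y)) (nubBy xs))) (nubBy-unique xs)

    nubBy-covers : ∀ {x} xs → x ∈ xs → key x ∈ map key (nubBy xs)
    nubBy-covers (x ∷ xs) (here refl) = here refl
    nubBy-covers {z} (x ∷ xs) (there z∈) with key x ≟ᴮ key z
    ... | yes eq = here (sym eq)
    ... | no ne with ∈-map⁻ key (nubBy-covers xs z∈)
    ...   | y , y∈ , eq = there (subst (_∈ map key (filter (λ y → ¬? (key x ≟ᴮ key y)) (nubBy xs))) (sym eq)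
              (∈-map⁺ key (∈-filter⁺ (λ y → ¬? (key x ≟ᴮ key y)) y∈ (λ eq′ → ne (trans eq′ (sym eq))))))

module WitnessTrees {n : ℕ} (G : Graph n) (hd : Edge G → Bool) (sc : Edge G → ℕ) (k L : ℕ) (sc≤k : ∀ e → sc e ≤ k) where

  open Layered G hd sc k L sc≤k

  incoming : ℕ → List (Fin n) → List (Edge G)
  incoming i A = filter (λ e → (sc e <? i) ×-dec (target e i ∈? A)) (allEdges G)

  below : ℕ → List (Edge G) → List (Fin n)
  below i H = map (λ e → target e i) H

  -- D is the depth and j the layer of the leaves; the root set A lies in layer D + j.
  trees : (D j : ℕ) → List (Fin n) → List (Log × List (Fin n))
  trees zero    j A = ([] , A) ∷ []
  trees (suc D) j A = concatMap (λ H → map (λ SB → map (_, suc (D + j)) H ++ proj₁ SB , proj₂ SB) (trees D j (below (D + j) H)))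
    (combos (4 * length A) (incoming (suc (D + j)) A))

  edgeNumber : ℕ → ℕ → ℕ
  edgeNumber zero    a = 0
  edgeNumber (suc D) a = 4 * a + edgeNumber D (4 * a)

  trees-size : ∀ D j A {S B} → (S , B) ∈ trees D j A → length S ≡ edgeNumber D (length A) × length B ≡ 4 ^ D * length A
  trees-size zero    j A (here refl) = refl , sym (*-identityˡ (length A))
  trees-size (suc D) j A SB∈ = sizes (combos (4 * length A) (incoming (suc (D + j)) A)) (length-∈-combos (4 * length A) (incoming (suc (D + j)) A))
    (∈-concatMap⁻ _ {xs = combos (4 * length A) (incoming (suc (D + j)) A)} SB∈)
    where
    sizes : ∀ Hs → (∀ {H} → H ∈ Hs → length H ≡ 4 * length A) → ∀ {S B} →
      Any.Any (λ H → (S , B) ∈ map (λ SB → map (_, suc (D + j)) H ++ proj₁ SB , proj₂ SB) (trees D j (below (D + j) H))) Hs →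
      length S ≡ edgeNumber (suc D) (length A) × length B ≡ 4 ^ suc D * length A
    sizes (H ∷ Hs) len (there p) = sizes Hs (λ h → len (there h)) p
    sizes (H ∷ Hs) len (here p) with ∈-map⁻ _ p
    ... | (S′ , B′) , p′ , refl with trees-size D j (below (D + j) H) p′
    ...   | lenS , lenB =
        (begin-equality
          length (map (_, suc (D + j)) H ++ S′) ≡⟨ length-++ (map (_, suc (D + j)) H) ⟩
          length (map (_, suc (D + j)) H) + length S′ ≡⟨ cong₂ _+_ (trans (length-map (_, suc (D + j)) H) (len (here refl))) (trans lenS (cong (edgeNumber D) lenH)) ⟩
          4 * length A + edgeNumber D (4 * length A) ∎)
      , (begin-equality
          length B′ ≡⟨ trans lenB (cong (4 ^ D *_) lenH) ⟩
          4 ^ D * (4 * length A) ≡⟨ trans (sym (*-assoc (4 ^ D) 4 (length A))) (cong (_* length A) (*-comm (4 ^ D) 4)) ⟩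
          4 ^ suc D * length A ∎)
      where
      lenH : length (below (D + j) H) ≡ 4 * length A
      lenH = trans (length-map (λ e → target e (D + j)) H) (len (here refl))

  fresh? : (i : ℕ) (v : Fin n) (p : Edge G × ℕ) → Dec ((proj₂ p ≡ i × target (proj₁ p) i ≡ v) × sc (proj₁ p) ≡ i)
  fresh? i v p = entry? i v p ×-dec (sc (proj₁ p) ≟ i)

  pushed? : (i : ℕ) (v : Fin n) (p : Edge G × ℕ) → Dec ((proj₂ p ≡ i × target (proj₁ p) i ≡ v) × sc (proj₁ p) < i)
  pushed? i v p = entry? i v p ×-dec (sc (proj₁ p) <? i)

  freshCount pushedCount : Log → ℕ → Fin n → ℕ
  freshCount  log i v = ∑ log (λ p → χ (fresh? i v p))
  pushedCount log i v = ∑ log (λ p → χ (pushed? i v p))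

  full⇒pushed : ∀ {log} → Valid log → ∀ {i v} → Full log i v → ¬ (L ≤ freshCount log i v) → L ≤ pushedCount log i v
  full⇒pushed {log} V {i} {v} full notFresh = +-cancelˡ-≤ L _ _ (begin
    L + L ≤⟨ full ⟩
    count log i v ≤⟨ ∑-mono∈ log pointwise ⟩
    ∑ log (λ p → χ (fresh? i v p) + χ (pushed? i v p)) ≡⟨ ∑-+ log _ _ ⟩
    freshCount log i v + pushedCount log i v ≤⟨ +-monoˡ-≤ _ (<⇒≤ (≰⇒> notFresh)) ⟩
    L + pushedCount log i v ∎)
    where
    pointwise : ∀ p → p ∈ log → χ (entry? i v p) ≤ χ (fresh? i v p) + χ (pushed? i v p)
    pointwise (e , i′) p∈ = χ≤ (entry? i v (e , i′)) (λ { (refl , eq) → byCases eq (m≤n⇒m<n∨m≡n (Valid.lower V p∈)) })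
      where
      byCases : target e i′ ≡ v → sc e < i′ ⊎ sc e ≡ i′ → 1 ≤ χ (fresh? i′ v (e , i′)) + χ (pushed? i′ v (e , i′))
      byCases eq (inj₁ lt)   = ≤-trans (1≤χ (pushed? i′ v (e , i′)) ((refl , eq) , lt)) (m≤n+m _ _)
      byCases eq (inj₂ sc≡i) = ≤-trans (1≤χ (fresh? i′ v (e , i′)) ((refl , eq) , sc≡i)) (m≤m+n _ _)

  open DecMembership (≡-dec (FP._≟_ {#E G}) _≟_) using () renaming (_∈?_ to _∈ᴸ?_) public

  -- The distinctness fields turn the sizes of the tree into numbers of log entries. By `old`, no
  -- tree entry is also a fresh entry at a leaf, so an arrival is never asked to pay twice; `layer`
  -- keeps the levels of the tree disjoint.
  record Witness (log : Log) (D j : ℕ) (A : List (Fin n)) : Set where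
    field
      edgesUsed : Log
      leaves    : List (Fin n)
      member    : (edgesUsed , leaves) ∈ trees D j A
      used      : ∀ {p} → p ∈ edgesUsed → p ∈ log
      old       : ∀ {e i} → (e , i) ∈ edgesUsed → sc e < i
      layer     : ∀ {e i} → (e , i) ∈ edgesUsed → i ≤ D + j
      distinct₁ : Unique edgesUsed
      distinct₂ : Unique leaves
      leaf      : ∀ {v} → v ∈ leaves → L ≤ freshCount log j v

  leafWitness : ∀ {log j A} → Unique A → (∀ {v} → v ∈ A → L ≤ freshCount log j v) → Witness log 0 j A
  leafWitness {A = A} u h = record
    { edgesUsed = [] ; leaves = A ; member = here refl ; used = λ () ; old = λ () ; layer = λ () ; distinct₁ = [] ; distinct₂ = u ; leaf = h }

  extendWitness : ∀ {log D j A H} → H ⊆ incoming (suc (D + j)) A → length H ≡ 4 * length A → (∀ {e} → e ∈ H → (e , suc (D + j)) ∈ log) →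
    Witness log D j (below (D + j) H) → Witness log (suc D) j A
  extendWitness {log} {D} {j} {A} {H} τ len logged W = record
    { edgesUsed = map (_, suc (D + j)) H ++ W.edgesUsed
    ; leaves    = W.leaves
    ; member    = ∈-concatMap⁺ _ (Any.map (λ { refl → ∈-map⁺ (λ SB → map (_, suc (D + j)) H ++ proj₁ SB , proj₂ SB) W.member }) (∈-combos τ len))
    ; used      = λ p∈ → either p∈ (λ e∈ → logged e∈) W.used
    ; old       = λ p∈ → either {Q = λ p → sc (proj₁ p) < proj₂ p} p∈ (λ e∈ → proj₁ (proj₂ (∈-filter⁻ inc? {xs = allEdges G} (⊆⇒∈ τ e∈)))) W.old
    ; layer     = λ p∈ → either {Q = λ p → proj₂ p ≤ suc (D + j)} p∈ (λ _ → ≤-refl) (λ q∈ → ≤-trans (W.layer q∈) (n≤1+n (D + j)))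
    ; distinct₁ = UniqueP.++⁺ (UniqueP.map⁺ (cong proj₁) (Unique-resp-⊆ (⊆-trans τ (SublistP.filter-⊆ inc? (allEdges G))) (UniqueP.allFin⁺ (#E G)))) W.distinct₁ disjoint
    ; distinct₂ = W.distinct₂
    ; leaf      = W.leaf
    }
    where
    module W = Witness W
    inc? : (e : Edge G) → Dec (sc e < suc (D + j) × target e (suc (D + j)) ∈ A)
    inc? e = (sc e <? suc (D + j)) ×-dec (target e (suc (D + j)) ∈? A)
    either : {Q : Edge G × ℕ → Set} → ∀ {p} → p ∈ map (_, suc (D + j)) H ++ W.edgesUsed →
      (∀ {e} → e ∈ H → Q (e , suc (D + j))) → (∀ {p} → p ∈ W.edgesUsed → Q p) → Q p
    either p∈ f g with ∈-++⁻ (map (_, suc (D + j)) H) p∈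
    ... | inj₂ q = g q
    ... | inj₁ q with ∈-map⁻ (_, suc (D + j)) q
    ...   | e , e∈ , refl = f e∈
    disjoint : ∀ {p} → ¬ (p ∈ map (_, suc (D + j)) H × p ∈ W.edgesUsed)
    disjoint (p , q) with ∈-map⁻ (_, suc (D + j)) p
    ... | e , e∈ , refl = 1+n≰n (W.layer q)

  module _ {log : Log} (V : Valid log) (M : ℕ) (M≥1 : 1 ≤ M) (9M≤L : 9 * M ≤ L)
    (dense : ∀ Z → ∑ log (λ p → χ (inside? G (_∈? Z) (proj₁ p))) ≤ M * length Z) where

    private
      -- Sides alternate, so the targets in consecutive layers are the two ends of the edge.
      endpoints-targets : ∀ {P : Fin n → Set} e i → P (target e (suc i)) → P (target e i) → P (head G true e) × P (head G false e)
      endpoints-targets e i p q with flip (i + sc e) (hd e)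
      ... | true  = q , p
      ... | false = p , q

      ∑-δ≤1 : {A : List (Fin n)} → Unique A → ∀ w → ∑ A (λ a → χ (w FP.≟ a)) ≤ 1
      ∑-δ≤1 {A} u w with w ∈? A
      ... | yes w∈ = ≤-reflexive (trans (∑-cong A (λ a → sym (*-identityʳ _))) (∑-δ FP._≟_ u (λ _ → 1) w∈))
      ... | no w∉  = ≤-trans (≤-reflexive (trans (∑-cong A (λ a → sym (*-identityʳ _))) (∑-δ-∉ FP._≟_ A w (λ _ → 1) w∉))) z≤n

    Step : ℕ → List (Fin n) → Set
    Step i A = Σ (List (Edge G)) (λ H → H ⊆ incoming (suc i) A × length H ≡ 4 * length A × (∀ {e} → e ∈ H → (e , suc i) ∈ log) × Unique (below i H) ×
      ((∀ {v} → v ∈ below i H → L ≤ freshCount log i v) ⊎ (∀ {v} → v ∈ below i H → L ≤ pushedCount log i v)))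

    module _ (i : ℕ) {A : List (Fin n)} (A-unique : Unique A) (busy : ∀ {a} → a ∈ A → L ≤ pushedCount log (suc i) a) where

      private
        key : Edge G → Fin n
        key e = target e i

        logged? : (e : Edge G) → Dec ((e , suc i) ∈ log)
        logged? e = (e , suc i) ∈ᴸ? log

        C₁ C₂ : List (Edge G)
        C₁ = filter logged? (incoming (suc i) A)
        -- One logged edge for each lower end, because the vertices of the next level have to be
        -- distinct.
        C₂ = nubBy FP._≟_ key C₁

        inc? : (e : Edge G) → Dec (sc e < suc i × target e (suc i) ∈ A)
        inc? e = (sc e <? suc i) ×-dec (target e (suc i) ∈? A)

        Z : List (Fin n)
        Z = A ++ map key C₂

        ∈C₁ : ∀ {e} → (e , suc i) ∈ log → sc e < suc i → target e (suc i) ∈ A → e ∈ C₁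
        ∈C₁ p lt t∈ = ∈-filter⁺ logged? (∈-filter⁺ inc? (∈-allFin _) (lt , t∈)) p

        -- The pushed entries at `A` have their upper ends in `A` and their lower ends among the
        -- keys of `C₂`, so they all lie inside `Z`; as `A` has no repetitions, no entry is counted
        -- twice.
        spread : L * length A ≤ M * length Z
        spread = begin
          L * length A ≡⟨ trans (*-comm L (length A)) (sym (∑-const A L)) ⟩
          ∑ A (λ _ → L) ≤⟨ ∑-mono∈ A (λ a a∈ → busy a∈) ⟩
          ∑ A (λ a → ∑ log (λ p → χ (pushed? (suc i) a p))) ≡⟨ ∑-swap A log _ ⟩
          ∑ log (λ p → ∑ A (λ a → χ (pushed? (suc i) a p))) ≤⟨ ∑-mono∈ log (λ p p∈ → perEntry p p∈ (inside? G (_∈? Z) (proj₁ p))) ⟩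
          ∑ log (λ p → χ (inside? G (_∈? Z) (proj₁ p))) ≤⟨ dense Z ⟩
          M * length Z ∎
          where
          perEntry : ∀ p → p ∈ log → (d : Dec (head G true (proj₁ p) ∈ Z × head G false (proj₁ p) ∈ Z)) → ∑ A (λ a → χ (pushed? (suc i) a p)) ≤ χ d
          perEntry (e , i′) p∈ (yes _) = ≤-trans (∑-mono A (λ a → χ-mono (pushed? (suc i) a (e , i′)) (target e (suc i) FP.≟ a) (λ { ((_ , eq) , _) → eq }))) (∑-δ≤1 A-unique (target e (suc i)))
          perEntry (e , i′) p∈ (no ¬in) = ≤-reflexive (trans (∑-cong∈ A (λ a a∈ → χ-no (pushed? (suc i) a (e , i′)) (λ { ((refl , refl) , lt) →
            ¬in (endpoints-targets {P = _∈ Z} e i (∈-++⁺ˡ a∈) (∈-++⁺ʳ A (nubBy-covers FP._≟_ key C₁ (∈C₁ p∈ lt a∈)))) }))) (∑-zero A))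

        -- Of the `9 * M` per vertex guaranteed by `L`, the vertices of `A` absorb one `M` in the
        -- density bound. What remains forces eight lower ends per vertex, and a majority of one
        -- kind still has four.
        many : 4 * length A + 4 * length A ≤ length C₂
        many = *-cancelˡ-≤ M {{>-nonZero M≥1}} (+-cancelˡ-≤ (M * length A) _ _ (begin
          M * length A + M * (4 * length A + 4 * length A) ≡⟨ e M (length A) ⟩
          9 * M * length A ≤⟨ *-monoˡ-≤ (length A) 9M≤L ⟩
          L * length A ≤⟨ spread ⟩
          M * length Z ≡⟨ cong (M *_) (trans (length-++ A) (cong (length A +_) (length-map key C₂))) ⟩
          M * (length A + length C₂) ≡⟨ *-distribˡ-+ M (length A) (length C₂) ⟩
          M * length A + M * length C₂ ∎))
          where
          e : ∀ M a → M * a + M * (4 * a + 4 * a) ≡ 9 * M * a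
          e = solve-∀

        isFresh? : (e : Edge G) → Dec (L ≤ freshCount log i (key e))
        isFresh? e = L ≤? freshCount log i (key e)

        C₂⊆ : C₂ ⊆ incoming (suc i) A
        C₂⊆ = ⊆-trans (nubBy-⊆ FP._≟_ key C₁) (SublistP.filter-⊆ logged? (incoming (suc i) A))

        C₂-logged : ∀ {e} → e ∈ C₂ → (e , suc i) ∈ log × sc e ≤ i
        C₂-logged e∈ with ∈-filter⁻ logged? {xs = incoming (suc i) A} (⊆⇒∈ (nubBy-⊆ FP._≟_ key C₁) e∈)
        ... | e∈inc , p = p , s≤s⁻¹ (proj₁ (proj₂ (∈-filter⁻ inc? {xs = allEdges G} e∈inc)))

        module Choice {P : Edge G → Set} (P? : ∀ e → Dec (P e)) (enough : 4 * length A ≤ length (filter P? C₂)) where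

          H : List (Edge G)
          H = take (4 * length A) (filter P? C₂)

          H⊆filter : H ⊆ filter P? C₂
          H⊆filter = SublistP.take-⊆ (4 * length A) (filter P? C₂)

          H⊆C₂ : H ⊆ C₂
          H⊆C₂ = ⊆-trans H⊆filter (SublistP.filter-⊆ P? C₂)

          H⊆incoming : H ⊆ incoming (suc i) A
          H⊆incoming = ⊆-trans H⊆C₂ C₂⊆

          length-H : length H ≡ 4 * length A
          length-H = trans (length-take (4 * length A) (filter P? C₂)) (m≤n⇒m⊓n≡m enough)

          H-logged : ∀ {e} → e ∈ H → (e , suc i) ∈ log
          H-logged e∈ = proj₁ (C₂-logged (⊆⇒∈ H⊆C₂ e∈))

          below-unique : Unique (below i H)
          below-unique = Unique-resp-⊆ (SublistP.map⁺ key H⊆C₂) (nubBy-unique FP._≟_ key C₁)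

          H-full : ∀ {e} → e ∈ H → Full log i (key e)
          H-full e∈ = Valid.chain V (H-logged e∈) (proj₂ (C₂-logged (⊆⇒∈ H⊆C₂ e∈)))

          H-P : ∀ {e} → e ∈ H → P e
          H-P e∈ = proj₂ (∈-filter⁻ P? {xs = C₂} (⊆⇒∈ H⊆filter e∈))

        pick : 4 * length A ≤ length (filter isFresh? C₂) ⊎ 4 * length A ≤ length (filter (¬? ∘ isFresh?) C₂) → Step i A
        pick (inj₁ enough) = H , H⊆incoming , length-H , H-logged , below-unique , inj₁ (λ v∈ → fresh (∈-map⁻ key v∈))
          where
          open Choice isFresh? enough
          fresh : ∀ {v} → ∃[ e ] (e ∈ H × v ≡ key e) → L ≤ freshCount log i v
          fresh (e , e∈ , refl) = H-P e∈
        pick (inj₂ enough) = H , H⊆incoming , length-H , H-logged , below-unique , inj₂ (λ v∈ → pushed (∈-map⁻ key v∈))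
          where
          open Choice (¬? ∘ isFresh?) enough
          pushed : ∀ {v} → ∃[ e ] (e ∈ H × v ≡ key e) → L ≤ pushedCount log i v
          pushed (e , e∈ , refl) = full⇒pushed V (H-full e∈) (H-P e∈)

      step : Step i A
      step = pick (majority isFresh? C₂ (4 * length A) many)

    AnyWitness : ℕ → List (Fin n) → Set
    AnyWitness i A = ∃[ D ] ∃[ j ] (D + j ≡ i × Witness log D j A)

    extendStep : ∀ {i A} → Step i A → 1 ≤ length A →
      (∀ {B} → 1 ≤ length B → Unique B → (∀ {b} → b ∈ B → L ≤ pushedCount log i b) → AnyWitness i B) → AnyWitness (suc i) A
    extendStep {i} (H , τ , len , logged , u , inj₁ fresh) ne rec = 1 , i , refl , extendWitness τ len logged (leafWitness u fresh)
    extendStep {i} {A} (H , τ , len , logged , u , inj₂ pushed) ne rec =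
      attach (rec (≤-trans ne (≤-trans (m≤n*m (length A) 4) (≤-reflexive (sym (trans (length-map (λ e → target e i) H) len))))) u pushed) τ logged
      where
      attach : ∀ {i} → AnyWitness i (below i H) → H ⊆ incoming (suc i) A → (∀ {e} → e ∈ H → (e , suc i) ∈ log) → AnyWitness (suc i) A
      attach (D , j , refl , W) τ logged = suc D , j , refl , extendWitness τ len logged W

    -- The choice between fresh and pushed is made for a whole level at once, so all leaves lie in
    -- the same layer and the union bound only has to range over the depth.
    pushedWitness : ∀ i {A} → 1 ≤ length A → Unique A → (∀ {a} → a ∈ A → L ≤ pushedCount log i a) → AnyWitness i A
    -- Nothing is pushed into layer 0 and `L` is positive, so the descent ends in fresh vertices at
    -- the latest there.
    pushedWitness zero {a ∷ A} _ u busy = contradiction (≤-trans (≤-trans (≤-trans M≥1 (m≤n*m M 9)) 9M≤L) (≤-trans (busy (here refl)) (≤-reflexive none))) (λ ())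
      where
      none : pushedCount log 0 a ≡ 0
      none = trans (∑-cong log (λ p → χ-no (pushed? 0 a p) (λ ()))) (∑-zero log)
    pushedWitness (suc i) {A} ne u busy = extendStep (step i u busy) ne (pushedWitness i)

    fullWitness : ∀ {i v} → Full log i v → AnyWitness i (v ∷ [])
    fullWitness {i} {v} full with L ≤? freshCount log i v
    ... | yes fresh = 0 , i , refl , leafWitness ([] ∷ []) (λ { (here refl) → fresh })
    ... | no ¬fresh = pushedWitness i ≤-refl ([] ∷ []) (λ { (here refl) → full⇒pushed V full ¬fresh })

-- Counting witness trees

module _ (x : ℕ) where

  private
    -- Bernoulli's inequality `(1 - 1/(x+1))^h ≥ 1 - h/(x+1)` without denominators, where `y` is
    -- `x + 1 - h`.
    bernoulli : ∀ h y → y + h ≡ suc x → suc x ^ h * y ≤ x ^ h * suc x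
    bernoulli zero    y eq = ≤-reflexive (cong (1 *_) (trans (sym (+-identityʳ y)) eq))
    bernoulli (suc h) y eq = begin
      suc x * suc x ^ h * y ≡⟨ *-CS.xy∙z≈y∙xz (suc x) (suc x ^ h) y ⟩
      suc x ^ h * (suc x * y) ≤⟨ *-monoʳ-≤ (suc x ^ h) (≤-trans (+-monoˡ-≤ (x * y) y≤x) (≤-reflexive (sym (*-suc x y)))) ⟩
      suc x ^ h * (x * suc y) ≡⟨ *-CS.x∙yz≈y∙xz (suc x ^ h) x (suc y) ⟩
      x * (suc x ^ h * suc y) ≤⟨ *-monoʳ-≤ x (bernoulli h (suc y) (trans (sym (+-suc y h)) eq)) ⟩
      x * (x ^ h * suc x) ≡⟨ *-assoc x (x ^ h) (suc x) ⟨
      x * x ^ h * suc x ∎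
      where
      y≤x : y ≤ x
      y≤x = ≤-trans (m≤m+n y h) (≤-reflexive (suc-injective (trans (sym (+-suc y h)) eq)))

    half-power : ∀ h y → y + h ≡ suc x → h ≤ y → suc x ^ h ≤ 2 * x ^ h
    half-power h y eq h≤y = *-cancelʳ-≤ (suc x ^ h) (2 * x ^ h) (suc x) (begin
      suc x ^ h * suc x ≡⟨ cong (suc x ^ h *_) eq ⟨
      suc x ^ h * (y + h) ≤⟨ *-monoʳ-≤ (suc x ^ h) (≤-trans (+-monoʳ-≤ y h≤y) (≤-reflexive (cong (y +_) (sym (+-identityʳ y))))) ⟩
      suc x ^ h * (2 * y) ≡⟨ *-CS.x∙yz≈y∙xz (suc x ^ h) 2 y ⟩
      2 * (suc x ^ h * y) ≤⟨ *-monoʳ-≤ 2 (bernoulli h y eq) ⟩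
      2 * (x ^ h * suc x) ≡⟨ *-assoc 2 (x ^ h) (suc x) ⟨
      2 * x ^ h * suc x ∎)

  -- The number 4 replaces `e` as a bound for `(1 + 1/x)^x`: by Bernoulli, each half of the exponent
  -- contributes a factor of at most 2.
  [1+x]^x≤4x^x : suc x ^ x ≤ 4 * x ^ x
  [1+x]^x≤4x^x = begin
    suc x ^ x ≡⟨ cong (suc x ^_) halves ⟨
    suc x ^ (⌊ x /2⌋ + ⌈ x /2⌉) ≡⟨ ^-distribˡ-+-* (suc x) ⌊ x /2⌋ ⌈ x /2⌉ ⟩
    suc x ^ ⌊ x /2⌋ * suc x ^ ⌈ x /2⌉ ≤⟨ *-mono-≤ (half-power ⌊ x /2⌋ (suc ⌈ x /2⌉) (cong suc (trans (+-comm ⌈ x /2⌉ ⌊ x /2⌋) halves)) (≤-trans (⌊n/2⌋≤⌈n/2⌉ x) (n≤1+n _)))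
                                                            (half-power ⌈ x /2⌉ (suc ⌊ x /2⌋) (cong suc halves) (⌊n/2⌋-mono (n≤1+n (suc x)))) ⟩
    2 * x ^ ⌊ x /2⌋ * (2 * x ^ ⌈ x /2⌉) ≡⟨ e (x ^ ⌊ x /2⌋) (x ^ ⌈ x /2⌉) ⟩
    4 * (x ^ ⌊ x /2⌋ * x ^ ⌈ x /2⌉) ≡⟨ cong (4 *_) (trans (sym (^-distribˡ-+-* x ⌊ x /2⌋ ⌈ x /2⌉)) (cong (x ^_) halves)) ⟩
    4 * x ^ x ∎
    where
    halves : ⌊ x /2⌋ + ⌈ x /2⌉ ≡ x
    halves = ⌊n/2⌋+⌈n/2⌉≡n x
    e : ∀ a b → 2 * a * (2 * b) ≡ 4 * (a * b)
    e = solve-∀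

  [1+x]^xa≤4^a*x^xa : ∀ a → suc x ^ (x * a) ≤ 4 ^ a * x ^ (x * a)
  [1+x]^xa≤4^a*x^xa a = begin
    suc x ^ (x * a) ≡⟨ ^-*-assoc (suc x) x a ⟨
    (suc x ^ x) ^ a ≤⟨ ^-monoˡ-≤ a [1+x]^x≤4x^x ⟩
    (4 * x ^ x) ^ a ≡⟨ ^-distribʳ-* a 4 (x ^ x) ⟩
    4 ^ a * (x ^ x) ^ a ≡⟨ cong (4 ^ a *_) (^-*-assoc x x a) ⟩
    4 ^ a * x ^ (x * a) ∎

-- Raise `1 + N/t ≤ (1 + 1/t)^N` to the power `t` and use `(1 + 1/t)^t ≤ 4`. This is the price of
-- tilting the measure by a total mass of `N`.
[t+N]^t≤t^t*4^N : ∀ t .{{_ : NonZero t}} N → (t + N) ^ t ≤ t ^ t * 4 ^ N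
[t+N]^t≤t^t*4^N t N = *-cancelʳ-≤ _ _ (t ^ (t * N)) {{m^n≢0 t (t * N)}} (begin
  (t + N) ^ t * t ^ (t * N) ≡⟨ cong (λ z → (t + N) ^ t * t ^ z) (*-comm t N) ⟩
  (t + N) ^ t * t ^ (N * t) ≡⟨ cong ((t + N) ^ t *_) (^-*-assoc t N t) ⟨
  (t + N) ^ t * (t ^ N) ^ t ≡⟨ ^-distribʳ-* t (t + N) (t ^ N) ⟨
  ((t + N) * t ^ N) ^ t ≤⟨ ^-monoˡ-≤ t (linear N) ⟩
  (t * suc t ^ N) ^ t ≡⟨ ^-distribʳ-* t t (suc t ^ N) ⟩
  t ^ t * (suc t ^ N) ^ t ≡⟨ cong (t ^ t *_) (trans (^-*-assoc (suc t) N t) (cong (suc t ^_) (*-comm N t))) ⟩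
  t ^ t * suc t ^ (t * N) ≤⟨ *-monoʳ-≤ (t ^ t) ([1+x]^xa≤4^a*x^xa t N) ⟩
  t ^ t * (4 ^ N * t ^ (t * N)) ≡⟨ *-assoc (t ^ t) (4 ^ N) _ ⟨
  t ^ t * 4 ^ N * t ^ (t * N) ∎)
  where
  linear : ∀ N → (t + N) * t ^ N ≤ t * suc t ^ N
  linear zero    = ≤-reflexive (cong (_* 1) (+-identityʳ t))
  linear (suc N) = begin
    (t + suc N) * (t * t ^ N) ≡⟨ e₁ t N (t ^ N) ⟩
    (t * t + t * N + t) * t ^ N ≤⟨ *-monoˡ-≤ (t ^ N) (m≤m+n (t * t + t * N + t) N) ⟩
    (t * t + t * N + t + N) * t ^ N ≡⟨ e₂ t N (t ^ N) ⟩
    suc t * ((t + N) * t ^ N) ≤⟨ *-monoʳ-≤ (suc t) (linear N) ⟩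
    suc t * (t * suc t ^ N) ≡⟨ *-CS.x∙yz≈y∙xz (suc t) t (suc t ^ N) ⟩
    t * (suc t * suc t ^ N) ∎
    where
    e₁ : ∀ t N x → (t + suc N) * (t * x) ≡ (t * t + t * N + t) * x
    e₁ = solve-∀
    e₂ : ∀ t N x → (t * t + t * N + t + N) * x ≡ suc t * ((t + N) * x)
    e₂ = solve-∀

-- A single term of the binomial expansion of `(x + 1)^N`, multiplied by `x^l`.
length-combos*x^N≤ : {A : Set} (x l : ℕ) (xs : List A) → length (combos l xs) * x ^ length xs ≤ suc x ^ length xs * x ^ l
length-combos*x^N≤ x zero    xs       = ≤-trans (≤-reflexive (*-identityˡ (x ^ length xs))) (≤-trans (^-monoˡ-≤ (length xs) (n≤1+n x)) (≤-reflexive (sym (*-identityʳ _))))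
length-combos*x^N≤ x (suc l) []       = z≤n
length-combos*x^N≤ x (suc l) (z ∷ xs) = begin
  length (map (z ∷_) (combos l xs) ++ combos (suc l) xs) * (x * x ^ N) ≡⟨ cong (_* (x * x ^ N)) (trans (length-++ (map (z ∷_) (combos l xs))) (cong (_+ c₂) (length-map (z ∷_) (combos l xs)))) ⟩
  (c₁ + c₂) * (x * x ^ N) ≡⟨ e₁ c₁ c₂ x (x ^ N) ⟩
  x * (c₁ * x ^ N + c₂ * x ^ N) ≤⟨ *-monoʳ-≤ x (+-mono-≤ (length-combos*x^N≤ x l xs) (length-combos*x^N≤ x (suc l) xs)) ⟩
  x * (suc x ^ N * x ^ l + suc x ^ N * (x * x ^ l)) ≡⟨ e₂ x (suc x ^ N) (x ^ l) ⟩
  suc x * suc x ^ N * (x * x ^ l) ∎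
  where
  N c₁ c₂ : ℕ
  N  = length xs
  c₁ = length (combos l xs)
  c₂ = length (combos (suc l) xs)
  e₁ : ∀ a b x y → (a + b) * (x * y) ≡ x * (a * y + b * y)
  e₁ = solve-∀
  e₂ : ∀ x y z → x * (y * z + y * (x * z)) ≡ suc x * y * (x * z)
  e₂ = solve-∀

-- Since `(1 + 1/x)^(x * a) ≤ 4^a`, each of the `l` choices costs a factor `x` instead of `x * a`.
-- Without this gain the cost of a level would grow with its width.
length-combos≤ : {A : Set} (x l a : ℕ) (xs : List A) → length xs ≤ x * a → length (combos l xs) ≤ 4 ^ a * x ^ l
length-combos≤ zero    zero    a xs le = ≤-trans (m^n>0 4 a) (≤-reflexive (sym (*-identityʳ (4 ^ a))))
length-combos≤ zero    (suc l) a []  le = z≤n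
length-combos≤ x@(suc _) l a xs le = *-cancelʳ-≤ _ _ (x ^ (x * a)) {{m^n≢0 x (x * a)}} (begin
  length (combos l xs) * x ^ (x * a) ≡⟨ cong (λ z → length (combos l xs) * x ^ z) (m+[n∸m]≡n le) ⟨
  length (combos l xs) * x ^ (length xs + r) ≡⟨ cong (length (combos l xs) *_) (^-distribˡ-+-* x (length xs) r) ⟩
  length (combos l xs) * (x ^ length xs * x ^ r) ≡⟨ *-assoc (length (combos l xs)) _ _ ⟨
  length (combos l xs) * x ^ length xs * x ^ r ≤⟨ *-mono-≤ (length-combos*x^N≤ x l xs) (^-monoˡ-≤ r (n≤1+n x)) ⟩
  suc x ^ length xs * x ^ l * suc x ^ r ≡⟨ *-CS.xy∙z≈xz∙y (suc x ^ length xs) (x ^ l) (suc x ^ r) ⟩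
  suc x ^ length xs * suc x ^ r * x ^ l ≡⟨ cong (_* x ^ l) (trans (sym (^-distribˡ-+-* (suc x) (length xs) r)) (cong (suc x ^_) (m+[n∸m]≡n le))) ⟩
  suc x ^ (x * a) * x ^ l ≤⟨ *-monoˡ-≤ (x ^ l) ([1+x]^xa≤4^a*x^xa x a) ⟩
  4 ^ a * x ^ (x * a) * x ^ l ≡⟨ *-CS.xy∙z≈xz∙y (4 ^ a) (x ^ (x * a)) (x ^ l) ⟩
  4 ^ a * x ^ l * x ^ (x * a) ∎)
  where
  r : ℕ
  r = x * a ∸ length xs

treeBound : (ℕ → ℕ) → (D j a : ℕ) → ℕ
treeBound P zero    j a = 1
treeBound P (suc D) j a = 4 ^ a * P (suc (D + j)) ^ (4 * a) * treeBound P D j (4 * a)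

module TreeCount {n : ℕ} (G : Graph n) (hd : Edge G → Bool) (sc : Edge G → ℕ) (k L : ℕ) (sc≤k : ∀ e → sc e ≤ k)
  (t : ℕ) (Δ P : ℕ → ℕ)
  (degree : ∀ i v → ∑ (allEdges G) (λ e → χ ((sc e <? i) ×-dec (head G (Layered.side G hd sc k L sc≤k e i) e FP.≟ v))) ≤ Δ i)
  (rate : ∀ i → 4 * t * Δ i ≤ P i * #E G) where

  open Layered G hd sc k L sc≤k
  open WitnessTrees G hd sc k L sc≤k

  private
    m : ℕ
    m = #E G

  length-incoming : ∀ i A → length (incoming i A) ≤ Δ i * length A
  length-incoming i A = begin
    length (incoming i A) ≡⟨ length-filter (λ e → (sc e <? i) ×-dec (target e i ∈? A)) (allEdges G) ⟩
    ∑ (allEdges G) (λ e → χ ((sc e <? i) ×-dec (target e i ∈? A))) ≤⟨ ∑-mono (allEdges G) pointwise ⟩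
    ∑ (allEdges G) (λ e → ∑ A (λ a → χ ((sc e <? i) ×-dec (target e i FP.≟ a)))) ≡⟨ ∑-swap (allEdges G) A _ ⟩
    ∑ A (λ a → ∑ (allEdges G) (λ e → χ ((sc e <? i) ×-dec (target e i FP.≟ a)))) ≤⟨ ∑-mono A (degree i) ⟩
    ∑ A (λ _ → Δ i) ≡⟨ trans (∑-const A (Δ i)) (*-comm (length A) (Δ i)) ⟩
    Δ i * length A ∎
    where
    pointwise : ∀ e → χ ((sc e <? i) ×-dec (target e i ∈? A)) ≤ ∑ A (λ a → χ ((sc e <? i) ×-dec (target e i FP.≟ a)))
    pointwise e = χ≤ ((sc e <? i) ×-dec (target e i ∈? A)) (λ { (lt , t∈) →
      ≤-trans (1≤χ ((sc e <? i) ×-dec (target e i FP.≟ target e i)) (lt , refl)) (∈⇒≤∑ (λ a → χ ((sc e <? i) ×-dec (target e i FP.≟ a))) t∈) })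

  -- Each tree edge is weighted by `4t/m`: `t/m` is the mean number of arrivals of a given edge, and
  -- the 4 prepays the factor that each tree edge costs in `[t+N]^t≤t^t*4^N`.
  length-trees : ∀ D j A → length (trees D j A) * (4 * t) ^ edgeNumber D (length A) ≤ treeBound P D j (length A) * m ^ edgeNumber D (length A)
  length-trees zero    j A = ≤-refl
  length-trees (suc D) j A = begin
    length (trees (suc D) j A) * (4 * t) ^ (4 * a + h)
      ≡⟨ cong₂ _*_ (trans (length≡∑ (trees (suc D) j A)) (trans (∑-concatMap _ Hs (λ _ → 1)) (∑-cong Hs (λ H → trans (sym (length≡∑ (map (graft H) (trees D j (below (D + j) H))))) (length-map (graft H) (trees D j (below (D + j) H)))))))
                  (trans (^-distribˡ-+-* (4 * t) (4 * a) h) (*-comm ((4 * t) ^ (4 * a)) ((4 * t) ^ h))) ⟩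
    ∑ Hs (λ H → length (trees D j (below (D + j) H))) * ((4 * t) ^ h * (4 * t) ^ (4 * a))
      ≡⟨ *-assoc (∑ Hs (λ H → length (trees D j (below (D + j) H)))) _ _ ⟨
    ∑ Hs (λ H → length (trees D j (below (D + j) H))) * (4 * t) ^ h * (4 * t) ^ (4 * a)
      ≡⟨ cong (_* (4 * t) ^ (4 * a)) (∑-*ʳ Hs ((4 * t) ^ h) _) ⟨
    ∑ Hs (λ H → length (trees D j (below (D + j) H)) * (4 * t) ^ h) * (4 * t) ^ (4 * a)
      ≤⟨ *-monoˡ-≤ ((4 * t) ^ (4 * a)) (∑-mono∈ Hs (λ H H∈ → subst (λ z → length (trees D j (below (D + j) H)) * (4 * t) ^ edgeNumber D z ≤ treeBound P D j z * m ^ edgeNumber D z)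
            (trans (length-map (λ e → target e (D + j)) H) (length-∈-combos (4 * a) (incoming (suc (D + j)) A) H∈)) (length-trees D j (below (D + j) H)))) ⟩
    ∑ Hs (λ _ → Q * m ^ h) * (4 * t) ^ (4 * a)
      ≡⟨ cong (_* (4 * t) ^ (4 * a)) (∑-const Hs (Q * m ^ h)) ⟩
    length Hs * (Q * m ^ h) * (4 * t) ^ (4 * a)
      ≤⟨ *-monoˡ-≤ ((4 * t) ^ (4 * a)) (*-monoˡ-≤ (Q * m ^ h) (length-combos≤ (Δ i) (4 * a) a (incoming i A) (length-incoming i A))) ⟩
    4 ^ a * Δ i ^ (4 * a) * (Q * m ^ h) * (4 * t) ^ (4 * a)
      ≡⟨ e₁ (4 ^ a) (Δ i ^ (4 * a)) Q (m ^ h) ((4 * t) ^ (4 * a)) ⟩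
    4 ^ a * ((4 * t) ^ (4 * a) * Δ i ^ (4 * a)) * Q * m ^ h
      ≡⟨ cong (λ z → 4 ^ a * z * Q * m ^ h) (^-distribʳ-* (4 * a) (4 * t) (Δ i)) ⟨
    4 ^ a * (4 * t * Δ i) ^ (4 * a) * Q * m ^ h
      ≤⟨ *-monoˡ-≤ (m ^ h) (*-monoˡ-≤ Q (*-monoʳ-≤ (4 ^ a) (^-monoˡ-≤ (4 * a) (rate i)))) ⟩
    4 ^ a * (P i * m) ^ (4 * a) * Q * m ^ h
      ≡⟨ cong (λ z → 4 ^ a * z * Q * m ^ h) (^-distribʳ-* (4 * a) (P i) m) ⟩
    4 ^ a * (P i ^ (4 * a) * m ^ (4 * a)) * Q * m ^ h
      ≡⟨ e₂ (4 ^ a) (P i ^ (4 * a)) (m ^ (4 * a)) Q (m ^ h) ⟩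
    4 ^ a * P i ^ (4 * a) * Q * (m ^ (4 * a) * m ^ h)
      ≡⟨ cong (4 ^ a * P i ^ (4 * a) * Q *_) (^-distribˡ-+-* m (4 * a) h) ⟨
    4 ^ a * P i ^ (4 * a) * Q * m ^ (4 * a + h) ∎
    where
    a h i Q : ℕ
    a = length A
    h = edgeNumber D (4 * a)
    i = suc (D + j)
    Q = treeBound P D j (4 * a)
    Hs : List (List (Edge G))
    Hs = combos (4 * a) (incoming i A)
    graft : List (Edge G) → Log × List (Fin n) → Log × List (Fin n)
    graft H SB = map (_, i) H ++ proj₁ SB , proj₂ SB
    e₁ : ∀ x d q y z → x * d * (q * y) * z ≡ x * (z * d) * q * y
    e₁ = solve-∀
    e₂ : ∀ x p y q z → x * (p * y) * q * z ≡ x * p * q * (y * z)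
    e₂ = solve-∀

-- The union bound over witness trees

unique⊆⇒length≤ : {A : Set} (_≟ᴬ_ : (x y : A) → Dec (x ≡ y)) (∈? : ∀ x (xs : List A) → Dec (x ∈ xs)) {S xs : List A} →
  Unique S → (∀ {x} → x ∈ S → x ∈ xs) → length S ≤ ∑ xs (λ x → χ (∈? x S))
unique⊆⇒length≤ _≟ᴬ_ ∈? {S} {xs} u S⊆xs = begin
  length S ≡⟨ length≡∑ S ⟩
  ∑ S (λ _ → 1) ≤⟨ ∑-mono∈ S (λ q q∈ → ≤-trans (1≤χ (q ≟ᴬ q) refl) (∈⇒≤∑ (λ p → χ (p ≟ᴬ q)) (S⊆xs q∈))) ⟩
  ∑ S (λ q → ∑ xs (λ p → χ (p ≟ᴬ q))) ≡⟨ ∑-swap S xs _ ⟩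
  ∑ xs (λ p → ∑ S (λ q → χ (p ≟ᴬ q))) ≤⟨ ∑-mono xs (λ p → atMost p (∈? p S)) ⟩
  ∑ xs (λ p → χ (∈? p S)) ∎
  where
  atMost : ∀ p (d : Dec (p ∈ S)) → ∑ S (λ q → χ (p ≟ᴬ q)) ≤ χ d
  atMost p (yes p∈) = ≤-reflexive (trans (∑-cong S (λ q → sym (*-identityʳ _))) (∑-δ _≟ᴬ_ u (λ _ → 1) p∈))
  atMost p (no p∉)  = ≤-reflexive (trans (∑-cong S (λ q → sym (*-identityʳ _))) (∑-δ-∉ _≟ᴬ_ S p (λ _ → 1) p∉))

∏-mono∈ : {A : Set} (xs : List A) {f g : A → ℕ} → (∀ x → x ∈ xs → f x ≤ g x) → ∏ xs f ≤ ∏ xs g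
∏-mono∈ []       h = ≤-refl
∏-mono∈ (x ∷ xs) h = *-mono-≤ (h x (here refl)) (∏-mono∈ xs (λ y y∈ → h y (there y∈)))

∏-const : {A : Set} (xs : List A) (c : ℕ) → ∏ xs (λ _ → c) ≡ c ^ length xs
∏-const []       c = refl
∏-const (x ∷ xs) c = cong (c *_) (∏-const xs c)

∏-* : {A : Set} (xs : List A) (f g : A → ℕ) → ∏ xs (λ x → f x * g x) ≡ ∏ xs f * ∏ xs g
∏-* []       f g = refl
∏-* (x ∷ xs) f g = trans (cong (f x * g x *_) (∏-* xs f g)) (*-CS.interchange (f x) (g x) (∏ xs f) (∏ xs g))

∏-^ : {A : Set} (xs : List A) (c : ℕ) (f : A → ℕ) → ∏ xs (λ x → c ^ f x) ≡ c ^ ∑ xs f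
∏-^ []       c f = refl
∏-^ (x ∷ xs) c f = trans (cong (c ^ f x *_) (∏-^ xs c f)) (sym (^-distribˡ-+-* c (f x) (∑ xs f)))

module Union {n : ℕ} (G : Graph n) (hd : Edge G → Bool) (sc : Edge G → ℕ) (k L : ℕ) (sc≤k : ∀ e → sc e ≤ k)
  (t : ℕ) (t≥1 : 1 ≤ t) (Δ P : ℕ → ℕ)
  (degree : ∀ i v → ∑ (allEdges G) (λ e → χ ((sc e <? i) ×-dec (head G (Layered.side G hd sc k L sc≤k e i) e FP.≟ v))) ≤ Δ i)
  (rate : ∀ i → 4 * t * Δ i ≤ P i * #E G)
  (d Y : ℕ → ℕ) (Y≥1 : ∀ j → 1 ≤ Y j)
  (inDegree : ∀ j b → ∑ (allEdges G) (λ e → χ ((hv G hd e FP.≟ b) ×-dec (sc e ≟ j))) ≤ d j)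
  (leafRate : ∀ j → t * (Y j * d j) ≤ L * #E G) where

  open Layered G hd sc k L sc≤k
  open WitnessTrees G hd sc k L sc≤k
  open TreeCount G hd sc k L sc≤k t Δ P degree rate

  private
    m : ℕ
    m = #E G
    xs : List (Edge G)
    xs = allEdges G
    seqs : List (Vec (Edge G) t)
    seqs = sequences G t
    vs : List (Fin n)
    vs = allFin n

  leafEdge? : (j : ℕ) (B : List (Fin n)) (e : Edge G) → Dec (hv G hd e ∈ B × sc e ≡ j)
  leafEdge? j B e = (hv G hd e ∈? B) ×-dec (sc e ≟ j)

  -- The tilted edge weights: t times the density of a distribution under which every tree edge
  -- arrives about once and every leaf receives about L arrivals of its own scale.
  weight : Log → List (Fin n) → ℕ → Edge G → ℕ
  weight S B j e = t + (m * ∑ S (λ p → χ (proj₁ p FP.≟ e)) + t * Y j * χ (leafEdge? j B e))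

  -- The untilted total is `m * t`. Every tree edge adds `m`, and by `leafRate` every leaf adds at
  -- most `L * m`, so the added mass depends only on the size of the tree.
  ∑-weight : ∀ S B j → ∑ xs (weight S B j) ≤ m * (t + (length S + L * length B))
  ∑-weight S B j = begin
    ∑ xs (weight S B j)
      ≡⟨ trans (∑-+ xs _ _) (cong₂ _+_ (trans (∑-const xs t) (cong (_* t) (length-allFin m))) (trans (∑-+ xs _ _) (cong₂ _+_ (∑-*ˡ xs m _) (∑-*ˡ xs (t * Y j) _)))) ⟩
    m * t + (m * ∑ xs (λ e → ∑ S (λ p → χ (proj₁ p FP.≟ e))) + t * Y j * ∑ xs (λ e → χ (leafEdge? j B e)))
      ≤⟨ +-monoʳ-≤ (m * t) (+-mono-≤ (≤-reflexive (cong (m *_) treeEdges)) leafEdges) ⟩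
    m * t + (m * length S + L * m * length B)
      ≡⟨ e₁ m t (length S) L (length B) ⟩
    m * (t + (length S + L * length B)) ∎
    where
    e₁ : ∀ m t s l b → m * t + (m * s + l * m * b) ≡ m * (t + (s + l * b))
    e₁ = solve-∀
    treeEdges : ∑ xs (λ e → ∑ S (λ p → χ (proj₁ p FP.≟ e))) ≡ length S
    treeEdges = trans (∑-swap xs S _) (trans (∑-cong S (λ p → trans (∑-cong xs (λ e → sym (*-identityʳ _))) (∑-δ-allFin (proj₁ p) (λ _ → 1)))) (sym (length≡∑ S)))
    leafEdges : t * Y j * ∑ xs (λ e → χ (leafEdge? j B e)) ≤ L * m * length B
    leafEdges = begin
      t * Y j * ∑ xs (λ e → χ (leafEdge? j B e)) ≤⟨ *-monoʳ-≤ (t * Y j) (∑-mono xs pointwise) ⟩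
      t * Y j * ∑ xs (λ e → ∑ B (λ b → χ ((hv G hd e FP.≟ b) ×-dec (sc e ≟ j)))) ≡⟨ cong (t * Y j *_) (∑-swap xs B _) ⟩
      t * Y j * ∑ B (λ b → ∑ xs (λ e → χ ((hv G hd e FP.≟ b) ×-dec (sc e ≟ j)))) ≤⟨ *-monoʳ-≤ (t * Y j) (∑-mono B (inDegree j)) ⟩
      t * Y j * ∑ B (λ _ → d j) ≡⟨ cong (t * Y j *_) (∑-const B (d j)) ⟩
      t * Y j * (length B * d j) ≡⟨ e₂ t (Y j) (length B) (d j) ⟩
      t * (Y j * d j) * length B ≤⟨ *-monoˡ-≤ (length B) (leafRate j) ⟩
      L * m * length B ∎
      where
      e₂ : ∀ t y b d → t * y * (b * d) ≡ t * (y * d) * b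
      e₂ = solve-∀
      pointwise : ∀ e → χ (leafEdge? j B e) ≤ ∑ B (λ b → χ ((hv G hd e FP.≟ b) ×-dec (sc e ≟ j)))
      pointwise e = χ≤ (leafEdge? j B e) (λ { (h∈ , eq) → ≤-trans (1≤χ ((hv G hd e FP.≟ hv G hd e) ×-dec (sc e ≟ j)) (refl , eq))
        (∈⇒≤∑ (λ b → χ ((hv G hd e FP.≟ b) ×-dec (sc e ≟ j))) h∈) })

  module _ {log : Log} {D j : ℕ} {A : List (Fin n)} (W : Witness log D j A) where

    private
      module W = Witness W
      S : Log
      S = W.edgesUsed
      B : List (Fin n)
      B = W.leaves

      α? : (p : Edge G × ℕ) → Dec (p ∈ S)
      α? p = p ∈ᴸ? S

      β? : (p : Edge G × ℕ) → Dec (proj₂ p ≡ j × (hv G hd (proj₁ p) ∈ B × sc (proj₁ p) ≡ j))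
      β? p = (proj₂ p ≟ j) ×-dec leafEdge? j B (proj₁ p)

      a b : ℕ
      a = ∑ log (λ p → χ (α? p))
      b = ∑ log (λ p → χ (β? p))

      a≥ : length S ≤ a
      a≥ = unique⊆⇒length≤ (≡-dec FP._≟_ _≟_) _∈ᴸ?_ W.distinct₁ W.used

      b≥ : L * length B ≤ b
      b≥ = begin
        L * length B ≡⟨ trans (*-comm L (length B)) (sym (∑-const B L)) ⟩
        ∑ B (λ _ → L) ≤⟨ ∑-mono∈ B (λ v v∈ → W.leaf v∈) ⟩
        ∑ B (λ v → ∑ log (λ p → χ (fresh? j v p))) ≡⟨ ∑-swap B log _ ⟩
        ∑ log (λ p → ∑ B (λ v → χ (fresh? j v p))) ≤⟨ ∑-mono log (λ p → perEntry p (β? p)) ⟩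
        b ∎
        where
        perEntry : ∀ p (q : Dec (proj₂ p ≡ j × (hv G hd (proj₁ p) ∈ B × sc (proj₁ p) ≡ j))) → ∑ B (λ v → χ (fresh? j v p)) ≤ χ q
        perEntry (e , i) (yes _) = ≤-trans (∑-mono B (λ v → χ-mono (fresh? j v (e , i)) (v FP.≟ target e j) (λ { ((_ , eq) , _) → sym eq }))) atMost
          where
          atMost : ∑ B (λ v → χ (v FP.≟ target e j)) ≤ 1
          atMost = ≤-trans (≤-reflexive (∑-cong B (λ v → trans (χ-cong (v FP.≟ target e j) (target e j FP.≟ v) sym sym) (sym (*-identityʳ _))))) (byCases (target e j ∈? B))
            where
            byCases : Dec (target e j ∈ B) → ∑ B (λ v → χ (target e j FP.≟ v) * 1) ≤ 1
            byCases (yes ∈B) = ≤-reflexive (∑-δ FP._≟_ W.distinct₂ (λ _ → 1) ∈B)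
            byCases (no ∉B)  = ≤-trans (≤-reflexive (∑-δ-∉ FP._≟_ B (target e j) (λ _ → 1) ∉B)) z≤n
        perEntry (e , i) (no ¬β) = ≤-reflexive (trans (∑-cong∈ B (λ v v∈ → χ-no (fresh? j v (e , i))
          (λ { ((refl , eq) , refl) → ¬β (refl , subst (_∈ B) (trans (sym eq) (cong (λ c → head G c e) (side-scale e))) v∈ , refl) }))) (∑-zero B))

      pointwise : ∀ p → p ∈ log → t * ((t + m) ^ χ (α? p) * (t * Y j) ^ χ (β? p)) ≤ weight S B j (proj₁ p) * (t ^ χ (α? p) * t ^ χ (β? p))
      pointwise (e , i) _ with α? (e , i) | β? (e , i)
      -- A tree entry lies above the scale of its edge, a leaf entry exactly at it.
      ... | yes p∈S | yes (i≡j , _ , sc≡j) = contradiction (≤-trans (W.old p∈S) (≤-reflexive (trans i≡j (sym sc≡j)))) 1+n≰n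
      ... | yes p∈S | no _ = begin
        t * ((t + m) * 1 * 1) ≡⟨ e₁ t m ⟩
        (t + m * 1) * (t * 1 * 1) ≤⟨ *-monoˡ-≤ (t * 1 * 1) (+-monoʳ-≤ t (≤-trans (*-monoʳ-≤ m (≤-trans (1≤χ (e FP.≟ e) refl) (∈⇒≤∑ (λ p → χ (proj₁ p FP.≟ e)) p∈S))) (m≤m+n _ _))) ⟩
        weight S B j e * (t * 1 * 1) ∎
        where
        e₁ : ∀ t m → t * ((t + m) * 1 * 1) ≡ (t + m * 1) * (t * 1 * 1)
        e₁ = solve-∀
      ... | no _ | yes (_ , q) = begin
        t * (1 * (t * Y j * 1)) ≡⟨ e₁ t (Y j) ⟩
        t * Y j * 1 * (1 * (t * 1)) ≡⟨ cong (λ z → t * Y j * z * (1 * (t * 1))) (χ-yes (leafEdge? j B e) q) ⟨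
        t * Y j * χ (leafEdge? j B e) * (1 * (t * 1)) ≤⟨ *-monoˡ-≤ (1 * (t * 1)) (≤-trans (m≤n+m _ (m * ∑ S (λ p → χ (proj₁ p FP.≟ e)))) (m≤n+m _ t)) ⟩
        weight S B j e * (1 * (t * 1)) ∎
        where
        e₁ : ∀ t y → t * (1 * (t * y * 1)) ≡ t * y * 1 * (1 * (t * 1))
        e₁ = solve-∀
      ... | no _ | no _ = ≤-trans (≤-reflexive (*-identityʳ t)) (≤-trans (m≤m+n t _) (≤-reflexive (sym (*-identityʳ _))))

      log-product : t ^ length log * ((t + m) ^ a * (t * Y j) ^ b) ≤ ∏ log (weight S B j ∘ proj₁) * (t ^ a * t ^ b)
      log-product = begin
        t ^ length log * ((t + m) ^ a * (t * Y j) ^ b)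
          ≡⟨ cong₂ _*_ (∏-const log t) (trans (∏-* log _ _) (cong₂ _*_ (∏-^ log (t + m) (λ p → χ (α? p))) (∏-^ log (t * Y j) (λ p → χ (β? p))))) ⟨
        ∏ log (λ _ → t) * ∏ log (λ p → (t + m) ^ χ (α? p) * (t * Y j) ^ χ (β? p))
          ≡⟨ ∏-* log _ _ ⟨
        ∏ log (λ p → t * ((t + m) ^ χ (α? p) * (t * Y j) ^ χ (β? p)))
          ≤⟨ ∏-mono∈ log pointwise ⟩
        ∏ log (λ p → weight S B j (proj₁ p) * (t ^ χ (α? p) * t ^ χ (β? p)))
          ≡⟨ trans (∏-* log _ _) (cong (∏ log (weight S B j ∘ proj₁) *_) (trans (∏-* log _ _) (cong₂ _*_ (∏-^ log t (λ p → χ (α? p))) (∏-^ log t (λ p → χ (β? p)))))) ⟩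
        ∏ log (weight S B j ∘ proj₁) * (t ^ a * t ^ b) ∎

    -- Relative to the untilted weight `t`, a tree entry gains at least `m/t` and a fresh entry at a
    -- leaf gains `Y j`. There may be more such entries than required; the surplus does no harm,
    -- since every gain is at least 1.
    log-weight : t ^ length log * (m ^ length S * Y j ^ (L * length B)) ≤ t ^ length S * ∏ log (weight S B j ∘ proj₁)
    log-weight = *-cancelʳ-≤ _ _ (t ^ r * t ^ b) {{m*n≢0 (t ^ r) (t ^ b) {{m^n≢0 t r {{>-nonZero t≥1}}}} {{m^n≢0 t b {{>-nonZero t≥1}}}}}} (begin
      t ^ length log * (m ^ h * Y j ^ (L * length B)) * (t ^ r * t ^ b)
        ≤⟨ *-monoˡ-≤ (t ^ r * t ^ b) (*-monoʳ-≤ (t ^ length log) (*-monoʳ-≤ (m ^ h) (^-monoʳ-≤ (Y j) {{>-nonZero (Y≥1 j)}} b≥))) ⟩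
      t ^ length log * (m ^ h * Y j ^ b) * (t ^ r * t ^ b)
        ≡⟨ e₁ (t ^ length log) (m ^ h) (Y j ^ b) (t ^ r) (t ^ b) ⟩
      t ^ length log * (m ^ h * t ^ r * (t ^ b * Y j ^ b))
        ≡⟨ cong (λ z → t ^ length log * (m ^ h * t ^ r * z)) (^-distribʳ-* b t (Y j)) ⟨
      t ^ length log * (m ^ h * t ^ r * (t * Y j) ^ b)
        ≤⟨ *-monoʳ-≤ (t ^ length log) (*-monoˡ-≤ ((t * Y j) ^ b) (*-mono-≤ (^-monoˡ-≤ h (m≤n+m m t)) (^-monoˡ-≤ r (m≤m+n t m)))) ⟩
      t ^ length log * ((t + m) ^ h * (t + m) ^ r * (t * Y j) ^ b)
        ≡⟨ cong (λ z → t ^ length log * (z * (t * Y j) ^ b)) (trans (sym (^-distribˡ-+-* (t + m) h r)) (cong ((t + m) ^_) h+r)) ⟩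
      t ^ length log * ((t + m) ^ a * (t * Y j) ^ b)
        ≤⟨ log-product ⟩
      Π * (t ^ a * t ^ b)
        ≡⟨ cong (λ z → Π * (z * t ^ b)) (trans (cong (t ^_) (sym h+r)) (^-distribˡ-+-* t h r)) ⟩
      Π * (t ^ h * t ^ r * t ^ b)
        ≡⟨ e₂ Π (t ^ h) (t ^ r) (t ^ b) ⟩
      t ^ h * Π * (t ^ r * t ^ b) ∎)
      where
      h r Π : ℕ
      h = length S
      r = a ∸ h
      Π = ∏ log (weight S B j ∘ proj₁)
      h+r : h + r ≡ a
      h+r = m+[n∸m]≡n a≥
      e₁ : ∀ x y z u v → x * (y * z) * (u * v) ≡ x * (y * u * (v * z))
      e₁ = solve-∀
      e₂ : ∀ p x y z → p * (x * y * z) ≡ x * p * (y * z)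
      e₂ = solve-∀

  tilted : (D j : ℕ) → Vec (Edge G) t → ℕ
  tilted D j s = ∑ vs (λ v → ∑ (trees D j (v ∷ [])) (λ SB → ∏ (toList s) (weight (proj₁ SB) (proj₂ SB) j)))

  threshold : (D j : ℕ) → ℕ
  threshold D j = t ^ t * (m ^ edgeNumber D 1 * Y j ^ (L * 4 ^ D))

  -- The arrivals left over when the algorithm gets stuck still weigh at least `t` each. One witness
  -- tree therefore lifts a single summand of `tilted` to the threshold, whatever the times of its
  -- arrivals.
  stuck-tilted : (M : ℕ) → 1 ≤ M → 9 * M ≤ L → (s : Vec (Edge G) t) → Balanced G s M → Stuck [] (toList s) →
    ∃[ D ] ∃[ j ] (D + j ≡ k × threshold D j ≤ t ^ edgeNumber D 1 * tilted D j s)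
  stuck-tilted M M≥1 9M≤L s bal St with fullWitness (Stuck.valid St) M M≥1 9M≤L dense (Stuck.full St)
    where
    dense : ∀ Z → ∑ (Stuck.final St) (λ p → χ (inside? G (_∈? Z) (proj₁ p))) ≤ M * length Z
    dense Z = begin
      ∑ (Stuck.final St) (λ p → χ (inside? G (_∈? Z) (proj₁ p))) ≤⟨ m≤m+n _ _ ⟩
      ∑ (Stuck.final St) (λ p → χ (inside? G (_∈? Z) (proj₁ p))) + ∑ (Stuck.remaining St) (λ e → χ (inside? G (_∈? Z) e))
                                                                     ≡⟨ Stuck.∑-split St _ ⟨
      ∑ (toList s) (λ e → χ (inside? G (_∈? Z) e)) ≤⟨ density G s bal (_∈? Z) ⟩
      M * ∑ vs (λ v → χ (v ∈? Z)) ≤⟨ *-monoʳ-≤ M (count∈≤length Z) ⟩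
      M * length Z ∎
  ... | D , j , D+j≡k , W = D , j , D+j≡k , (begin
    t ^ t * (m ^ edgeNumber D 1 * Y j ^ (L * 4 ^ D))
      ≡⟨ cong₂ (λ x y → t ^ t * (m ^ x * Y j ^ (L * y))) (sym (proj₁ size)) (sym (trans (proj₂ size) (*-identityʳ (4 ^ D)))) ⟩
    t ^ t * (m ^ length S * Y j ^ (L * length B))
      ≡⟨ cong (λ z → t ^ z * (m ^ length S * Y j ^ (L * length B))) lengths ⟩
    t ^ (length final + length remaining) * (m ^ length S * Y j ^ (L * length B))
      ≡⟨ trans (cong (_* (m ^ length S * Y j ^ (L * length B))) (^-distribˡ-+-* t (length final) (length remaining))) (*-CS.xy∙z≈xz∙y (t ^ length final) (t ^ length remaining) _) ⟩
    t ^ length final * (m ^ length S * Y j ^ (L * length B)) * t ^ length remaining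
      ≤⟨ *-mono-≤ (log-weight W) rest-weight ⟩
    t ^ length S * ∏ final (y ∘ proj₁) * ∏ remaining y
      ≡⟨ *-assoc (t ^ length S) _ _ ⟩
    t ^ length S * (∏ final (y ∘ proj₁) * ∏ remaining y)
      ≡⟨ cong₂ _*_ (cong (t ^_) (proj₁ size)) (sym (trans (sym (+-identityʳ _)) (∏-split y))) ⟩
    t ^ edgeNumber D 1 * ∏ (toList s) y
      ≤⟨ *-monoʳ-≤ (t ^ edgeNumber D 1) (≤-trans (∈⇒≤∑ (λ SB → ∏ (toList s) (weight (proj₁ SB) (proj₂ SB) j)) member)
           (∈⇒≤∑ (λ v → ∑ (trees D j (v ∷ [])) (λ SB → ∏ (toList s) (weight (proj₁ SB) (proj₂ SB) j))) (∈-allFin vertex))) ⟩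
    t ^ edgeNumber D 1 * tilted D j s ∎)
    where
    open Stuck St
    open Witness W using (member) renaming (edgesUsed to S; leaves to B)
    y : Edge G → ℕ
    y = weight S B j
    size : length S ≡ edgeNumber D 1 × length B ≡ 4 ^ D * 1
    size = trees-size D j (vertex ∷ []) member
    length-toList : ∀ {u} (s : Vec (Edge G) u) → u ≡ ∑ (toList s) (λ _ → 1)
    length-toList V.[]      = refl
    length-toList (_ V.∷ s) = cong suc (length-toList s)
    lengths : t ≡ length final + length remaining
    lengths = trans (length-toList s) (trans (∑-split (λ _ → 1)) (cong₂ _+_ (sym (length≡∑ final)) (sym (length≡∑ remaining))))
    rest-weight : t ^ length remaining ≤ ∏ remaining y
    rest-weight = ≤-trans (≤-reflexive (sym (∏-const remaining t))) (∏-mono∈ remaining (λ e _ → m≤m+n t _))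

  ∑-tilted : ∀ D j → ∑ (sequences G t) (tilted D j) * (4 * t) ^ edgeNumber D 1 ≤
    m ^ t * (t ^ t * (4 ^ (edgeNumber D 1 + L * 4 ^ D) * (n * treeBound P D j 1 * m ^ edgeNumber D 1)))
  ∑-tilted D j = begin
    ∑ seqs (tilted D j) * (4 * t) ^ h
      ≡⟨ cong (_* (4 * t) ^ h) (trans (∑-swap seqs vs _) (∑-cong vs (λ v → trans (∑-swap seqs (trees D j (v ∷ [])) _) (∑-cong (trees D j (v ∷ [])) (λ SB → ∑-∏ xs t (weight (proj₁ SB) (proj₂ SB) j)))))) ⟩
    ∑ vs (λ v → ∑ (trees D j (v ∷ [])) (λ SB → ∑ xs (weight (proj₁ SB) (proj₂ SB) j) ^ t)) * (4 * t) ^ h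
      ≤⟨ *-monoˡ-≤ ((4 * t) ^ h) (∑-mono vs (λ v → ∑-mono∈ (trees D j (v ∷ [])) (perTree v))) ⟩
    ∑ vs (λ v → ∑ (trees D j (v ∷ [])) (λ _ → w)) * (4 * t) ^ h
      ≡⟨ cong (_* (4 * t) ^ h) (trans (∑-cong vs (λ v → ∑-const (trees D j (v ∷ [])) w)) (∑-*ʳ vs w _)) ⟩
    ∑ vs (λ v → length (trees D j (v ∷ []))) * w * (4 * t) ^ h
      ≡⟨ *-CS.xy∙z≈y∙xz (∑ vs (λ v → length (trees D j (v ∷ [])))) w ((4 * t) ^ h) ⟩
    w * (∑ vs (λ v → length (trees D j (v ∷ []))) * (4 * t) ^ h)
      ≡⟨ cong (w *_) (∑-*ʳ vs ((4 * t) ^ h) _) ⟨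
    w * ∑ vs (λ v → length (trees D j (v ∷ [])) * (4 * t) ^ h)
      ≤⟨ *-monoʳ-≤ w (∑-mono vs (λ v → length-trees D j (v ∷ []))) ⟩
    w * ∑ vs (λ _ → treeBound P D j 1 * m ^ h)
      ≡⟨ cong (w *_) (trans (∑-const vs _) (trans (cong (_* (treeBound P D j 1 * m ^ h)) (length-allFin n)) (sym (*-assoc n (treeBound P D j 1) (m ^ h))))) ⟩
    w * (n * treeBound P D j 1 * m ^ h)
      ≡⟨ e₂ (m ^ t) (t ^ t) (4 ^ N) (n * treeBound P D j 1 * m ^ h) ⟩
    m ^ t * (t ^ t * (4 ^ N * (n * treeBound P D j 1 * m ^ h))) ∎
    where
    h N w : ℕ
    h = edgeNumber D 1
    N = h + L * 4 ^ D
    w = m ^ t * (t ^ t * 4 ^ N)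
    e₂ : ∀ a b c d → a * (b * c) * d ≡ a * (b * (c * d))
    e₂ = solve-∀
    perTree : ∀ v SB → SB ∈ trees D j (v ∷ []) → ∑ xs (weight (proj₁ SB) (proj₂ SB) j) ^ t ≤ w
    perTree v (S , B) SB∈ = begin
      ∑ xs (weight S B j) ^ t ≤⟨ ^-monoˡ-≤ t (∑-weight S B j) ⟩
      (m * (t + (length S + L * length B))) ^ t ≡⟨ cong₂ (λ x y → (m * (t + (x + L * y))) ^ t) (proj₁ size) (trans (proj₂ size) (*-identityʳ (4 ^ D))) ⟩
      (m * (t + N)) ^ t ≡⟨ ^-distribʳ-* t m (t + N) ⟩
      m ^ t * (t + N) ^ t ≤⟨ *-monoʳ-≤ (m ^ t) ([t+N]^t≤t^t*4^N t {{>-nonZero t≥1}} N) ⟩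
      w ∎
      where
      size : length S ≡ edgeNumber D 1 × length B ≡ 4 ^ D * 1
      size = trees-size D j (v ∷ []) SB∈

  Event : (D j : ℕ) → Vec (Edge G) t → Set
  Event D j s = threshold D j ≤ t ^ edgeNumber D 1 * tilted D j s

  event? : ∀ D j s → Dec (Event D j s)
  event? D j s = threshold D j ≤? t ^ edgeNumber D 1 * tilted D j s

  -- Markov's inequality for `tilted`. The powers of `t`, `m` and `4` belonging to the tree edges
  -- cancel, and the leaf gain `Y j ^ (L * 4 ^ D)` is left to beat the number of trees.
  event-rare : ∀ D j c → c * (4 ^ (L * 4 ^ D) * (n * treeBound P D j 1)) ≤ Y j ^ (L * 4 ^ D) →
    c * ∑ (sequences G t) (λ s → χ (event? D j s)) ≤ m ^ t
  event-rare D j c numeric = *-cancelʳ-≤ _ _ F {{F≢0}} (begin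
    c * N * F ≡⟨ e₁ c N (t ^ t) (m ^ h) (Y j ^ (L * 4 ^ D)) (4 ^ h) ⟩
    c * (threshold D j * N) * 4 ^ h ≤⟨ *-monoˡ-≤ (4 ^ h) (*-monoʳ-≤ c counted) ⟩
    c * (t ^ h * Σ′) * 4 ^ h ≡⟨ e₂ c (t ^ h) Σ′ (4 ^ h) ⟩
    c * (Σ′ * (4 ^ h * t ^ h)) ≡⟨ cong (λ z → c * (Σ′ * z)) (^-distribʳ-* h 4 t) ⟨
    c * (Σ′ * (4 * t) ^ h) ≤⟨ *-monoʳ-≤ c (∑-tilted D j) ⟩
    c * (m ^ t * (t ^ t * (4 ^ (h + L * 4 ^ D) * (n * treeBound P D j 1 * m ^ h))))
      ≡⟨ cong (λ z → c * (m ^ t * (t ^ t * (z * (n * treeBound P D j 1 * m ^ h))))) (^-distribˡ-+-* 4 h (L * 4 ^ D)) ⟩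
    c * (m ^ t * (t ^ t * (4 ^ h * 4 ^ (L * 4 ^ D) * (n * treeBound P D j 1 * m ^ h))))
      ≡⟨ e₃ c (m ^ t) (t ^ t) (4 ^ h) (4 ^ (L * 4 ^ D)) (n * treeBound P D j 1) (m ^ h) ⟩
    m ^ t * (t ^ t * (m ^ h * (c * (4 ^ (L * 4 ^ D) * (n * treeBound P D j 1)))) * 4 ^ h)
      ≤⟨ *-monoʳ-≤ (m ^ t) (*-monoˡ-≤ (4 ^ h) (*-monoʳ-≤ (t ^ t) (*-monoʳ-≤ (m ^ h) numeric))) ⟩
    m ^ t * F ∎)
    where
    h N Σ′ F : ℕ
    h  = edgeNumber D 1
    N  = ∑ seqs (λ s → χ (event? D j s))
    Σ′ = ∑ seqs (tilted D j)
    F  = threshold D j * 4 ^ h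
    instance
      t≢0 : NonZero t
      t≢0 = >-nonZero t≥1
      m≢0 : NonZero m
      m≢0 = nonempty G
      Y≢0 : NonZero (Y j)
      Y≢0 = >-nonZero (Y≥1 j)
    F≢0 : NonZero F
    F≢0 = m*n≢0 (threshold D j) (4 ^ h) {{m*n≢0 (t ^ t) _ {{m^n≢0 t t}} {{m*n≢0 (m ^ h) _ {{m^n≢0 m h}} {{m^n≢0 (Y j) (L * 4 ^ D)}}}}}} {{m^n≢0 4 h}}
    e₁ : ∀ c N a b y z → c * N * (a * (b * y) * z) ≡ c * (a * (b * y) * N) * z
    e₁ = solve-∀
    e₂ : ∀ c a s b → c * (a * s) * b ≡ c * (s * (b * a))
    e₂ = solve-∀
    e₃ : ∀ c x a y z b w → c * (x * (a * (y * z * (b * w)))) ≡ x * (a * (w * (c * (z * b))) * y)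
    e₃ = solve-∀
    counted : threshold D j * N ≤ t ^ h * Σ′
    counted = begin
      threshold D j * N ≡⟨ ∑-*ˡ seqs (threshold D j) _ ⟨
      ∑ seqs (λ s → threshold D j * χ (event? D j s)) ≤⟨ ∑-mono seqs (λ s → scaled (event? D j s)) ⟩
      ∑ seqs (λ s → t ^ h * tilted D j s) ≡⟨ ∑-*ˡ seqs (t ^ h) _ ⟩
      t ^ h * Σ′ ∎
      where
      scaled : ∀ {x y} (q : Dec (x ≤ y)) → x * χ q ≤ y
      scaled {x} (yes le) = ≤-trans (≤-reflexive (*-identityʳ x)) le
      scaled {x} (no _)   = ≤-trans (≤-reflexive (*-zeroʳ x)) z≤n

  -- The failure probability 1/2 is spent in two quarters: one for an optimum above `4 * K`, one for
  -- the witness trees, divided evenly among the `suc k` depths.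
  overflow-rare : (K : ℕ) → 1 ≤ K → 9 * (4 * K) ≤ L → ∑ (sequences G t) (offlineOpt G) ≤ K * m ^ t →
    (∀ D → D ≤ k → 4 * suc k * (4 ^ (L * 4 ^ D) * (n * treeBound P D (k ∸ D) 1)) ≤ Y (k ∸ D) ^ (L * 4 ^ D)) →
    2 * overflowCount [] t ≤ m ^ t
  overflow-rare K K≥1 36K≤L opt≤K numeric = *-cancelˡ-≤ 2 (begin
    2 * (2 * overflowCount [] t) ≡⟨ *-assoc 2 2 (overflowCount [] t) ⟨
    4 * overflowCount [] t ≤⟨ *-monoʳ-≤ 4 (≤-trans (∑-mono seqs perSequence) (≤-reflexive (trans (∑-+ seqs _ _) (cong (bad +_) (∑-swap seqs layers _))))) ⟩
    4 * (bad + ∑ layers N) ≡⟨ *-distribˡ-+ 4 bad _ ⟩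
    4 * bad + 4 * ∑ layers N ≤⟨ +-mono-≤ (markov seqs (offlineOpt G) K 4 (m ^ t) K≥1 opt≤K) events ⟩
    m ^ t + m ^ t ≡⟨ cong (m ^ t +_) (+-identityʳ (m ^ t)) ⟨
    2 * m ^ t ∎)
    where
    layers : List (Fin (suc k))
    layers = allFin (suc k)
    at? : ∀ s (i : Fin (suc k)) → Dec (Event (F.toℕ i) (k ∸ F.toℕ i) s)
    at? s i = event? (F.toℕ i) (k ∸ F.toℕ i) s
    bad : ℕ
    bad = ∑ seqs (λ s → χ (¬? (offlineOpt G s ≤? 4 * K)))
    N : Fin (suc k) → ℕ
    N i = ∑ seqs (λ s → χ (at? s i))
    events : 4 * ∑ layers N ≤ m ^ t
    events = *-cancelˡ-≤ (suc k) (begin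
      suc k * (4 * ∑ layers N) ≡⟨ e₁ (suc k) (∑ layers N) ⟩
      4 * suc k * ∑ layers N ≡⟨ ∑-*ˡ layers (4 * suc k) N ⟨
      ∑ layers (λ i → 4 * suc k * N i) ≤⟨ ∑-mono layers (λ i → event-rare (F.toℕ i) (k ∸ F.toℕ i) (4 * suc k) (numeric (F.toℕ i) (s≤s⁻¹ (FP.toℕ<n i)))) ⟩
      ∑ layers (λ _ → m ^ t) ≡⟨ trans (∑-const layers (m ^ t)) (cong (_* m ^ t) (length-allFin (suc k))) ⟩
      suc k * m ^ t ∎)
      where
      e₁ : ∀ a b → a * (4 * b) ≡ 4 * a * b
      e₁ = solve-∀
    perSequence : ∀ s → overflowing [] (toList s) ≤ χ (¬? (offlineOpt G s ≤? 4 * K)) + ∑ layers (λ i → χ (at? s i))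
    perSequence s = byCases (overflowing [] (toList s) ≟ 0) (offlineOpt G s ≤? 4 * K)
      where
      byCases : Dec (overflowing [] (toList s) ≡ 0) → (q : Dec (offlineOpt G s ≤ 4 * K)) →
        overflowing [] (toList s) ≤ χ (¬? q) + ∑ layers (λ i → χ (at? s i))
      byCases (yes eq) _       = ≤-trans (≤-reflexive eq) z≤n
      byCases (no _)   (no _)  = ≤-trans (overflowing≤1 [] (toList s)) (m≤m+n 1 _)
      byCases (no ne)  (yes q) = ≤-trans (overflowing≤1 [] (toList s)) (found (stuck-tilted (4 * K) (≤-trans K≥1 (m≤n*m K 4)) 36K≤L s bal (stuck valid-[] (toList s) ne)))
        where
        bal : Balanced G s (4 * K)
        bal = proj₁ (offlineOpt-balanced G s) , λ v → ≤-trans (proj₂ (offlineOpt-balanced G s) v) q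
        found : (∃[ D ] ∃[ j ] (D + j ≡ k × Event D j s)) → 1 ≤ ∑ layers (λ i → χ (at? s i))
        found (D , j , D+j≡k , ev) = ≤-trans (1≤χ (at? s i) ev′)
          (∈⇒≤∑ (λ i → χ (at? s i)) (∈-allFin i))
          where
          D<1+k : D < suc k
          D<1+k = s≤s (≤-trans (m≤m+n D j) (≤-reflexive D+j≡k))
          i : Fin (suc k)
          i = F.fromℕ< D<1+k
          toℕi : F.toℕ i ≡ D
          toℕi = FP.toℕ-fromℕ< D<1+k
          j≡ : j ≡ k ∸ D
          j≡ = trans (sym (m+n∸m≡n D j)) (cong (_∸ D) D+j≡k)
          ev′ : Event (F.toℕ i) (k ∸ F.toℕ i) s
          ev′ = subst (λ z → Event z (k ∸ z) s) (sym toℕi) (subst (λ z → Event D z s) j≡ ev)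

-- Numerical estimates

-- The expected values of algorithm and optimum share their denominator, so competitiveness is an
-- inequality between two sums of naturals.
≤-scaled : ∀ a b c d .{{_ : NonZero d}} → a ≤ c * b → ((ℤ.+ a) ℚ./ d) ℚ.≤ ((ℤ.+ c) ℚ./ 1) *ℚ ((ℤ.+ b) ℚ./ d)
≤-scaled a b c d@(suc d-1) a≤cb = ℚP.toℚᵘ-cancel-≤
  (ℚᵘP.≤-respˡ-≃ (ℚᵘP.≃-sym (ℚP.toℚᵘ-fromℚᵘ (mkℚᵘ (ℤ.+ a) d-1)))
  (ℚᵘP.≤-respʳ-≃ (ℚᵘP.≃-sym (ℚᵘP.≃-trans (ℚP.toℚᵘ-homo-* ((ℤ.+ c) ℚ./ 1) ((ℤ.+ b) ℚ./ d))
    (ℚᵘP.*-cong (ℚP.toℚᵘ-fromℚᵘ (mkℚᵘ (ℤ.+ c) 0)) (ℚP.toℚᵘ-fromℚᵘ (mkℚᵘ (ℤ.+ b) d-1)))))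
  (*≤* (integers a≤cb))))
  where
  integers : a ≤ c * b → (ℤ.+ a) ℤ.* (ℤ.+ (1 * d)) ℤ.≤ (ℤ.+ c) ℤ.* (ℤ.+ b) ℤ.* (ℤ.+ d)
  integers h = subst₂ ℤ._≤_ (ℤP.pos-* a (1 * d)) (trans (ℤP.pos-* (c * b) d) (cong (ℤ._* (ℤ.+ d)) (ℤP.pos-* c b)))
    (ℤ.+≤+ (≤-trans (≤-reflexive (cong (a *_) (*-identityˡ d))) (*-monoˡ-≤ d h)))

#E≤n*n : ∀ {n} (G : Graph n) → #E G ≤ n * n
#E≤n*n {n} G = begin
  length (edges G) ≤⟨ unique⊆⇒length≤ pair≟ (DecMembership._∈?_ pair≟) (distinct G) (λ {p} _ → all p) ⟩
  ∑ pairs (λ p → χ (DecMembership._∈?_ pair≟ p (edges G))) ≤⟨ ∑-mono pairs (λ p → χ≤1 (DecMembership._∈?_ pair≟ p (edges G))) ⟩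
  ∑ pairs (λ _ → 1) ≡⟨ ∑-concatMap _ (allFin n) (λ _ → 1) ⟩
  ∑ (allFin n) (λ v → ∑ (map (v ,_) (allFin n)) (λ _ → 1)) ≡⟨ ∑-cong (allFin n) (λ v → trans (∑-map (v ,_) (allFin n) (λ _ → 1)) (trans (sym (length≡∑ (allFin n))) (length-allFin n))) ⟩
  ∑ (allFin n) (λ _ → n) ≡⟨ trans (∑-const (allFin n) n) (cong (_* n) (length-allFin n)) ⟩
  n * n ∎
  where
  pair≟ : (p q : Fin n × Fin n) → Dec (p ≡ q)
  pair≟ = ≡-dec FP._≟_ FP._≟_
  pairs : List (Fin n × Fin n)
  pairs = concatMap (λ v → map (v ,_) (allFin n)) (allFin n)
  all : ∀ p → p ∈ pairs
  all (v , w) = ∈-concatMap⁺ _ (Any.map (λ { refl → ∈-map⁺ (v ,_) (∈-allFin w) }) (∈-allFin v))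

n≤2^⌈log₂n⌉ : ∀ n → n ≤ 2 ^ ⌈log₂ n ⌉
n≤2^⌈log₂n⌉ n = go n n ≤-refl
  where
  go : ∀ fuel n → n ≤ fuel → n ≤ 2 ^ ⌈log₂ n ⌉
  go _          zero                _  = z≤n
  go _          (suc zero)          _  = m^n>0 2 ⌈log₂ 1 ⌉
  go (suc fuel) n@(suc (suc n-2)) le = begin
    n ≡⟨ ⌊n/2⌋+⌈n/2⌉≡n n ⟨
    ⌊ n /2⌋ + ⌈ n /2⌉ ≤⟨ +-monoˡ-≤ ⌈ n /2⌉ (⌊n/2⌋≤⌈n/2⌉ n) ⟩
    ⌈ n /2⌉ + ⌈ n /2⌉ ≤⟨ +-mono-≤ half half ⟩
    2 ^ l′ + 2 ^ l′ ≡⟨ cong (2 ^ l′ +_) (+-identityʳ (2 ^ l′)) ⟨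
    2 ^ suc l′ ≡⟨ cong (λ z → 2 ^ suc z) (⌈log₂⌈n/2⌉⌉≡⌈log₂n⌉∸1 n) ⟩
    2 ^ suc (⌈log₂ n ⌉ ∸ 1) ≡⟨ cong (2 ^_) (m+[n∸m]≡n (⌈log₂⌉-mono-≤ {2} {n} (s≤s (s≤s z≤n)))) ⟩
    2 ^ ⌈log₂ n ⌉ ∎
    where
    l′ : ℕ
    l′ = ⌈log₂ ⌈ n /2⌉ ⌉
    half : ⌈ n /2⌉ ≤ 2 ^ l′
    half = go fuel ⌈ n /2⌉ (s≤s⁻¹ (≤-trans (⌈n/2⌉<n n-2) le))

n≤2^2^loglog : ∀ n → n ≤ 2 ^ (2 ^ loglog n)
n≤2^2^loglog n = ≤-trans (n≤2^⌈log₂n⌉ n) (^-monoʳ-≤ 2 (n≤2^⌈log₂n⌉ ⌈log₂ n ⌉))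

loglog≥1 : ∀ {n} → 3 ≤ n → 1 ≤ loglog n
loglog≥1 n≥3 = ⌈log₂⌉-mono-≤ (⌈log₂⌉-mono-≤ n≥3)

-- X j governs the in-degree d j ≈ 2Km/(tX) of scale j; the leaves of scale j use the tilt Y j.
module Parameters (K : ℕ) (K≥1 : 1 ≤ K) where

  X Y P Q : ℕ → ℕ
  X j = 2 ^ pred (2 ^ j)
  Y j = 4 * 2 ^ (2 ^ j)
  -- In `16 * K * Q j` the base `64 * X (suc j)` is `2 ^ (5 + 2 ^ suc j)`. The exponent is thus at
  -- most `5K + 50K + 20K * 2 ^ j`, which is at most `75K * 2 ^ j`.
  P j = 2 ^ (75 * K * 2 ^ j)
  Q j = (64 * X (suc j)) ^ (10 * K)

  capacityL : ℕ
  -- Four tree edges at `75 * K` each, plus 2 for the factor `4 ^ a` of `treeBound`.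
  capacityL = 302 * K

  2*X≡ : ∀ j → 2 * X j ≡ 2 ^ (2 ^ j)
  2*X≡ j = cong (2 ^_) (suc-pred (2 ^ j) {{m^n≢0 2 j}})

  X≥1 : ∀ j → 1 ≤ X j
  X≥1 j = m^n>0 2 (pred (2 ^ j))

  Q≥1 : ∀ j → 1 ≤ Q j
  Q≥1 j = m^n>0 (64 * X (suc j)) {{m*n≢0 64 (X (suc j)) {{_}} {{>-nonZero (X≥1 (suc j))}}}} (10 * K)

  16KQ≤P : ∀ j → 16 * K * Q j ≤ P j
  16KQ≤P j = begin
    16 * K * Q j ≡⟨ cong (λ z → 16 * K * z ^ (10 * K)) (trans (*-assoc 32 2 (X (suc j))) (trans (cong (32 *_) (2*X≡ (suc j))) (sym (^-distribˡ-+-* 2 5 (2 ^ suc j))))) ⟩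
    16 * K * (2 ^ (5 + 2 ^ suc j)) ^ (10 * K) ≡⟨ cong (16 * K *_) (^-*-assoc 2 (5 + 2 ^ suc j) (10 * K)) ⟩
    16 * K * 2 ^ E ≤⟨ *-monoˡ-≤ (2 ^ E) (≤-trans (*-monoʳ-≤ 16 (<⇒≤ (n<2^n K))) (≤-reflexive (sym (^-distribˡ-+-* 2 4 K)))) ⟩
    2 ^ (4 + K) * 2 ^ E ≡⟨ ^-distribˡ-+-* 2 (4 + K) E ⟨
    2 ^ (4 + K + E) ≤⟨ ^-monoʳ-≤ 2 exponents ⟩
    P j ∎
    where
    E : ℕ
    E = (5 + 2 ^ suc j) * (10 * K)
    e₁ : ∀ K x → 4 * K + K + (5 + 2 * x) * (10 * K) ≡ 55 * K * 1 + 20 * K * x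
    e₁ = solve-∀
    e₂ : ∀ K x → 55 * K * x + 20 * K * x ≡ 75 * K * x
    e₂ = solve-∀
    exponents : 4 + K + E ≤ 75 * K * 2 ^ j
    exponents = begin
      4 + K + E ≤⟨ +-monoˡ-≤ E (+-monoˡ-≤ K (*-monoʳ-≤ 4 K≥1)) ⟩
      4 * K + K + E ≡⟨ e₁ K (2 ^ j) ⟩
      55 * K * 1 + 20 * K * 2 ^ j ≤⟨ +-monoˡ-≤ (20 * K * 2 ^ j) (*-monoʳ-≤ (55 * K) (m^n>0 2 j)) ⟩
      55 * K * 2 ^ j + 20 * K * 2 ^ j ≡⟨ e₂ K (2 ^ j) ⟩
      75 * K * 2 ^ j ∎

  2*P≤P : ∀ j → P j + P j ≤ P (suc j)
  2*P≤P j = begin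
    P j + P j ≡⟨ cong (P j +_) (+-identityʳ (P j)) ⟨
    2 ^ suc (75 * K * 2 ^ j) ≤⟨ ^-monoʳ-≤ 2 (≤-trans (+-monoˡ-≤ (75 * K * 2 ^ j) (≤-trans (≤-trans K≥1 (m≤n*m K 75)) (m≤m*n (75 * K) (2 ^ j) {{m^n≢0 2 j}}))) (≤-reflexive (e (75 * K) (2 ^ j)))) ⟩
    P (suc j) ∎
    where
    e : ∀ a x → a * x + a * x ≡ a * (2 * x)
    e = solve-∀

  -- The potential `capacityL * a * 2 ^ i` doubles with each step down, because `a` quadruples while
  -- `2 ^ i` halves. The gain, equal to the old potential, is what the factor
  -- `4 ^ a * P i ^ (4 * a)` of that level may cost.
  treeBound≤ : ∀ D j a → treeBound P D j a * 2 ^ (capacityL * a * 2 ^ (D + j)) ≤ 2 ^ (2 ^ j * (capacityL * (4 ^ D * a)))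
  treeBound≤ zero j a = ≤-reflexive (trans (+-identityʳ _) (cong (2 ^_) (e capacityL a (2 ^ j))))
    where
    e : ∀ l a x → l * a * x ≡ x * (l * (1 * a))
    e = solve-∀
  treeBound≤ (suc D) j a = begin
    4 ^ a * P i ^ (4 * a) * R * 2 ^ (L * a * 2 ^ i)
      ≡⟨ cong₂ (λ x y → x * y * R * 2 ^ (L * a * 2 ^ i)) (^-*-assoc 2 2 a) (^-*-assoc 2 (75 * K * 2 ^ i) (4 * a)) ⟩
    2 ^ (2 * a) * 2 ^ (75 * K * 2 ^ i * (4 * a)) * R * 2 ^ (L * a * 2 ^ i)
      ≡⟨ e₁ (2 ^ (2 * a)) (2 ^ (75 * K * 2 ^ i * (4 * a))) R (2 ^ (L * a * 2 ^ i)) ⟩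
    R * (2 ^ (2 * a) * 2 ^ (75 * K * 2 ^ i * (4 * a)) * 2 ^ (L * a * 2 ^ i))
      ≡⟨ cong (R *_) (trans (cong (_* 2 ^ (L * a * 2 ^ i)) (sym (^-distribˡ-+-* 2 (2 * a) _))) (sym (^-distribˡ-+-* 2 (2 * a + 75 * K * 2 ^ i * (4 * a)) _))) ⟩
    R * 2 ^ (2 * a + 75 * K * 2 ^ i * (4 * a) + L * a * 2 ^ i)
      ≤⟨ *-monoʳ-≤ R (^-monoʳ-≤ 2 exponents) ⟩
    R * 2 ^ (L * (4 * a) * 2 ^ (D + j))
      ≤⟨ treeBound≤ D j (4 * a) ⟩
    2 ^ (2 ^ j * (L * (4 ^ D * (4 * a))))
      ≡⟨ cong (λ z → 2 ^ (2 ^ j * (L * z))) (trans (sym (*-assoc (4 ^ D) 4 a)) (cong (_* a) (*-comm (4 ^ D) 4))) ⟩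
    2 ^ (2 ^ j * (L * (4 ^ suc D * a))) ∎
    where
    i R L : ℕ
    i = suc (D + j)
    R = treeBound P D j (4 * a)
    L = capacityL
    e₁ : ∀ x y r z → x * y * r * z ≡ r * (x * y * z)
    e₁ = solve-∀
    e₃ : ∀ K a x → 2 * K * a * (2 * x) + 75 * K * (2 * x) * (4 * a) + 302 * K * a * (2 * x) ≡ 302 * K * (4 * a) * x
    e₃ = solve-∀
    exponents : 2 * a + 75 * K * 2 ^ i * (4 * a) + L * a * 2 ^ i ≤ L * (4 * a) * 2 ^ (D + j)
    exponents = begin
      2 * a + 75 * K * 2 ^ i * (4 * a) + L * a * 2 ^ i
        ≤⟨ +-monoˡ-≤ (L * a * 2 ^ i) (+-monoˡ-≤ (75 * K * 2 ^ i * (4 * a)) (≤-trans (*-monoˡ-≤ a (*-monoʳ-≤ 2 K≥1)) (m≤m*n (2 * K * a) (2 ^ i) {{m^n≢0 2 i}}))) ⟩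
      2 * K * a * 2 ^ i + 75 * K * 2 ^ i * (4 * a) + L * a * 2 ^ i
        ≡⟨ e₃ K a (2 ^ (D + j)) ⟩
      L * (4 * a) * 2 ^ (D + j) ∎

  -- The potential of the root pays for the `n` possible roots and for the factor `4 * suc k`; the
  -- factor 4 in `Y` pays for the mass that the leaves add to the measure.
  numeric : ∀ {n k} D j → D + j ≡ k → n ≤ 2 ^ (2 ^ k) →
    4 * suc k * (4 ^ (capacityL * 4 ^ D) * (n * treeBound P D j 1)) ≤ Y j ^ (capacityL * 4 ^ D)
  numeric {n} {k} D j refl n≤ = begin
    4 * suc k * (4 ^ N * (n * R)) ≡⟨ e₁ (4 * suc k) (4 ^ N) n R ⟩
    4 ^ N * (R * (4 * suc k * n)) ≤⟨ *-monoʳ-≤ (4 ^ N) (*-monoʳ-≤ R small) ⟩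
    4 ^ N * (R * 2 ^ (L * 1 * 2 ^ k)) ≤⟨ *-monoʳ-≤ (4 ^ N) (treeBound≤ D j 1) ⟩
    4 ^ N * 2 ^ (2 ^ j * (L * (4 ^ D * 1))) ≡⟨ cong (λ z → 4 ^ N * 2 ^ (2 ^ j * (L * z))) (*-identityʳ (4 ^ D)) ⟩
    4 ^ N * 2 ^ (2 ^ j * N) ≡⟨ cong (4 ^ N *_) (^-*-assoc 2 (2 ^ j) N) ⟨
    4 ^ N * (2 ^ (2 ^ j)) ^ N ≡⟨ ^-distribʳ-* N 4 (2 ^ (2 ^ j)) ⟨
    Y j ^ N ∎
    where
    L N R : ℕ
    L = capacityL
    N = L * 4 ^ D
    R = treeBound P D j 1
    e₁ : ∀ c x n r → c * (x * (n * r)) ≡ x * (r * (c * n))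
    e₁ = solve-∀
    e₂ : ∀ x → 2 * x + x + x ≡ 4 * x
    e₂ = solve-∀
    small : 4 * suc k * n ≤ 2 ^ (L * 1 * 2 ^ k)
    small = begin
      4 * suc k * n ≤⟨ *-mono-≤ (*-monoʳ-≤ 4 (≤-trans (n<2^n k) (^-monoʳ-≤ 2 (<⇒≤ (n<2^n k))))) n≤ ⟩
      2 ^ 2 * 2 ^ (2 ^ k) * 2 ^ (2 ^ k) ≡⟨ trans (cong (_* 2 ^ (2 ^ k)) (sym (^-distribˡ-+-* 2 2 (2 ^ k)))) (sym (^-distribˡ-+-* 2 (2 + 2 ^ k) (2 ^ k))) ⟩
      2 ^ (2 + 2 ^ k + 2 ^ k) ≤⟨ ^-monoʳ-≤ 2 (begin
          2 + 2 ^ k + 2 ^ k ≤⟨ +-monoˡ-≤ (2 ^ k) (+-monoˡ-≤ (2 ^ k) (*-monoʳ-≤ 2 (m^n>0 2 k))) ⟩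
          2 * 2 ^ k + 2 ^ k + 2 ^ k ≡⟨ e₂ (2 ^ k) ⟩
          4 * 2 ^ k ≤⟨ *-monoˡ-≤ (2 ^ k) (≤-trans (m≤m+n 4 298) (≤-trans (*-monoʳ-≤ 302 K≥1) (≤-reflexive (sym (*-identityʳ L))))) ⟩
          L * 1 * 2 ^ k ∎) ⟩
      2 ^ (L * 1 * 2 ^ k) ∎

-- Choice of the scales and the bound on the expected load.

module Assembly {n : ℕ} (n≥3 : 3 ≤ n) (G : Graph n) (t : ℕ) (t≥1 : 1 ≤ t) (K : ℕ) (K≥1 : 1 ≤ K)
  (opt≤K : ∑ (sequences G t) (offlineOpt G) ≤ K * #E G ^ t) (10K≤t : 10 * K ≤ t) where

  open Parameters K K≥1

  private
    m : ℕ
    m = #E G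
    xs : List (Edge G)
    xs = allEdges G

  k : ℕ
  -- There may be about `n * n` edges, hence one more than `loglog n`: with `w = 2 ^ loglog n`,
  -- `2 * m` can only be bounded by `2 ^ (2w + 1)`, and `X (suc k)` is `2 ^ (4w - 1)`.
  k = suc (loglog n)

  private
    tX≢0 : ∀ j → NonZero (t * X j)
    tX≢0 j = m*n≢0 t (X j) {{>-nonZero t≥1}} {{>-nonZero (X≥1 j)}}

  d : ℕ → ℕ
  d j = _/_ (2 * K * m) (t * X j) {{tX≢0 j}}

  d*tX≤ : ∀ j → d j * (t * X j) ≤ 2 * K * m
  d*tX≤ j = m/n*n≤m (2 * K * m) (t * X j) {{tX≢0 j}}

  t*d≤ : ∀ j → t * d j ≤ 2 * K * m
  t*d≤ j = begin
    t * d j ≡⟨ *-comm t (d j) ⟩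
    d j * t ≤⟨ *-monoʳ-≤ (d j) (m≤m*n t (X j) {{>-nonZero (X≥1 j)}}) ⟩
    d j * (t * X j) ≤⟨ d*tX≤ j ⟩
    2 * K * m ∎

  <tX*suc-d : ∀ j → 2 * K * m < t * X j * suc (d j)
  <tX*suc-d j = begin-strict
    2 * K * m ≡⟨ m≡m%n+[m/n]*n (2 * K * m) (t * X j) {{tX≢0 j}} ⟩
    _%_ (2 * K * m) (t * X j) {{tX≢0 j}} + d j * (t * X j) <⟨ +-monoˡ-< (d j * (t * X j)) (m%n<n (2 * K * m) (t * X j) {{tX≢0 j}}) ⟩
    t * X j + d j * (t * X j) ≡⟨ *-comm (suc (d j)) (t * X j) ⟩
    t * X j * suc (d j) ∎

  2m≤X : 2 * m ≤ X (suc k)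
  2m≤X = begin
    2 * m ≤⟨ *-monoʳ-≤ 2 (≤-trans (#E≤n*n G) (*-mono-≤ (n≤2^2^loglog n) (n≤2^2^loglog n))) ⟩
    2 * (2 ^ w * 2 ^ w) ≡⟨ cong (2 *_) (^-distribˡ-+-* 2 w w) ⟨
    2 ^ suc (w + w) ≤⟨ ^-monoʳ-≤ 2 (≤-pred (begin
        suc (suc (w + w)) ≤⟨ +-monoˡ-≤ (w + w) (+-mono-≤ (m^n>0 2 (loglog n)) (m^n>0 2 (loglog n))) ⟩
        w + w + (w + w) ≡⟨ e w ⟩
        2 ^ suc k ≡⟨ suc-pred (2 ^ suc k) {{m^n≢0 2 (suc k)}} ⟨
        suc (pred (2 ^ suc k)) ∎)) ⟩
    X (suc k) ∎
    where
    w : ℕ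
    w = 2 ^ loglog n
    e : ∀ w → w + w + (w + w) ≡ 2 * (2 * w)
    e = solve-∀

  d-end : d (suc k) ≡ 0
  d-end = m<n⇒m/n≡0 {{tX≢0 (suc k)}} (begin-strict
    2 * K * m ≡⟨ trans (cong (_* m) (*-comm 2 K)) (*-assoc K 2 m) ⟩
    K * (2 * m) ≤⟨ *-monoʳ-≤ K 2m≤X ⟩
    K * X (suc k) <⟨ *-monoˡ-< (X (suc k)) {{>-nonZero (X≥1 (suc k))}} (≤-trans (≤-trans (+-monoˡ-≤ K K≥1) (≤-trans (+-monoʳ-≤ K (m≤m+n K (8 * K))) (≤-reflexive (e K)))) 10K≤t) ⟩
    t * X (suc k) ∎)
    where
    e : ∀ K → K + (K + 8 * K) ≡ 10 * K
    e = solve-∀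

  orientation : Σ (Edge G → Bool) (λ hd → ∀ b → ∑ xs (λ e → χ (hv G hd e FP.≟ b)) ≤ d 0)
  -- `X 0` is 1, so scale 0 starts at the in-degree `2Km/t` supplied by the density of the base
  -- graph.
  orientation = low-indegree-orientation G t K opt≤K (d 0) (subst (λ z → 2 * K * m < z * suc (d 0)) (*-identityʳ t) (<tX*suc-d 0))

  hd : Edge G → Bool
  hd = proj₁ orientation

  scales : Scaling G t K opt≤K K≥1 10K≤t hd k d X t*d≤ (λ j → <⇒≤ (<tX*suc-d j)) d-end 0 (λ _ → true)
  scales = scaling G t K opt≤K K≥1 10K≤t hd k d X t*d≤ (λ j → <⇒≤ (<tX*suc-d j)) d-end (proj₂ orientation)

  module _ (sc : Edge G → ℕ) (sc≤k : ∀ e → sc e ≤ k)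
    (inDeg  : ∀ i b → ∑ xs (λ e → χ ((hv G hd e FP.≟ b) ×-dec (sc e ≟ i))) ≤ d i)
    (outDeg : ∀ i a → ∑ xs (λ e → χ ((tv G hd e FP.≟ a) ×-dec (sc e ≟ i))) ≤ Q i * d i) where

    Δ : ℕ → ℕ
    Δ zero    = 0
    Δ (suc i) = Δ i + (d i + Q i * d i)

    private
      incident : Fin n → Edge G → ℕ
      incident v e = χ (hv G hd e FP.≟ v) + χ (tv G hd e FP.≟ v)

      incident-below : ∀ i v → ∑ xs (λ e → χ (sc e <? i) * incident v e) ≤ Δ i
      incident-below zero    v = ≤-reflexive (trans (∑-cong xs (λ e → cong (_* incident v e) (χ-no (sc e <? 0) (λ ())))) (∑-zero xs))
      incident-below (suc i) v = begin
        ∑ xs (λ e → χ (sc e <? suc i) * incident v e)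
          ≤⟨ ∑-mono xs (λ e → ≤-trans (*-monoˡ-≤ (incident v e) (split e)) (≤-reflexive (e₁ (χ (sc e <? i)) (χ (sc e ≟ i)) (χ (hv G hd e FP.≟ v)) (χ (tv G hd e FP.≟ v))))) ⟩
        ∑ xs (λ e → χ (sc e <? i) * incident v e + (χ (hv G hd e FP.≟ v) * χ (sc e ≟ i) + χ (tv G hd e FP.≟ v) * χ (sc e ≟ i)))
          ≡⟨ trans (∑-+ xs _ _) (cong (∑ xs (λ e → χ (sc e <? i) * incident v e) +_) (trans (∑-+ xs _ _)
               (cong₂ _+_ (∑-cong xs (λ e → sym (χ-× (hv G hd e FP.≟ v) (sc e ≟ i)))) (∑-cong xs (λ e → sym (χ-× (tv G hd e FP.≟ v) (sc e ≟ i))))))) ⟩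
        ∑ xs (λ e → χ (sc e <? i) * incident v e) + (∑ xs (λ e → χ ((hv G hd e FP.≟ v) ×-dec (sc e ≟ i))) + ∑ xs (λ e → χ ((tv G hd e FP.≟ v) ×-dec (sc e ≟ i))))
          ≤⟨ +-mono-≤ (incident-below i v) (+-mono-≤ (inDeg i v) (outDeg i v)) ⟩
        Δ i + (d i + Q i * d i) ∎
        where
        e₁ : ∀ a b x y → (a + b) * (x + y) ≡ a * (x + y) + (x * b + y * b)
        e₁ = solve-∀
        split : ∀ e → χ (sc e <? suc i) ≤ χ (sc e <? i) + χ (sc e ≟ i)
        split e = χ≤ (sc e <? suc i) (λ lt → byCases (m<1+n⇒m<n∨m≡n lt))
          where
          byCases : sc e < i ⊎ sc e ≡ i → 1 ≤ χ (sc e <? i) + χ (sc e ≟ i)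
          byCases (inj₁ lt) = ≤-trans (1≤χ (sc e <? i) lt) (m≤m+n _ _)
          byCases (inj₂ eq) = ≤-trans (1≤χ (sc e ≟ i) eq) (m≤n+m _ _)

    -- `Δ` counts the edges at both ends, so the bound holds for every choice of sides and in
    -- particular for the alternating one.
    degree : (side : Edge G → ℕ → Bool) → ∀ i v → ∑ xs (λ e → χ ((sc e <? i) ×-dec (head G (side e i) e FP.≟ v))) ≤ Δ i
    degree side i v = ≤-trans (∑-mono xs pointwise) (incident-below i v)
      where
      pointwise : ∀ e → χ ((sc e <? i) ×-dec (head G (side e i) e FP.≟ v)) ≤ χ (sc e <? i) * incident v e
      pointwise e = ≤-trans (≤-reflexive (χ-× (sc e <? i) (head G (side e i) e FP.≟ v))) (*-monoʳ-≤ (χ (sc e <? i))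
        (χ≤ (head G (side e i) e FP.≟ v) (λ eq → byCases eq (head≡hv⊎tv G hd (side e i) e))))
        where
        byCases : head G (side e i) e ≡ v → head G (side e i) e ≡ hv G hd e ⊎ head G (side e i) e ≡ tv G hd e → 1 ≤ incident v e
        byCases eq (inj₁ h) = ≤-trans (1≤χ (hv G hd e FP.≟ v) (trans (sym h) eq)) (m≤m+n _ _)
        byCases eq (inj₂ h) = ≤-trans (1≤χ (tv G hd e FP.≟ v) (trans (sym h) eq)) (m≤n+m _ _)

    -- The newest scale needs at most `16 * K * Q i * m`, hence at most `P i * m`, as much as is
    -- allowed for all earlier scales; and `P` at least doubles.
    Δ-rate : ∀ i → 4 * t * Δ i ≤ P i * m
    Δ-rate zero    = ≤-trans (≤-reflexive (*-zeroʳ (4 * t))) z≤n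
    Δ-rate (suc i) = begin
      4 * t * (Δ i + (d i + Q i * d i)) ≡⟨ e₁ t (Δ i) (d i) (Q i) ⟩
      4 * t * Δ i + 4 * suc (Q i) * (t * d i) ≤⟨ +-mono-≤ (Δ-rate i) (*-mono-≤ (*-monoʳ-≤ 4 (+-monoˡ-≤ (Q i) (Q≥1 i))) (t*d≤ i)) ⟩
      P i * m + 4 * (Q i + Q i) * (2 * K * m) ≡⟨ cong (P i * m +_) (e₂ (Q i) K m) ⟩
      P i * m + 16 * K * Q i * m ≤⟨ +-monoʳ-≤ (P i * m) (*-monoˡ-≤ m (16KQ≤P i)) ⟩
      P i * m + P i * m ≡⟨ *-distribʳ-+ m (P i) (P i) ⟨
      (P i + P i) * m ≤⟨ *-monoˡ-≤ m (2*P≤P i) ⟩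
      P (suc i) * m ∎
      where
      e₁ : ∀ t x d q → 4 * t * (x + (d + q * d)) ≡ 4 * t * x + 4 * suc q * (t * d)
      e₁ = solve-∀
      e₂ : ∀ q K m → 4 * (q + q) * (2 * K * m) ≡ 16 * K * q * m
      e₂ = solve-∀

    leafRate : ∀ j → t * (Y j * d j) ≤ capacityL * m
    leafRate j = begin
      t * (4 * 2 ^ (2 ^ j) * d j) ≡⟨ cong (λ z → t * (4 * z * d j)) (2*X≡ j) ⟨
      t * (4 * (2 * X j) * d j) ≡⟨ e₁ t (X j) (d j) ⟩
      8 * (d j * (t * X j)) ≤⟨ *-monoʳ-≤ 8 (d*tX≤ j) ⟩
      8 * (2 * K * m) ≡⟨ e₂ K m ⟩
      16 * (K * m) ≤⟨ *-monoˡ-≤ (K * m) (m≤m+n 16 286) ⟩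
      302 * (K * m) ≡⟨ *-assoc 302 K m ⟨
      capacityL * m ∎
      where
      e₁ : ∀ t x d → t * (4 * (2 * x) * d) ≡ 8 * (d * (t * x))
      e₁ = solve-∀
      e₂ : ∀ K m → 8 * (2 * K * m) ≡ 16 * (K * m)
      e₂ = solve-∀

    open Layered G hd sc k capacityL sc≤k using (algorithm; capacity; ∑-maxLoad≤; overflowCount; side)

    overflow≤ : 2 * overflowCount [] t ≤ m ^ t
    overflow≤ = Union.overflow-rare G hd sc k capacityL sc≤k t t≥1 Δ P (degree side) Δ-rate d Y (λ j → *-mono-≤ {1} {4} (s≤s z≤n) (m^n>0 2 (2 ^ j))) inDeg leafRate
      K K≥1 (≤-trans (≤-reflexive (sym (*-assoc 9 4 K))) (*-monoˡ-≤ K (m≤m+n 36 266))) opt≤K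
      (λ D D≤k → numeric D (k ∸ D) (m+[n∸m]≡n D≤k) (≤-trans (n≤2^2^loglog n) (^-monoʳ-≤ 2 (^-monoʳ-≤ 2 (n≤1+n (loglog n))))))

    good-algorithm : ∃[ A ] (∑ (sequences G t) (λ s → maxLoad (run G A [] (toList s))) ≤ 3630 * loglog n * (K * m ^ t))
    good-algorithm = algorithm , (begin
      ∑ (sequences G t) (λ s → maxLoad (run G algorithm [] (toList s))) ≤⟨ ∑-maxLoad≤ t overflow≤ ⟩
      2 * m ^ t * suc capacity ≤⟨ *-monoʳ-≤ (2 * m ^ t) capacity≤ ⟩
      2 * m ^ t * (1815 * loglog n * K) ≡⟨ e₁ (m ^ t) (loglog n) K ⟩
      3630 * loglog n * (K * m ^ t) ∎)
      where
      e₁ : ∀ x q K → 2 * x * (1815 * q * K) ≡ 3630 * q * (K * x)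
      e₁ = solve-∀
      e₂ : ∀ q K → 1 * 1 * K + suc (suc q) * (302 * K + 302 * K) ≡ 604 * q * K + 1209 * 1 * K
      e₂ = solve-∀
      e₃ : ∀ q K → 604 * q * K + 1209 * q * K ≡ 1813 * q * K
      e₃ = solve-∀
      -- There are `loglog n + 2` layers of `604 * K` and one extra unit; as `1 ≤ loglog n`, the
      -- coefficients add up to `604 + 1208 + 1 = 1813`.
      capacity≤ : suc capacity ≤ 1815 * loglog n * K
      capacity≤ = begin
        1 + capacity ≤⟨ +-monoˡ-≤ capacity (≤-trans K≥1 (≤-reflexive (sym (*-identityˡ K)))) ⟩
        1 * 1 * K + capacity ≡⟨ e₂ (loglog n) K ⟩
        604 * loglog n * K + 1209 * 1 * K ≤⟨ +-monoʳ-≤ (604 * loglog n * K) (*-monoˡ-≤ K (*-monoʳ-≤ 1209 (loglog≥1 n≥3))) ⟩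
        604 * loglog n * K + 1209 * loglog n * K ≡⟨ e₃ (loglog n) K ⟩
        1813 * loglog n * K ≤⟨ *-monoˡ-≤ K (*-monoˡ-≤ (loglog n) (m≤m+n 1813 2)) ⟩
        1815 * loglog n * K ∎

  assembled : ∃[ A ] (∑ (sequences G t) (λ s → maxLoad (run G A [] (toList s))) ≤ 3630 * loglog n * (K * m ^ t))
  assembled = good-algorithm (Scaling.scale scales) (λ e → Scaling.upper scales e tt)
    (λ i b → ≤-trans (∑-mono xs (λ e → χ-mono ((hv G hd e FP.≟ b) ×-dec (Scaling.scale scales e ≟ i)) ((hv G hd e FP.≟ b) ×-dec (T? true ×-dec (Scaling.scale scales e ≟ i))) (λ { (p , q) → p , tt , q }))) (Scaling.inDeg scales i z≤n b))
    (λ i a → ≤-trans (∑-mono xs (λ e → χ-mono ((tv G hd e FP.≟ a) ×-dec (Scaling.scale scales e ≟ i)) ((tv G hd e FP.≟ a) ×-dec (T? true ×-dec (Scaling.scale scales e ≟ i))) (λ { (p , q) → p , tt , q }))) (Scaling.outDeg scales i z≤n a))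

-- Short sequences and the rounding of the optimum.

maxLoad-run≤length : ∀ {n} (G : Graph n) (A : OnlineAlg G) {t} (s : Vec (Edge G) t) → maxLoad (run G A [] (toList s)) ≤ t
maxLoad-run≤length G A s = maxLoad≤ (run G A [] (toList s)) (λ v → ≤-trans (load≤length (run G A [] (toList s)) v) (≤-reflexive (length-run [] s)))
  where
  length-run : ∀ past {t} (s : Vec (Edge G) t) → length (run G A past (toList s)) ≡ t
  length-run past V.[]      = refl
  length-run past (e V.∷ s) = cong suc (length-run (past ++ [ e ]) s)

-- For `t < 10 * K` there is no room for planting, but then even the trivial load `t` is of order
-- `K` and any orientation rule will do.
competitive : ∀ {n} → 3 ≤ n → (G : Graph n) (t : ℕ) → 1 ≤ t →
  ∃[ A ] (∑ (sequences G t) (λ s → maxLoad (run G A [] (toList s))) ≤ 7260 * loglog n * ∑ (sequences G t) (offlineOpt G))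
competitive {n} n≥3 G t@(suc _) t≥1 = byCases (10 * K ≤? t)
  where
  seqs : List (Vec (Edge G) t)
  seqs = sequences G t
  N M : ℕ
  N = #E G ^ t
  M = ∑ seqs (offlineOpt G)
  instance
    N≢0 : NonZero N
    N≢0 = m^n≢0 (#E G) t {{nonempty G}}
  K : ℕ
  -- Rounding up at most doubles the mean optimum `M / N`, since every nonempty sequence has optimum
  -- at least 1; this is the factor from 3630 to 7260.
  K = suc (M / N)
  M≤KN : M ≤ K * N
  M≤KN = ≤-trans (≤-reflexive (m≡m%n+[m/n]*n M N)) (+-monoˡ-≤ (M / N * N) (<⇒≤ (m%n<n M N)))
  N≤M : N ≤ M
  N≤M = begin
    N ≡⟨ length-sequences G t ⟨
    length seqs ≡⟨ length≡∑ seqs ⟩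
    ∑ seqs (λ _ → 1) ≤⟨ ∑-mono seqs (offlineOpt≥1 G) ⟩
    M ∎
  KN≤2M : K * N ≤ 2 * M
  KN≤2M = ≤-trans (+-mono-≤ N≤M (m/n*n≤m M N)) (≤-reflexive (cong (M +_) (sym (+-identityʳ M))))
  scaleUp : ∀ {a c} → a ≤ c * loglog n * (K * N) → c ≤ 3630 → a ≤ 7260 * loglog n * M
  scaleUp {a} {c} h c≤ = begin
    a ≤⟨ h ⟩
    c * loglog n * (K * N) ≤⟨ *-mono-≤ (*-monoˡ-≤ (loglog n) c≤) KN≤2M ⟩
    3630 * loglog n * (2 * M) ≡⟨ e (loglog n) M ⟩
    7260 * loglog n * M ∎
    where
    e : ∀ q x → 3630 * q * (2 * x) ≡ 7260 * q * x
    e = solve-∀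
  byCases : Dec (10 * K ≤ t) → ∃[ A ] (∑ seqs (λ s → maxLoad (run G A [] (toList s))) ≤ 7260 * loglog n * M)
  byCases (yes 10K≤t) = proj₁ good , scaleUp {c = 3630} (proj₂ good) ≤-refl
    where
    good : _
    good = Assembly.assembled n≥3 G t t≥1 K (s≤s z≤n) M≤KN 10K≤t
  byCases (no 10K≰t) = A₀ , scaleUp {c = 10} (begin
    ∑ seqs (λ s → maxLoad (run G A₀ [] (toList s))) ≤⟨ ∑-mono seqs (maxLoad-run≤length G A₀) ⟩
    ∑ seqs (λ _ → t) ≡⟨ trans (∑-const seqs t) (cong (_* t) (length-sequences G t)) ⟩
    N * t ≤⟨ *-monoʳ-≤ N (<⇒≤ (≰⇒> 10K≰t)) ⟩
    N * (10 * K) ≡⟨ e N K ⟩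
    10 * 1 * (K * N) ≤⟨ *-monoˡ-≤ (K * N) (*-monoʳ-≤ 10 (loglog≥1 n≥3)) ⟩
    10 * loglog n * (K * N) ∎) (m≤m+n 10 3620)
    where
    A₀ : OnlineAlg G
    A₀ _ _ = true
    e : ∀ x K → x * (10 * K) ≡ 10 * 1 * (K * x)
    e = solve-∀

theorem1p1 : ∃[ C ] (∀ (n : ℕ) → n ≥ 3 → (G : Graph n) → (T : ℕ) → T ≥ 1 →
    ∃[ A ] (ALG G T A ℚ.≤ ((ℤ.+ (C * loglog n)) ℚ./ 1) *ℚ OPT G T))
theorem1p1 = 7260 , λ n n≥3 G T T≥1 → proj₁ (competitive n≥3 G T T≥1) , bound n n≥3 G T T≥1
  where
  bound : ∀ n (n≥3 : n ≥ 3) (G : Graph n) T (T≥1 : T ≥ 1) →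
    ALG G T (proj₁ (competitive n≥3 G T T≥1)) ℚ.≤ ((ℤ.+ (7260 * loglog n)) ℚ./ 1) *ℚ OPT G T
  bound n n≥3 G T T≥1 = ≤-scaled (sum (map alg (sequences G T))) (sum (map (offlineOpt G) (sequences G T))) (7260 * loglog n) (#E G ^ T) {{m^n≢0 (#E G) T {{nonempty G}}}}
    (subst₂ (λ a b → a ≤ 7260 * loglog n * b) (sym (sum-map alg (sequences G T))) (sym (sum-map (offlineOpt G) (sequences G T))) (proj₂ (competitive n≥3 G T T≥1)))
    where
    alg : Vec (Edge G) T → ℕ
    alg s = maxLoad (run G (proj₁ (competitive n≥3 G T T≥1)) [] (toList s))
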